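{- For every nonnegative integer $n$, \begin{align*} v_0(3^2(96n+68)) &\equiv 0\pmod{27},\\ v_0(3^3(96n+44)) &\equiv 0\pmod{27},\\ v_0(3^3(96n+76)) &\equiv 0\pmod{27}. \end{align*}
   Context: The integer sequence $v_0(n)$, $n\ge 0$, is defined by the generating function (formal power series in $q$) $$\sum_{n=0}^\infty v_0(n)q^n=\sum_{n=0}^\infty \frac{q^{n^2}(-q;q^2)_n}{(q;q^2)_n},$$ where $(a;q)_0=1$ and $(a;q)_n=\prod_{i=1}^n(1-aq^{i-1})$ for $n\ge1$, so that $(-q;q^2)_n=\prod_{i=1}^n(1+q^{2i-1})$ and $(q;q^2)_n=\prod_{i=1}^n(1-q^{2i-1})$. -}

module Defs where

open import Data.Nat.Base as ℕ using (ℕ; zero; suc; _∸_; z≤n; s≤s)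
import Data.Nat.Properties as ℕ
open import Data.Integer.Base using (ℤ; +_; 0ℤ; 1ℤ; _+_; _-_; _*_; -_)
open import Data.Integer.Properties
  using (+-*-semiring; *-identityˡ; *-zeroˡ; +-identityˡ; +-identityʳ; +-inverseˡ)
open import Data.Fin.Base using (Fin; zero; suc; toℕ)
import Data.Fin.Properties as Fin
open import Data.Vec.Base using (Vec; []; _∷_; head; lookup)
open import Function.Base using (_∘_)
open import Relation.Binary.PropositionalEquality
  using (_≡_; _≗_; refl; sym; trans; cong; cong₂; module ≡-Reasoning)
open import Algebra.Properties.Semiring.Sum +-*-semiring
  using (sum-syntax; sum⁺-syntax; sum-cong-≗; sum-replicate-zero)

-- ℤ[[q]]: a series is its sequence of coefficients.
Series : Set
Series = ℕ → ℤ

infixl 6 _⊖_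
infixl 7 _⊛_ _⊘_
infixr 8 _↑_
infix  9 ⊝_

𝟙 : Series
𝟙 zero    = 1ℤ
𝟙 (suc _) = 0ℤ

q : Series
q zero          = 0ℤ
q (suc zero)    = 1ℤ
q (suc (suc _)) = 0ℤ

⊝_ : Series → Series
(⊝ f) n = - f n

_⊖_ : Series → Series → Series
(f ⊖ g) n = f n - g n

_⊛_ : Series → Series → Series
(f ⊛ g) n = ∑[ i ≤ n ] (f (toℕ i) * g (n ∸ toℕ i))

_↑_ : Series → ℕ → Series
f ↑ zero  = 𝟙
f ↑ suc k = f ⊛ f ↑ k

-- For f with constant term 1, the inverse g = f⁻¹ is determined by
--   g₀ = 1,   gₙ₊₁ = - Σ_{i ≤ n} fᵢ₊₁ gₙ₋ᵢ.
-- The vector holds gₙ , … , g₀, in that order.  The constant term of f is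
-- never inspected: the result is an inverse only when it is 1 (⊛-inverseʳ).
inverseCoeffs : Series → (n : ℕ) → Vec ℤ (suc n)
inverseCoeffs f zero    = 1ℤ ∷ []
inverseCoeffs f (suc n) =
  - (∑[ i ≤ n ] (f (suc (toℕ i)) * lookup (inverseCoeffs f n) i)) ∷ inverseCoeffs f n

inverse : Series → Series
inverse f n = head (inverseCoeffs f n)

_⊘_ : Series → Series → Series
f ⊘ g = f ⊛ inverse g

-- (a ; b)ₙ = ∏_{i=1}^{n} (1 - a bⁱ⁻¹)
poch : Series → Series → ℕ → Series
poch a b zero    = 𝟙
poch a b (suc n) = poch a b n ⊛ (𝟙 ⊖ a ⊛ b ↑ n)

-- The formal sum Σ_{n ≥ 0} F n of a family in which qⁿ divides F n: only the
-- members F 0 , … , F N can contribute to the coefficient of q^N.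
∑∞ : (ℕ → Series) → Series
∑∞ F N = ∑[ n ≤ N ] F (toℕ n) N

v₀-term : ℕ → Series
v₀-term n = (q ↑ (n ℕ.* n) ⊛ poch (⊝ q) (q ↑ 2) n) ⊘ poch q (q ↑ 2) n

v₀ : ℕ → ℤ
v₀ = ∑∞ v₀-term

-- The remaining lemmas justify the two conventions above: the inverse is
-- applied only to series with constant term 1, and the terms dropped by ∑∞ vanish.

private
  lookup-inverseCoeffs : ∀ f n (i : Fin (suc n)) →
    lookup (inverseCoeffs f n) i ≡ inverse f (n ∸ toℕ i)
  lookup-inverseCoeffs f zero    zero    = refl
  lookup-inverseCoeffs f (suc n) zero    = refl
  lookup-inverseCoeffs f (suc n) (suc i) = lookup-inverseCoeffs f n i

  sum-zero : ∀ n {t : Fin n → ℤ} → (∀ i → t i ≡ 0ℤ) → (∑[ i < n ] t i) ≡ 0ℤ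
  sum-zero n t≡0 = trans (sum-cong-≗ t≡0) (sum-replicate-zero n)

⊛-inverseʳ : ∀ f → f 0 ≡ 1ℤ → f ⊛ inverse f ≗ 𝟙
⊛-inverseʳ f f₀≡1 zero    = trans (+-identityʳ _) (cong (_* 1ℤ) f₀≡1)
⊛-inverseʳ f f₀≡1 (suc n) = begin
  f 0 * (- S) + (∑[ i ≤ n ] (f (suc (toℕ i)) * inverse f (n ∸ toℕ i)))
    ≡⟨ cong₂ _+_ (trans (cong (_* (- S)) f₀≡1) (*-identityˡ (- S)))
         (sum-cong-≗ λ i → cong (f (suc (toℕ i)) *_) (sym (lookup-inverseCoeffs f n i))) ⟩
  - S + S
    ≡⟨ +-inverseˡ S ⟩
  0ℤ ∎
  where
  open ≡-Reasoning
  S : ℤ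
  S = ∑[ i ≤ n ] (f (suc (toℕ i)) * lookup (inverseCoeffs f n) i)

poch-q-constant : ∀ b n → poch q b n 0 ≡ 1ℤ
poch-q-constant b zero    = refl
poch-q-constant b (suc n) = cong (λ c → c * 1ℤ + 0ℤ) (poch-q-constant b n)

⊛-vanishes : ∀ {k} f g → (∀ {m} → m ℕ.< k → f m ≡ 0ℤ) →
             ∀ {m} → m ℕ.< k → (f ⊛ g) m ≡ 0ℤ
⊛-vanishes f g f≡0 {m} m<k = sum-zero (suc m) λ i →
  trans (cong (_* g (m ∸ toℕ i)) (f≡0 (ℕ.≤-<-trans (ℕ.≤-pred (Fin.toℕ<n i)) m<k)))
        (*-zeroˡ (g (m ∸ toℕ i)))

q↑-vanishes : ∀ k {m} → m ℕ.< k → (q ↑ k) m ≡ 0ℤ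
q↑-vanishes (suc k) {zero}  _         = refl
q↑-vanishes (suc k) {suc m} (s≤s m<k) = begin
  0ℤ + (1ℤ * (q ↑ k) m + (∑[ i < m ] (0ℤ * (q ↑ k) (m ∸ suc (toℕ i)))))
    ≡⟨ +-identityˡ _ ⟩
  1ℤ * (q ↑ k) m + (∑[ i < m ] (0ℤ * (q ↑ k) (m ∸ suc (toℕ i))))
    ≡⟨ cong₂ _+_ (trans (*-identityˡ _) (q↑-vanishes k m<k)) (sum-zero m λ _ → refl) ⟩
  0ℤ ∎
  where open ≡-Reasoning

v₀-term-vanishes : ∀ n {N} → N ℕ.< n → v₀-term n N ≡ 0ℤ
v₀-term-vanishes n@(suc _) N<n =
  ⊛-vanishes (q ↑ (n ℕ.* n) ⊛ poch (⊝ q) (q ↑ 2) n) (inverse (poch q (q ↑ 2) n))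
    (⊛-vanishes (q ↑ (n ℕ.* n)) (poch (⊝ q) (q ↑ 2) n) (q↑-vanishes (n ℕ.* n)))
    (ℕ.<-≤-trans N<n (ℕ.m≤m*n n n))

{-# OPTIONS --safe #-}

-- Write V for the generating function.  Extended to all integers n, its terms
-- q^{n²} (-q;q²)ₙ / (q;q²)ₙ sum to V(q) + V(-q) - 1.  Multiply by
-- (q;q²)_∞ (-q;q²)_∞ and expand by Euler: one gets the sum over n ∈ ℤ and
-- k, l ≥ 0 of (-1)ᵏ q^{(n+k)²+(n-l)²} / ((q²;q²)ₖ (q²;q²)ₗ), where the sum
-- over n depends on k + l only and Gauss's identity evaluates the rest.  Hence
--   φ(-q⁴) (V(q) + V(-q) - 1) = φ(q²)²
-- for Ramanujan's theta functions φ and ψ.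
-- Repeated 2-dissection turns this into
--   2 Σ v₀(32n+4) qⁿ = 6 ψ(q) + 1024 q ψ(q)⁹ / φ(-q)⁸ = 6 ψ + 1024 q ρ²⁷ φ(-q),
-- with ρ = (-q;q)_∞ and ψ = ρ³ φ(-q).  The 3-dissections of ψ and φ(-q) give
-- ρ³ = ρ(q³) (1 + w) / (1 - 2w), w being q times a series in q³.  Modulo 27
-- therefore ρ²⁷ ≡ ρ(q³)⁹, and two 3-sections lead to
--   2 Σ v₀(288n+36) qⁿ ≡ 4 ψ(q) - 18 q ψ(q⁹)  (mod 27).
-- The exponents of the theorem are those where both terms on the right vanish.

module Submission where

open import Defs
open import Data.Nat.Base using (ℕ; zero; suc; _+_; _*_; _^_; _∸_; _≤_; _<_; z≤n; s≤s)
open import Data.Integer.Base using (+_)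
open import Data.Integer.Divisibility using (_∣_)
open import Data.Product.Base using (_×_; _,_)
import Data.Nat.Properties as ℕ
open import Data.Nat.Solver using (module +-*-Solver)
open import Data.Integer.Base as ℤ using (ℤ; 0ℤ; 1ℤ)
open import Data.Integer.Divisibility.Signed using (divides; ∣⇒∣ᵤ)
import Data.Integer.Properties as ℤ
import Data.Integer.Solver as ℤ
open import Data.Fin.Base using (toℕ)
open import Data.Maybe.Base using (Maybe; just; nothing)
open import Algebra.Bundles using (CommutativeRing)
open import Algebra.Properties.Semiring.Sum ℤ.+-*-semiring using (sum)
open import Algebra.Solver.Ring.AlmostCommutativeRing
  using (_-Raw-AlmostCommutative⟶_; fromCommutativeRing)
import Algebra.Solver.Ring
open import Level using (0ℓ)
import Relation.Binary.Reasoning.Setoid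
open import Relation.Nullary.Decidable.Core using (yes; no)
open import Relation.Binary.PropositionalEquality.Core
  using (_≡_; refl; sym; trans; cong; cong₂; subst)
open import Relation.Binary.PropositionalEquality.Properties using (module ≡-Reasoning)

open +-*-Solver using () renaming (solve to ℕ-solve; con to ♯; _:+_ to _∔_; _:*_ to _∙_; _:=_ to _≜_)

-- The ring of power series

-- Infinite products enter as power series, through Euler's expansion; limits are replaced by
-- estimates of orders in `q`, and division is only by series with constant term 1. To dissect an
-- identity `X N = Y`, the multiplier `X` is first made a series in `q^k`, which `section-[]⊠` moves
-- out of the section. In the bisections this rests on `φ(q) φ(-q) = φ(-q²)²`: a factor `φ(q)^j`
-- turns `φ(-q)^j` into `φ(-q²)^(2j)`, so the power of `φ(-q)` doubles from 1 to 8. The delicate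
-- step is the second 3-section. Modulo 27, `ρ⁹` is `ρ(q³)³ (1 + 9y)` with `y = w / (1 - 2w)`, so
-- the part `η` of `y` in powers of `q³` is needed modulo 3. With `w = q γ(q³)` and `u = q γ³`,
-- clearing the denominator by `1 - 8w³` gives `η = 4u / (1 - 8u)`. As `γ³ ≡ γ(q³)` modulo 3,
-- `u ≡ w` and `η ≡ w / (1 + w)`. The factor `1 + w` in `ψ(q) = ρ(q³) φ(-q⁹) (1 + w)` cancels this
-- denominator and leaves `q ψ(q⁹)`: hence the term with coefficient -18.

module SeriesRing where
  infix  4 _≈_
  infixl 6 _⊞_
  infixl 7 _⊠_
  infix  7.5 ⊟_

  -- A record rather than _≗_, so that the two series can be inferred from the type.
  record _≈_ (f g : Series) : Set where
    constructor pointwise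
    field at : ∀ n → f n ≡ g n
  open _≈_ public

  tail : Series → Series
  tail f n = f (suc n)

  ι : ℤ → Series
  ι a zero    = a
  ι a (suc _) = 0ℤ

  -- The ring operations are opaque to keep the conversion checker from unfolding
  -- convolutions.
  opaque
    _⊞_ : Series → Series → Series
    (f ⊞ g) n = f n ℤ.+ g n

    _⊠_ : Series → Series → Series
    _⊠_ = _⊛_

    ⊟_ : Series → Series
    (⊟ f) n = ℤ.- f n

    ⊞-at : ∀ f g n → (f ⊞ g) n ≡ f n ℤ.+ g n
    ⊞-at _ _ _ = refl

    ⊟-at : ∀ f n → (⊟ f) n ≡ ℤ.- f n
    ⊟-at _ _ = refl

    ⊠≡⊛ : ∀ f g → f ⊠ g ≡ f ⊛ g
    ⊠≡⊛ _ _ = refl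

    ⊠-at-zero : ∀ f g → (f ⊠ g) 0 ≡ f 0 ℤ.* g 0
    ⊠-at-zero f g = ℤ.+-identityʳ _

    ⊠-at-suc : ∀ f g n → (f ⊠ g) (suc n) ≡ f 0 ℤ.* g (suc n) ℤ.+ (tail f ⊠ g) n
    ⊠-at-suc f g n = refl

  -- With the operations opaque, a convolution is accessible only through its two recursion
  -- equations. This is its congruence, in the truncated form that products modulo `q^k` require.
  ⊠-local : ∀ {f f′ g g′} n → (∀ m → m ≤ n → f m ≡ f′ m) → (∀ m → m ≤ n → g m ≡ g′ m) →
            (f ⊠ g) n ≡ (f′ ⊠ g′) n
  ⊠-local {f} {f′} {g} {g′} zero p r =
    trans (⊠-at-zero f g) (trans (cong₂ ℤ._*_ (p 0 z≤n) (r 0 z≤n)) (sym (⊠-at-zero f′ g′)))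
  ⊠-local {f} {f′} {g} {g′} (suc n) p r = begin
    (f ⊠ g) (suc n)                                ≡⟨ ⊠-at-suc f g n ⟩
    f 0 ℤ.* g (suc n) ℤ.+ (tail f ⊠ g) n
      ≡⟨ cong₂ ℤ._+_ (cong₂ ℤ._*_ (p 0 z≤n) (r (suc n) ℕ.≤-refl))
                     (⊠-local n (λ m m≤n → p (suc m) (s≤s m≤n)) (λ m m≤n → r m (ℕ.m≤n⇒m≤1+n m≤n))) ⟩
    f′ 0 ℤ.* g′ (suc n) ℤ.+ (tail f′ ⊠ g′) n       ≡⟨ ⊠-at-suc f′ g′ n ⟨
    (f′ ⊠ g′) (suc n)                              ∎
    where open ≡-Reasoning

  module ℤS = ℤ.+-*-Solver

  private
    ⊠-zero : ∀ f g → (∀ n → f n ≡ 0ℤ) → ∀ n → (f ⊠ g) n ≡ 0ℤ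
    ⊠-zero f g z zero    = trans (⊠-at-zero f g) (cong (ℤ._* g 0) (z 0))
    ⊠-zero f g z (suc n) = trans (⊠-at-suc f g n)
      (cong₂ ℤ._+_ (cong (ℤ._* g (suc n)) (z 0)) (⊠-zero (tail f) g (λ m → z (suc m)) n))

    ι-⊠ : ∀ a g n → (ι a ⊠ g) n ≡ a ℤ.* g n
    ι-⊠ a g zero    = ⊠-at-zero (ι a) g
    ι-⊠ a g (suc n) = trans (⊠-at-suc (ι a) g n)
      (trans (cong (λ z → a ℤ.* g (suc n) ℤ.+ z) (⊠-zero (tail (ι a)) g (λ _ → refl) n)) (ℤ.+-identityʳ _))

    -- The Cauchy sum peeled from its other end. Commutativity follows by matching this recursion
    -- with `⊠-at-suc`.
    ⊠-at-sucʳ : ∀ f g n → (f ⊠ g) (suc n) ≡ (f ⊠ tail g) n ℤ.+ f (suc n) ℤ.* g 0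
    ⊠-at-sucʳ f g zero = begin
      (f ⊠ g) 1                               ≡⟨ ⊠-at-suc f g 0 ⟩
      f 0 ℤ.* g 1 ℤ.+ (tail f ⊠ g) 0          ≡⟨ cong₂ ℤ._+_ (⊠-at-zero f (tail g))
          (sym (⊠-at-zero (tail f) g)) ⟨
      (f ⊠ tail g) 0 ℤ.+ f 1 ℤ.* g 0          ∎
      where open ≡-Reasoning
    ⊠-at-sucʳ f g (suc n) = begin
      (f ⊠ g) (2 + n)                                                ≡⟨ ⊠-at-suc f g (suc n) ⟩
      f 0 ℤ.* g (2 + n) ℤ.+ (tail f ⊠ g) (suc n)
        ≡⟨ cong (λ z → f 0 ℤ.* g (2 + n) ℤ.+ z) (⊠-at-sucʳ (tail f) g n) ⟩
      f 0 ℤ.* g (2 + n) ℤ.+ ((tail f ⊠ tail g) n ℤ.+ f (2 + n) ℤ.* g 0)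
        ≡⟨ ℤ.+-assoc (f 0 ℤ.* g (2 + n)) _ _ ⟨
      f 0 ℤ.* g (2 + n) ℤ.+ (tail f ⊠ tail g) n ℤ.+ f (2 + n) ℤ.* g 0
        ≡⟨ cong (ℤ._+ (f (2 + n) ℤ.* g 0)) (⊠-at-suc f (tail g) n) ⟨
      (f ⊠ tail g) (suc n) ℤ.+ f (2 + n) ℤ.* g 0                     ∎
      where open ≡-Reasoning

    ⊠-comm-at : ∀ f g n → (f ⊠ g) n ≡ (g ⊠ f) n
    ⊠-comm-at f g zero    = trans (⊠-at-zero f g) (trans (ℤ.*-comm (f 0) (g 0)) (sym (⊠-at-zero g f)))
    ⊠-comm-at f g (suc n) = begin
      (f ⊠ g) (suc n)                            ≡⟨ ⊠-at-suc f g n ⟩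
      f 0 ℤ.* g (suc n) ℤ.+ (tail f ⊠ g) n       ≡⟨ cong₂ ℤ._+_ (ℤ.*-comm (f 0) (g (suc n)))
          (⊠-comm-at (tail f) g n) ⟩
      g (suc n) ℤ.* f 0 ℤ.+ (g ⊠ tail f) n       ≡⟨ ℤ.+-comm (g (suc n) ℤ.* f 0) _ ⟩
      (g ⊠ tail f) n ℤ.+ g (suc n) ℤ.* f 0       ≡⟨ ⊠-at-sucʳ g f n ⟨
      (g ⊠ f) (suc n)                            ∎
      where open ≡-Reasoning

    ⊠-distribʳ-at : ∀ h f g n → ((f ⊞ g) ⊠ h) n ≡ (f ⊠ h) n ℤ.+ (g ⊠ h) n
    ⊠-distribʳ-at h f g zero = begin
      ((f ⊞ g) ⊠ h) 0              ≡⟨ ⊠-at-zero (f ⊞ g) h ⟩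
      (f ⊞ g) 0 ℤ.* h 0            ≡⟨ cong (ℤ._* h 0) (⊞-at f g 0) ⟩
      (f 0 ℤ.+ g 0) ℤ.* h 0        ≡⟨ ℤ.*-distribʳ-+ (h 0) (f 0) (g 0) ⟩
      f 0 ℤ.* h 0 ℤ.+ g 0 ℤ.* h 0  ≡⟨ cong₂ ℤ._+_ (⊠-at-zero f h) (⊠-at-zero g h) ⟨
      (f ⊠ h) 0 ℤ.+ (g ⊠ h) 0      ∎
      where open ≡-Reasoning
    ⊠-distribʳ-at h f g (suc n) = begin
      ((f ⊞ g) ⊠ h) (suc n)
        ≡⟨ ⊠-at-suc (f ⊞ g) h n ⟩
      (f ⊞ g) 0 ℤ.* h (suc n) ℤ.+ (tail (f ⊞ g) ⊠ h) n
        ≡⟨ cong₂ ℤ._+_ (cong (ℤ._* h (suc n)) (⊞-at f g 0))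
             (trans (⊠-local n (λ m _ → trans (⊞-at f g (suc m)) (sym (⊞-at (tail f) (tail g) m)))
                 (λ _ _ → refl))
                    (⊠-distribʳ-at h (tail f) (tail g) n)) ⟩
      (f 0 ℤ.+ g 0) ℤ.* h (suc n) ℤ.+ ((tail f ⊠ h) n ℤ.+ (tail g ⊠ h) n)
        ≡⟨ ℤS.solve 5 (λ a b c d e → (a :+ b) :* c :+ (d :+ e) := (a :* c :+ d) :+ (b :* c :+ e)) refl
             (f 0) (g 0) (h (suc n)) ((tail f ⊠ h) n) ((tail g ⊠ h) n) ⟩
      (f 0 ℤ.* h (suc n) ℤ.+ (tail f ⊠ h) n) ℤ.+ (g 0 ℤ.* h (suc n) ℤ.+ (tail g ⊠ h) n)
        ≡⟨ cong₂ ℤ._+_ (⊠-at-suc f h n) (⊠-at-suc g h n) ⟨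
      (f ⊠ h) (suc n) ℤ.+ (g ⊠ h) (suc n) ∎
      where open ≡-Reasoning
            open ℤS

    ⊠-scale-at : ∀ a f g n → ((λ m → a ℤ.* f m) ⊠ g) n ≡ a ℤ.* (f ⊠ g) n
    ⊠-scale-at a f g zero    = trans (⊠-at-zero _ g)
        (trans (ℤ.*-assoc a (f 0) (g 0)) (cong (a ℤ.*_) (sym (⊠-at-zero f g))))
    ⊠-scale-at a f g (suc n) = begin
      ((λ m → a ℤ.* f m) ⊠ g) (suc n)                                   ≡⟨ ⊠-at-suc _ g n ⟩
      a ℤ.* f 0 ℤ.* g (suc n) ℤ.+ ((λ m → a ℤ.* tail f m) ⊠ g) n        ≡⟨ cong₂ ℤ._+_
          (ℤ.*-assoc a (f 0) (g (suc n))) (⊠-scale-at a (tail f) g n) ⟩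
      a ℤ.* (f 0 ℤ.* g (suc n)) ℤ.+ a ℤ.* (tail f ⊠ g) n                ≡⟨ ℤ.*-distribˡ-+ a _ _ ⟨
      a ℤ.* (f 0 ℤ.* g (suc n) ℤ.+ (tail f ⊠ g) n)                      ≡⟨ cong (a ℤ.*_) (⊠-at-suc f g n) ⟨
      a ℤ.* (f ⊠ g) (suc n)                                             ∎
      where open ≡-Reasoning

    ⊠-assoc-at : ∀ f g h n → ((f ⊠ g) ⊠ h) n ≡ (f ⊠ (g ⊠ h)) n
    ⊠-assoc-at f g h zero = begin
      ((f ⊠ g) ⊠ h) 0            ≡⟨ ⊠-at-zero (f ⊠ g) h ⟩
      (f ⊠ g) 0 ℤ.* h 0          ≡⟨ cong (ℤ._* h 0) (⊠-at-zero f g) ⟩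
      f 0 ℤ.* g 0 ℤ.* h 0        ≡⟨ ℤ.*-assoc (f 0) (g 0) (h 0) ⟩
      f 0 ℤ.* (g 0 ℤ.* h 0)      ≡⟨ cong (f 0 ℤ.*_) (⊠-at-zero g h) ⟨
      f 0 ℤ.* (g ⊠ h) 0          ≡⟨ ⊠-at-zero f (g ⊠ h) ⟨
      (f ⊠ (g ⊠ h)) 0            ∎
      where open ≡-Reasoning
    ⊠-assoc-at f g h (suc n) = begin
      ((f ⊠ g) ⊠ h) (suc n)
        ≡⟨ ⊠-at-suc (f ⊠ g) h n ⟩
      (f ⊠ g) 0 ℤ.* h (suc n) ℤ.+ (tail (f ⊠ g) ⊠ h) n
        ≡⟨ cong₂ ℤ._+_ (cong (ℤ._* h (suc n)) (⊠-at-zero f g))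
             (⊠-local n (λ m _ → trans (⊠-at-suc f g m)
                 (sym (⊞-at (λ j → f 0 ℤ.* tail g j) (tail f ⊠ g) m))) (λ _ _ → refl)) ⟩
      f 0 ℤ.* g 0 ℤ.* h (suc n) ℤ.+ (((λ j → f 0 ℤ.* tail g j) ⊞ tail f ⊠ g) ⊠ h) n
        ≡⟨ cong (λ z → f 0 ℤ.* g 0 ℤ.* h (suc n) ℤ.+ z) (trans (⊠-distribʳ-at h _ _ n)
             (cong₂ ℤ._+_ (⊠-scale-at (f 0) (tail g) h n) (⊠-assoc-at (tail f) g h n))) ⟩
      f 0 ℤ.* g 0 ℤ.* h (suc n) ℤ.+ (f 0 ℤ.* (tail g ⊠ h) n ℤ.+ (tail f ⊠ (g ⊠ h)) n)
        ≡⟨ ℤS.solve 5 (λ a b c d e → a :* b :* c :+ (a :* d :+ e) := a :* (b :* c :+ d) :+ e) refl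
             (f 0) (g 0) (h (suc n)) ((tail g ⊠ h) n) _ ⟩
      f 0 ℤ.* (g 0 ℤ.* h (suc n) ℤ.+ (tail g ⊠ h) n) ℤ.+ (tail f ⊠ (g ⊠ h)) n
        ≡⟨ cong (λ c → f 0 ℤ.* c ℤ.+ (tail f ⊠ (g ⊠ h)) n) (⊠-at-suc g h n) ⟨
      f 0 ℤ.* (g ⊠ h) (suc n) ℤ.+ (tail f ⊠ (g ⊠ h)) n
        ≡⟨ ⊠-at-suc f (g ⊠ h) n ⟨
      (f ⊠ (g ⊠ h)) (suc n) ∎
      where open ≡-Reasoning
            open ℤS

  ι-at : ∀ a f n → (ι a ⊠ f) n ≡ a ℤ.* f n
  ι-at = ι-⊠

  ≈-refl : ∀ {f} → f ≈ f
  ≈-refl = pointwise λ _ → refl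

  ≈-sym : ∀ {f g} → f ≈ g → g ≈ f
  ≈-sym p = pointwise λ n → sym (at p n)

  ≈-trans : ∀ {f g h} → f ≈ g → g ≈ h → f ≈ h
  ≈-trans p r = pointwise λ n → trans (at p n) (at r n)

  𝟙≈ι : 𝟙 ≈ ι 1ℤ
  𝟙≈ι = pointwise λ { zero → refl ; (suc _) → refl }

  private
    ⊠-cong : ∀ {f f′ g g′} → f ≈ f′ → g ≈ g′ → f ⊠ g ≈ f′ ⊠ g′
    ⊠-cong p r = pointwise λ n → ⊠-local n (λ m _ → at p m) (λ m _ → at r m)

    ⊞-lift : ∀ {f f′ g g′} → f ≈ f′ → g ≈ g′ → f ⊞ g ≈ f′ ⊞ g′
    ⊞-lift {f} {f′} {g} {g′} p r = pointwise λ n →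
      trans (⊞-at f g n) (trans (cong₂ ℤ._+_ (at p n) (at r n)) (sym (⊞-at f′ g′ n)))

    ⊠-idˡ : ∀ f → 𝟙 ⊠ f ≈ f
    ⊠-idˡ f = ≈-trans (⊠-cong 𝟙≈ι ≈-refl) (pointwise λ n → trans (ι-⊠ 1ℤ f n) (ℤ.*-identityˡ (f n)))

  opaque
    unfolding _⊞_
    private
      ⊞-assoc : ∀ f g h → (f ⊞ g) ⊞ h ≈ f ⊞ (g ⊞ h)
      ⊞-assoc f g h = pointwise λ n → ℤ.+-assoc (f n) (g n) (h n)
      ⊞-comm : ∀ f g → f ⊞ g ≈ g ⊞ f
      ⊞-comm f g = pointwise λ n → ℤ.+-comm (f n) (g n)
      ⊞-idˡ : ∀ f → ι 0ℤ ⊞ f ≈ f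
      ⊞-idˡ f = pointwise λ { zero → ℤ.+-identityˡ _ ; (suc _) → ℤ.+-identityˡ _ }
      ⊟-invˡ : ∀ f → ⊟ f ⊞ f ≈ ι 0ℤ
      ⊟-invˡ f = pointwise λ { zero → ℤ.+-inverseˡ (f 0) ; (suc n) → ℤ.+-inverseˡ (f (suc n)) }
      ⊟-lift : ∀ {f g} → f ≈ g → ⊟ f ≈ ⊟ g
      ⊟-lift p = pointwise λ n → cong ℤ.-_ (at p n)
      ⊠-distribʳ : ∀ h f g → (f ⊞ g) ⊠ h ≈ f ⊠ h ⊞ g ⊠ h
      ⊠-distribʳ h f g = pointwise (⊠-distribʳ-at h f g)
      ι-⊞ : ∀ a b → ι (a ℤ.+ b) ≈ ι a ⊞ ι b
      ι-⊞ a b = pointwise λ { zero → refl ; (suc _) → refl }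
      ι-⊟ : ∀ a → ι (ℤ.- a) ≈ ⊟ ι a
      ι-⊟ a = pointwise λ { zero → refl ; (suc _) → refl }

  series : CommutativeRing 0ℓ 0ℓ
  series = record
    { Carrier = Series ; _≈_ = _≈_ ; _+_ = _⊞_ ; _*_ = _⊠_ ; -_ = ⊟_ ; 0# = ι 0ℤ ; 1# = 𝟙
    ; isCommutativeRing = record
      { isRing = record
        { +-isAbelianGroup = record
          { isGroup = record
            { isMonoid = record
              { isSemigroup = record
                { isMagma = record
                  { isEquivalence = record { refl = ≈-refl ; sym = ≈-sym ; trans = ≈-trans }
                  ; ∙-cong = ⊞-lift }
                ; assoc = ⊞-assoc }
              ; identity = ⊞-idˡ , λ f → ≈-trans (⊞-comm f _) (⊞-idˡ f) }
            ; inverse = ⊟-invˡ , λ f → ≈-trans (⊞-comm f _) (⊟-invˡ f)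
            ; ⁻¹-cong = ⊟-lift }
          ; comm = ⊞-comm }
        ; *-cong = ⊠-cong
        ; *-assoc = λ f g h → pointwise (⊠-assoc-at f g h)
        ; *-identity = ⊠-idˡ , λ f → ≈-trans (pointwise (⊠-comm-at f 𝟙)) (⊠-idˡ f)
        ; distrib = (λ h f g → ≈-trans (pointwise (⊠-comm-at h (f ⊞ g)))
                                (≈-trans (⊠-distribʳ h f g)
                                  (⊞-lift (pointwise (⊠-comm-at f h)) (pointwise (⊠-comm-at g h)))))
                  , ⊠-distribʳ }
      ; *-comm = λ f g → pointwise (⊠-comm-at f g) } }

  open CommutativeRing series public
    using (setoid; *-comm; *-assoc; *-identityˡ; *-identityʳ; zeroˡ; zeroʳ; +-identityˡ; +-identityʳ)
    renaming (*-cong to _⟨⊠⟩_; +-cong to _⟨⊞⟩_; -‿cong to ⟨⊟⟩_;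
              *-congˡ to ⊠-congˡ; *-congʳ to ⊠-congʳ; +-congˡ to ⊞-congˡ; +-congʳ to ⊞-congʳ; +-comm
                  to ⊞-comm; +-assoc to ⊞-assoc; distribʳ to ⊠-distribʳ)
  open import Algebra.Properties.Semiring.Exp (CommutativeRing.semiring series) public
    using () renaming (_^_ to _⇡_; ^-homo-* to ⇡-+; ^-assocʳ to ⇡-*; ^-congˡ to ⇡-congˡ; ^-congʳ to ⇡-congʳ)
  open import Algebra.Properties.CommutativeSemiring.Exp (CommutativeRing.commutativeSemiring series) public
    using () renaming (^-distrib-* to ⇡-distrib)

  -- Lets the solver do its coefficient arithmetic in the integers, so that one call settles an
  -- identity whose numerals have to be combined.
  ι-hom : CommutativeRing.rawRing ℤ.+-*-commutativeRing -Raw-AlmostCommutative⟶ fromCommutativeRing series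
  ι-hom = record
    { ⟦_⟧ = ι ; +-homo = ι-⊞ ; -‿homo = ι-⊟ ; 0-homo = ≈-refl ; 1-homo = ≈-sym 𝟙≈ι
    ; *-homo = λ a b → ≈-sym (pointwise λ { zero → ι-⊠ a (ι b) 0
                                          ; (suc n) → trans (ι-⊠ a (ι b) (suc n)) (ℤ.*-zeroʳ a) }) }

  private
    ι≟ : ∀ a b → Maybe (ι a ≈ ι b)
    ι≟ a b with a ℤ.≟ b
    ... | yes refl = just ≈-refl
    ... | no  _    = nothing

  open Algebra.Solver.Ring (CommutativeRing.rawRing ℤ.+-*-commutativeRing)
      (fromCommutativeRing series) ι-hom ι≟ public
    using (solve; _:=_; con; _:+_; _:*_; _:-_; :-_; _:^_)

open SeriesRing

module ≈-Reasoning = Relation.Binary.Reasoning.Setoid setoid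
open ≈-Reasoning

-- Series up to a power of q

record Ord (k : ℕ) (f : Series) : Set where
  constructor ord
  field vanish : ∀ {m} → m < k → f m ≡ 0ℤ
open Ord public

infix 4 _≈[_]_
record _≈[_]_ (f : Series) (k : ℕ) (g : Series) : Set where
  constructor upTo
  field agree : ∀ {m} → m < k → f m ≡ g m
open _≈[_]_ public

≈-from-≈[] : ∀ {f g} → (∀ n → f ≈[ n ] g) → f ≈ g
≈-from-≈[] p = pointwise λ n → agree (p (suc n)) ℕ.≤-refl

≈⇒≈[] : ∀ {k f g} → f ≈ g → f ≈[ k ] g
≈⇒≈[] p = upTo λ {m} _ → at p m

≈[]-sym : ∀ {k f g} → f ≈[ k ] g → g ≈[ k ] f
≈[]-sym p = upTo λ m<k → sym (agree p m<k)

≈[]-trans : ∀ {k f g h} → f ≈[ k ] g → g ≈[ k ] h → f ≈[ k ] h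
≈[]-trans p r = upTo λ m<k → trans (agree p m<k) (agree r m<k)

≈[]-⊠ : ∀ {k f f′ g g′} → f ≈[ k ] f′ → g ≈[ k ] g′ → f ⊠ g ≈[ k ] f′ ⊠ g′
≈[]-⊠ p r = upTo λ {m} m<k →
  ⊠-local m (λ j j≤m → agree p (ℕ.≤-<-trans j≤m m<k)) (λ j j≤m → agree r (ℕ.≤-<-trans j≤m m<k))

≈[]-⊞ : ∀ {k f f′ g g′} → f ≈[ k ] f′ → g ≈[ k ] g′ → f ⊞ g ≈[ k ] f′ ⊞ g′
≈[]-⊞ {f = f} {f′} {g} {g′} p r = upTo λ {m} m<k →
  trans (⊞-at f g m) (trans (cong₂ ℤ._+_ (agree p m<k) (agree r m<k)) (sym (⊞-at f′ g′ m)))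

≈[]-⊞-Ord : ∀ {k f g h} → f ≈[ k ] g → Ord k h → f ⊞ h ≈[ k ] g
≈[]-⊞-Ord {f = f} {g} {h} p o = upTo λ {m} m<k →
  trans (⊞-at f h m) (trans (cong₂ ℤ._+_ (agree p m<k) (vanish o m<k)) (ℤ.+-identityʳ (g m)))

Ord-≈ : ∀ {k f g} → f ≈ g → Ord k f → Ord k g
Ord-≈ p o = ord λ {m} m<k → trans (sym (at p m)) (vanish o m<k)

Ord-≤ : ∀ {j k f} → j ≤ k → Ord k f → Ord j f
Ord-≤ j≤k o = ord λ m<j → vanish o (ℕ.<-≤-trans m<j j≤k)

Ord-zero : ∀ {f} → Ord 0 f
Ord-zero = ord λ ()

Ord-⊠ : ∀ {j k f g} → Ord j f → Ord k g → Ord (j + k) (f ⊠ g)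
Ord-⊠ {j} {k} {f} {g} o p = ord (product j f (vanish o) _)
  where
  product : ∀ j f → (∀ {m} → m < j → f m ≡ 0ℤ) → ∀ m → m < j + k → (f ⊠ g) m ≡ 0ℤ
  product zero f o zero 0<k = trans (⊠-at-zero f g) (trans (cong (f 0 ℤ.*_) (vanish p 0<k)) (ℤ.*-zeroʳ (f 0)))
  product zero f o (suc m) m<k = trans (⊠-at-suc f g m) (cong₂ ℤ._+_
    (trans (cong (f 0 ℤ.*_) (vanish p m<k)) (ℤ.*-zeroʳ (f 0)))
    (product zero (tail f) (λ ()) m (ℕ.<⇒≤ m<k)))
  product (suc j) f o zero _ = trans (⊠-at-zero f g) (cong (ℤ._* g 0) (o (s≤s z≤n)))
  product (suc j) f o (suc m) (s≤s m<) = trans (⊠-at-suc f g m) (cong₂ ℤ._+_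
    (cong (ℤ._* g (suc m)) (o (s≤s z≤n)))
    (product j (tail f) (λ i<j → o (s≤s i<j)) m m<))

Ord-⊠ˡ : ∀ {k f g} → Ord k f → Ord k (f ⊠ g)
Ord-⊠ˡ {k} o = Ord-≤ (ℕ.m≤m+n k 0) (Ord-⊠ o Ord-zero)

Ord-⊠ʳ : ∀ {k f g} → Ord k g → Ord k (f ⊠ g)
Ord-⊠ʳ o = Ord-⊠ Ord-zero o

Ord-⊞ : ∀ {k f g} → Ord k f → Ord k g → Ord k (f ⊞ g)
Ord-⊞ {f = f} {g} o p = ord λ {m} m<k → trans (⊞-at f g m) (cong₂ ℤ._+_ (vanish o m<k) (vanish p m<k))

Ord-⊟ : ∀ {k f} → Ord k f → Ord k (⊟ f)
Ord-⊟ {f = f} o = ord λ {m} m<k → trans (⊟-at f m) (cong ℤ.-_ (vanish o m<k))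

Ord-⇡ : ∀ {f} n → Ord 1 f → Ord n (f ⇡ n)
Ord-⇡ zero    o = Ord-zero
Ord-⇡ (suc n) o = Ord-⊠ o (Ord-⇡ n o)

Ord-q : Ord 1 q
Ord-q = ord λ { {zero} _ → refl ; {suc _} (s≤s ()) }

-- Sums

fsum : ℕ → (ℕ → Series) → Series
fsum zero    F = ι 0ℤ
fsum (suc X) F = F 0 ⊞ fsum X (λ n → F (suc n))

-- Σ_{n ≥ 0} F n for a family with F n = O(q^{n-b}).
opaque
  Sum : ℕ → (ℕ → Series) → Series
  Sum b F N = fsum (b + suc N) F N

  Sum-def : ∀ b F N → Sum b F N ≡ fsum (b + suc N) F N
  Sum-def b F N = refl

-- Truncated subtraction puts no condition on the members of index at most `b`, and `b + suc N`
-- members determine the coefficient of `q^N`. The terms of index `l - n` of a bilateral series,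
-- listed from `l = 0`, need `b = n`.
Summable : ℕ → (ℕ → Series) → Set
Summable b F = ∀ n → Ord (n ∸ b) (F n)

fsum-cong : ∀ X {F G} → (∀ n → F n ≈ G n) → fsum X F ≈ fsum X G
fsum-cong zero    p = ≈-refl
fsum-cong (suc X) p = p 0 ⟨⊞⟩ fsum-cong X (λ n → p (suc n))

fsum-cong-at : ∀ X F G N → (∀ n → n < X → F n N ≡ G n N) → fsum X F N ≡ fsum X G N
fsum-cong-at zero    F G N p = refl
fsum-cong-at (suc X) F G N p = trans (⊞-at (F 0) _ N) (trans
  (cong₂ ℤ._+_ (p 0 (s≤s z≤n)) (fsum-cong-at X (λ n → F (suc n)) (λ n → G (suc n)) N
      (λ n n<X → p (suc n) (s≤s n<X))))
  (sym (⊞-at (G 0) _ N)))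

fsum-⊞ : ∀ X F G → fsum X (λ n → F n ⊞ G n) ≈ fsum X F ⊞ fsum X G
fsum-⊞ zero    F G = ≈-sym (+-identityˡ _)
fsum-⊞ (suc X) F G = ≈-trans (⊞-congˡ (fsum-⊞ X _ _))
  (solve 4 (λ a b c d → (a :+ b) :+ (c :+ d) := (a :+ c) :+ (b :+ d)) ≈-refl (F 0) (G 0) _ _)

fsum-⊠ : ∀ X h F → h ⊠ fsum X F ≈ fsum X (λ n → h ⊠ F n)
fsum-⊠ zero    h F = zeroʳ h
fsum-⊠ (suc X) h F = ≈-trans
  (solve 3 (λ h a b → h :* (a :+ b) := h :* a :+ h :* b) ≈-refl h (F 0) _) (⊞-congˡ (fsum-⊠ X h _))

fsum-zero : ∀ X → fsum X (λ _ → ι 0ℤ) ≈ ι 0ℤ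
fsum-zero zero    = ≈-refl
fsum-zero (suc X) = ≈-trans (+-identityˡ _) (fsum-zero X)

fsum-swap : ∀ X Y F → fsum X (λ m → fsum Y (F m)) ≈ fsum Y (λ n → fsum X (λ m → F m n))
fsum-swap zero    Y F = ≈-sym (fsum-zero Y)
fsum-swap (suc X) Y F = ≈-trans (⊞-congˡ (fsum-swap X Y (λ m → F (suc m)))) (≈-sym (fsum-⊞ Y (F 0) _))

fsum-+ : ∀ X Y F → fsum (X + Y) F ≈ fsum X F ⊞ fsum Y (λ n → F (X + n))
fsum-+ zero    Y F = ≈-sym (+-identityˡ _)
fsum-+ (suc X) Y F = ≈-trans (⊞-congˡ (fsum-+ X Y _)) (≈-sym (⊞-assoc (F 0) _ _))

fsum-last : ∀ X F → fsum (suc X) F ≈ fsum X F ⊞ F X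
fsum-last zero    F = ⊞-comm (F 0) (ι 0ℤ)
fsum-last (suc X) F = ≈-trans (⊞-congˡ (fsum-last X _)) (≈-sym (⊞-assoc (F 0) _ _))

fsum-* : ∀ X k F → fsum (X * k) F ≈ fsum X (λ m → fsum k (λ r → F (m * k + r)))
fsum-* zero    k F = ≈-refl
fsum-* (suc X) k F = ≈-trans (fsum-+ k (X * k) F) (⊞-congˡ (≈-trans (fsum-* X k _)
  (fsum-cong X λ m → fsum-cong k λ r → pointwise λ N → cong (λ i → F i N) (sym (ℕ.+-assoc k (m * k) r)))))

fsum-vanish-at : ∀ X F N → (∀ n → F n N ≡ 0ℤ) → fsum X F N ≡ 0ℤ
fsum-vanish-at zero    F zero    p = refl
fsum-vanish-at zero    F (suc N) p = refl
fsum-vanish-at (suc X) F N p = trans (⊞-at (F 0) _ N)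
    (cong₂ ℤ._+_ (p 0) (fsum-vanish-at X _ N (λ n → p (suc n))))

fsum-stable : ∀ {M X} F N → M ≤ X → (∀ n → M ≤ n → F n N ≡ 0ℤ) → fsum X F N ≡ fsum M F N
fsum-stable {X = X} F N z≤n p =
  trans (fsum-vanish-at X F N (λ n → p n z≤n)) (sym (fsum-vanish-at 0 F N (λ n → p n z≤n)))
fsum-stable F N (s≤s M≤X) p = trans (⊞-at (F 0) _ N)
  (trans (cong (λ z → F 0 N ℤ.+ z) (fsum-stable _ N M≤X (λ n M≤n → p (suc n) (s≤s M≤n))))
      (sym (⊞-at (F 0) _ N)))

-- Members beyond index `b + N` have order above `N`. The free cut-off `X` lets sums be compared
-- over index sets of convenient length.
Sum-at : ∀ {b X F} N → Summable b F → b + N < X → fsum X F N ≡ Sum b F N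
Sum-at {b} {X} {F} N s b+N<X = trans
  (fsum-stable F N (subst (_≤ X) (sym (ℕ.+-suc b N)) b+N<X)
    λ n b+N<n → vanish (s n) (ℕ.m+n≤o⇒m≤o∸n (suc N)
        (subst (_≤ n) (trans (ℕ.+-suc b N) (cong suc (ℕ.+-comm b N))) b+N<n)))
  (sym (Sum-def b F N))

Sum-cong : ∀ {b F G} → (∀ n → F n ≈ G n) → Sum b F ≈ Sum b G
Sum-cong {b} {F} {G} p = pointwise λ N →
  trans (Sum-def b F N) (trans (at (fsum-cong (b + suc N) p) N) (sym (Sum-def b G N)))

Sum-⊞ : ∀ {b} F G → Sum b (λ n → F n ⊞ G n) ≈ Sum b F ⊞ Sum b G
Sum-⊞ {b} F G = pointwise λ N → trans (Sum-def b _ N) (trans (at (fsum-⊞ (b + suc N) F G) N)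
  (trans (⊞-at (fsum (b + suc N) F) _ N) (trans (cong₂ ℤ._+_ (sym (Sum-def b F N)) (sym (Sum-def b G N)))
    (sym (⊞-at (Sum b F) (Sum b G) N)))))

Sum-⊠ : ∀ {b F} h → Summable b F → h ⊠ Sum b F ≈ Sum b (λ n → h ⊠ F n)
Sum-⊠ {b} {F} h s = pointwise λ N → trans
  (⊠-local {h} N (λ _ _ → refl) (λ m m≤N → sym (Sum-at m s
    (ℕ.≤-trans (s≤s (ℕ.+-monoʳ-≤ b m≤N)) (ℕ.≤-reflexive (sym (ℕ.+-suc b N)))))))
  (trans (at (fsum-⊠ (b + suc N) h F) N) (sym (Sum-def b _ N)))

Sum-offset : ∀ {b F} → Summable 0 F → Sum b F ≈ Sum 0 F
Sum-offset {b} {F} s = pointwise λ N → trans (Sum-def b F N) (Sum-at N s (ℕ.m≤n+m (suc N) b))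

-- Lowering the offset along with the shift preserves the number of members counted, so at each
-- coefficient both sides are the same finite sum.
Sum-suc-offset : ∀ {b} F → Sum (suc b) F ≈ F 0 ⊞ Sum b (λ n → F (suc n))
Sum-suc-offset {b} F = pointwise λ N → trans (Sum-def (suc b) F N) (trans (⊞-at (F 0) _ N)
  (trans (cong (λ z → F 0 N ℤ.+ z) (sym (Sum-def b _ N))) (sym (⊞-at (F 0) (Sum b _) N))))

Sum-uncons : ∀ {b F} → Summable b F → Sum b F ≈ F 0 ⊞ Sum b (λ n → F (suc n))
Sum-uncons {b} {F} s = ≈-trans
  (pointwise λ N → trans
    (sym (Sum-at N s (ℕ.≤-trans (ℕ.≤-reflexive (sym (ℕ.+-suc b N))) (ℕ.n≤1+n (b + suc N)))))
    (sym (Sum-def (suc b) F N)))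
  (Sum-suc-offset F)

Sum-Sum : ∀ (F : ℕ → ℕ → Series) N → Sum 0 (λ m → Sum 0 (F m)) N ≡ fsum (suc N) (λ m → fsum (suc N) (F m)) N
Sum-Sum F N = trans (Sum-def 0 _ N)
  (fsum-cong-at (suc N) (λ m → Sum 0 (F m)) (λ m → fsum (suc N) (F m)) N λ m _ → Sum-def 0 (F m) N)

-- At the coefficient of `q^N` both orders of summation are cut off at the same square of side
-- `suc N`.
Sum-swap : ∀ (F : ℕ → ℕ → Series) → Sum 0 (λ m → Sum 0 (F m)) ≈ Sum 0 (λ n → Sum 0 (λ m → F m n))
Sum-swap F = pointwise λ N →
  trans (Sum-Sum F N) (trans (at (fsum-swap (suc N) (suc N) F) N) (sym (Sum-Sum (λ n m → F m n) N)))

-- The coefficient of `q^N` is computed with `suc N * suc k` members, so that the index set consists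
-- of complete blocks of length `suc k`.
Sum-residues : ∀ k {F} → Summable 0 F → Sum 0 F ≈ fsum (suc k) (λ r → Sum 0 (λ m → F (m * suc k + r)))
Sum-residues k {F} s = pointwise λ N → trans
  (sym (Sum-at {0} {suc N * suc k} N s (ℕ.m≤m*n (suc N) (suc k))))
  (trans (at (fsum-* (suc N) (suc k) F) N)
  (trans (at (fsum-swap (suc N) (suc k) (λ m r → F (m * suc k + r))) N)
         (fsum-cong-at (suc k) (λ r → fsum (suc N) (λ m → F (m * suc k + r)))
           (λ r → Sum 0 (λ m → F (m * suc k + r))) N
           λ r _ → sym (Sum-def 0 (λ m → F (m * suc k + r)) N))))

Ord-Sum : ∀ {b k F} → (∀ n → Ord k (F n)) → Ord k (Sum b F)
Ord-Sum {b} {k} {F} o = ord λ {m} m<k →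
  trans (Sum-def b F m) (fsum-vanish-at (b + suc m) F m (λ n → vanish (o n) m<k))

∑∞≈Sum : ∀ F → ∑∞ F ≈ Sum 0 F
∑∞≈Sum F = pointwise λ N → trans (finite (suc N) F N) (sym (Sum-def 0 F N))
  where
  finite : ∀ X F N → sum {X} (λ i → F (toℕ i) N) ≡ fsum X F N
  finite zero    F zero    = refl
  finite zero    F (suc N) = refl
  finite (suc X) F N = trans (cong (λ z → F 0 N ℤ.+ z) (finite X (λ n → F (suc n)) N)) (sym (⊞-at (F 0) _ N))

-- Σ_{k + l = N} F k l
diag : ℕ → (ℕ → ℕ → Series) → Series
diag zero    F = F 0 0
diag (suc N) F = F 0 (suc N) ⊞ diag N (λ k → F (suc k))

diag-cong : ∀ N {F G} → (∀ k l → k + l ≡ N → F k l ≈ G k l) → diag N F ≈ diag N G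
diag-cong zero    p = p 0 0 refl
diag-cong (suc N) p = p 0 (suc N) refl ⟨⊞⟩ diag-cong N (λ k l e → p (suc k) l (cong suc e))

diag-⊞ : ∀ N F G → diag N (λ k l → F k l ⊞ G k l) ≈ diag N F ⊞ diag N G
diag-⊞ zero    F G = ≈-refl
diag-⊞ (suc N) F G = ≈-trans (⊞-congˡ (diag-⊞ N _ _))
  (solve 4 (λ a b c d → (a :+ b) :+ (c :+ d) := (a :+ c) :+ (b :+ d)) ≈-refl (F 0 (suc N)) (G 0 (suc N)) _ _)

diag-⊠ : ∀ N h F → h ⊠ diag N F ≈ diag N (λ k l → h ⊠ F k l)
diag-⊠ zero    h F = ≈-refl
diag-⊠ (suc N) h F = ≈-trans
  (solve 3 (λ h a b → h :* (a :+ b) := h :* a :+ h :* b) ≈-refl h (F 0 (suc N)) _) (⊞-congˡ (diag-⊠ N h _))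

diag-last : ∀ N F → diag (suc N) F ≈ diag N (λ k l → F k (suc l)) ⊞ F (suc N) 0
diag-last zero    F = ≈-refl
diag-last (suc N) F = ≈-trans (⊞-congˡ (diag-last N (λ k → F (suc k)))) (≈-sym (⊞-assoc (F 0 (2 + N)) _ _))

diag-flip : ∀ N F → diag N F ≈ diag N (λ k l → F l k)
diag-flip zero    F = ≈-refl
diag-flip (suc N) F = ≈-trans (⊞-comm (F 0 (suc N)) _)
  (≈-trans (⊞-congʳ (diag-flip N (λ k → F (suc k)))) (≈-sym (diag-last N (λ k l → F l k))))

diag-Sum : ∀ N {b} (F : ℕ → ℕ → ℕ → Series) →
           diag N (λ k l → Sum b (F k l)) ≈ Sum b (λ n → diag N (λ k l → F k l n))
diag-Sum zero    F = ≈-refl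
diag-Sum (suc N) F = ≈-trans (⊞-congˡ (diag-Sum N (λ k → F (suc k)))) (≈-sym (Sum-⊞ (F 0 (suc N)) _))

Ord-diag : ∀ {j} N {F} → (∀ k l → k + l ≡ N → Ord j (F k l)) → Ord j (diag N F)
Ord-diag zero    o = o 0 0 refl
Ord-diag (suc N) {F} o = Ord-⊞ (o 0 (suc N) refl) (Ord-diag N (λ k l e → o (suc k) l (cong suc e)))

-- Unit steps along the antidiagonal carry every `Z k l` to `Z 0 N`. Meant for the lattice sums,
-- which depend on `k + l` only.
diag-factor : ∀ N (F Z : ℕ → ℕ → Series) → (∀ k l → Z (suc k) l ≈ Z k (suc l)) →
              diag N (λ k l → F k l ⊠ Z k l) ≈ diag N F ⊠ Z 0 N
diag-factor zero    F Z p = ≈-refl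
diag-factor (suc N) F Z p = ≈-trans
  (⊞-congˡ (≈-trans (diag-factor N (λ k → F (suc k)) (λ k → Z (suc k)) (λ k → p (suc k))) (⊠-congˡ (p 0 N))))
  (solve 3 (λ a b z → a :* z :+ b :* z := (a :+ b) :* z) ≈-refl (F 0 (suc N)) _ (Z 0 (suc N)))

-- Only pairs with `k + l ≤ N` reach the coefficient of `q^N`: the square of indices shrinks to a
-- triangle, which is then regrouped by antidiagonals.
Sum-diag : ∀ {F} → (∀ k l → Ord (k + l) (F k l)) → Sum 0 (λ k → Sum 0 (F k)) ≈ Sum 0 (λ N → diag N F)
Sum-diag {F} o = pointwise λ N → trans (Sum-Sum F N)
  (trans (square (suc N) (suc N) F N (λ k l N<k+l → vanish (o k l) N<k+l) ℕ.≤-refl)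
  (trans (at (triangle-diag (suc N) F) N) (sym (Sum-def 0 (λ n → diag n F) N))))
  where
  triangle : ℕ → (ℕ → ℕ → Series) → Series
  triangle zero    F = ι 0ℤ
  triangle (suc X) F = fsum (suc X) (F 0) ⊞ triangle X (λ k → F (suc k))

  triangle-diag : ∀ X F → triangle X F ≈ fsum X (λ N → diag N F)
  triangle-diag zero    F = ≈-refl
  triangle-diag (suc X) F = ≈-trans (⊞-congˡ (triangle-diag X (λ k → F (suc k))))
    (≈-trans (⊞-assoc (F 0 0) _ _) (⊞-congˡ (≈-sym (fsum-⊞ X (λ N → F 0 (suc N)) _))))

  square : ∀ X Y F N → (∀ k l → X ≤ k + l → F k l N ≡ 0ℤ) → X ≤ Y →
           fsum X (λ k → fsum Y (F k)) N ≡ triangle X F N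
  square zero    Y F N z X≤Y = refl
  square (suc X) Y F N z X≤Y = trans (⊞-at (fsum Y (F 0)) _ N) (trans
    (cong₂ ℤ._+_ (fsum-stable (F 0) N X≤Y (λ n → z 0 n))
      (square X Y (λ k → F (suc k)) N (λ k l X≤ → z (suc k) l (s≤s X≤)) (ℕ.<⇒≤ X≤Y)))
    (sym (⊞-at (fsum (suc X) (F 0)) _ N)))

-- Units

⊠-inverse : ∀ {f} → f 0 ≡ 1ℤ → f ⊠ inverse f ≈ 𝟙
⊠-inverse {f} p = pointwise λ n → trans (cong (λ h → h n) (⊠≡⊛ f (inverse f))) (⊛-inverseʳ f p n)

⊠-cancelˡ : ∀ u {v a b} → u ⊠ v ≈ 𝟙 → u ⊠ a ≈ u ⊠ b → a ≈ b
⊠-cancelˡ u {v} {a} {b} uv p = begin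
  a              ≈⟨ *-identityˡ a ⟨
  𝟙 ⊠ a          ≈⟨ ⊠-congʳ uv ⟨
  u ⊠ v ⊠ a      ≈⟨ solve 3 (λ u v a → u :* v :* a := v :* (u :* a)) ≈-refl u v a ⟩
  v ⊠ (u ⊠ a)    ≈⟨ ⊠-congˡ p ⟩
  v ⊠ (u ⊠ b)    ≈⟨ solve 3 (λ u v a → u :* v :* a := v :* (u :* a)) ≈-refl u v b ⟨
  u ⊠ v ⊠ b      ≈⟨ ⊠-congʳ uv ⟩
  𝟙 ⊠ b          ≈⟨ *-identityˡ b ⟩
  b              ∎

⊠-cancel : ∀ u {a b} → u 0 ≡ 1ℤ → u ⊠ a ≈ u ⊠ b → a ≈ b
⊠-cancel u u₀ = ⊠-cancelˡ u (⊠-inverse u₀)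

unit-⊠ : ∀ {f g} → f 0 ≡ 1ℤ → g 0 ≡ 1ℤ → (f ⊠ g) 0 ≡ 1ℤ
unit-⊠ {f} {g} p r = trans (⊠-at-zero f g) (cong₂ ℤ._*_ p r)

unit-⊞ : ∀ {f g} → f 0 ≡ 1ℤ → Ord 1 g → (f ⊞ g) 0 ≡ 1ℤ
unit-⊞ {f} {g} p o = trans (⊞-at f g 0) (cong₂ ℤ._+_ p (vanish o (s≤s z≤n)))

unit-⇡ : ∀ {f} n → f 0 ≡ 1ℤ → (f ⇡ n) 0 ≡ 1ℤ
unit-⇡ zero    p = refl
unit-⇡ {f} (suc n) p = unit-⊠ {f} p (unit-⇡ n p)

-- Euler's products

tri : ℕ → ℕ
tri zero    = 0
tri (suc n) = n + tri n

-- (c ; c)ₖ and its inverse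
qfac rfac : Series → ℕ → Series
qfac c zero    = 𝟙
qfac c (suc k) = qfac c k ⊠ (𝟙 ⊞ ⊟ c ⇡ suc k)
rfac c k = inverse (qfac c k)

1-unit : ∀ {x} → Ord 1 x → (𝟙 ⊞ ⊟ x) 0 ≡ 1ℤ
1-unit o = unit-⊞ {𝟙} refl (Ord-⊟ o)

Ord-⇡suc : ∀ {x} n → Ord 1 x → Ord 1 (x ⇡ suc n)
Ord-⇡suc n o = Ord-⊠ˡ o

qfac-unit : ∀ {c} → Ord 1 c → ∀ k → qfac c k 0 ≡ 1ℤ
qfac-unit o zero    = refl
qfac-unit {c} o (suc k) = unit-⊠ {qfac c k} (qfac-unit o k) (1-unit (Ord-⇡suc k o))

rfac-inverse : ∀ {c} → Ord 1 c → ∀ k → qfac c k ⊠ rfac c k ≈ 𝟙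
rfac-inverse o k = ⊠-inverse (qfac-unit o k)

inverse-unique : ∀ f {g} → f 0 ≡ 1ℤ → f ⊠ g ≈ 𝟙 → g ≈ inverse f
inverse-unique f p r = ⊠-cancel f p (≈-trans r (≈-sym (⊠-inverse p)))

rfac-zero : ∀ c → rfac c 0 ≈ 𝟙
rfac-zero c = ≈-sym (inverse-unique 𝟙 refl (*-identityˡ 𝟙))

rfac-step : ∀ {c} → Ord 1 c → ∀ k → rfac c k ≈ rfac c (suc k) ⊠ (𝟙 ⊞ ⊟ c ⇡ suc k)
rfac-step {c} o k = ≈-sym (inverse-unique (qfac c k) (qfac-unit o k) (≈-trans
  (solve 3 (λ f r u → f :* (r :* u) := f :* u :* r) ≈-refl (qfac c k) (rfac c (suc k)) _)
  (rfac-inverse o (suc k))))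

qfac-cong : ∀ {c d} → c ≈ d → ∀ k → qfac c k ≈ qfac d k
qfac-cong p zero    = ≈-refl
qfac-cong p (suc k) = qfac-cong p k ⟨⊠⟩ ⊞-congˡ (⟨⊟⟩ ⇡-congˡ (suc k) p)

rfac-cong : ∀ {c d} → Ord 1 c → c ≈ d → ∀ k → rfac c k ≈ rfac d k
rfac-cong {c} {d} o p k = inverse-unique (qfac d k) (qfac-unit (Ord-≈ p o) k)
  (≈-trans (⊠-congʳ (≈-sym (qfac-cong p k))) (rfac-inverse o k))

eulerTerm : Series → Series → ℕ → Series
eulerTerm x c k = x ⇡ k ⊠ c ⇡ tri k ⊠ rfac c k

-- ∏_{i ≥ 0} (1 + x cⁱ), by Euler's expansion
Euler : Series → Series → Series
Euler x c = Sum 0 (eulerTerm x c)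

eulerTerm-Ord : ∀ {x} c → Ord 1 x → Summable 0 (eulerTerm x c)
eulerTerm-Ord c o k = Ord-⊠ˡ (Ord-⊠ˡ (Ord-⇡ k o))

eulerTerm-zero : ∀ x c → eulerTerm x c 0 ≈ 𝟙
eulerTerm-zero x c = ≈-trans (⊠-congˡ (rfac-zero c)) (≈-trans (*-identityʳ _) (*-identityʳ 𝟙))

-- Split `1` as `c^(k+1) + (1 - c^(k+1))`. The first part turns `x` into `x c`; the second cancels
-- the last factor of `(c ; c)` and lowers `k`.
eulerTerm-suc : ∀ {x c} → Ord 1 c → ∀ k →
  eulerTerm x c (suc k) ≈ eulerTerm (x ⊠ c) c (suc k) ⊞ x ⊠ eulerTerm (x ⊠ c) c k
eulerTerm-suc {x} {c} o k = begin
  x ⊠ x ⇡ k ⊠ c ⇡ (k + tri k) ⊠ r′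
    ≈⟨ ⊠-congʳ (⊠-congˡ (⇡-+ c k (tri k))) ⟩
  x ⊠ x ⇡ k ⊠ (c ⇡ k ⊠ c ⇡ tri k) ⊠ r′
    ≈⟨ solve 6 (λ x c X C T r → x :* X :* (C :* T) :* r :=
         x :* c :* (X :* C) :* (C :* T) :* r :+ x :* (X :* C :* T :* (r :* (x :^ 0 :- c :* C)))) ≈-refl
         x c (x ⇡ k) (c ⇡ k) (c ⇡ tri k) r′ ⟩
  x ⊠ c ⊠ (x ⇡ k ⊠ c ⇡ k) ⊠ (c ⇡ k ⊠ c ⇡ tri k) ⊠ r′ ⊞
  x ⊠ (x ⇡ k ⊠ c ⇡ k ⊠ c ⇡ tri k ⊠ (r′ ⊠ (𝟙 ⊞ ⊟ c ⇡ suc k)))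
    ≈⟨ (⊠-congʳ (⊠-congˡ (⇡-distrib x c k) ⟨⊠⟩ ⇡-+ c k (tri k))) ⟨⊞⟩
       ⊠-congˡ (⊠-congʳ (⇡-distrib x c k) ⟨⊠⟩ rfac-step o k) ⟨
  eulerTerm (x ⊠ c) c (suc k) ⊞ x ⊠ eulerTerm (x ⊠ c) c k ∎
  where r′ = rfac c (suc k)

Euler-step : ∀ {x c} → Ord 1 c → Ord 1 x → Euler x c ≈ (𝟙 ⊞ x) ⊠ Euler (x ⊠ c) c
Euler-step {x} {c} oc ox = begin
  Euler x c
    ≈⟨ Sum-uncons (eulerTerm-Ord c ox) ⟩
  eulerTerm x c 0 ⊞ Sum 0 (λ k → eulerTerm x c (suc k))
    ≈⟨ ⊞-congˡ (Sum-cong (eulerTerm-suc oc)) ⟩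
  eulerTerm x c 0 ⊞ Sum 0 (λ k → eulerTerm (x ⊠ c) c (suc k) ⊞ x ⊠ eulerTerm (x ⊠ c) c k)
    ≈⟨ ⊞-congˡ (Sum-⊞ _ _) ⟩
  eulerTerm x c 0 ⊞ (Sum 0 (λ k → eulerTerm (x ⊠ c) c (suc k)) ⊞ Sum 0 (λ k → x ⊠ eulerTerm (x ⊠ c) c k))
    ≈⟨ ⊞-assoc _ _ _ ⟨
  eulerTerm (x ⊠ c) c 0 ⊞ Sum 0 (λ k → eulerTerm (x ⊠ c) c (suc k)) ⊞ Sum 0 (λ k → x ⊠ eulerTerm (x ⊠ c) c k)
    ≈⟨ Sum-uncons (eulerTerm-Ord c (Ord-⊠ˡ ox)) ⟨⊞⟩ Sum-⊠ x (eulerTerm-Ord c (Ord-⊠ˡ ox)) ⟨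
  Euler (x ⊠ c) c ⊞ x ⊠ Euler (x ⊠ c) c
    ≈⟨ ≈-trans (⊠-distribʳ _ 𝟙 x) (⊞-congʳ (*-identityˡ _)) ⟨
  (𝟙 ⊞ x) ⊠ Euler (x ⊠ c) c ∎

Euler-cong : ∀ {x y c d} → Ord 1 c → x ≈ y → c ≈ d → Euler x c ≈ Euler y d
Euler-cong oc p r = Sum-cong λ k → (⇡-congˡ k p ⟨⊠⟩ ⇡-congˡ (tri k) r) ⟨⊠⟩ rfac-cong oc r k

Euler-≈𝟙 : ∀ {x c n} → Ord (suc n) x → Euler x c ≈[ suc n ] 𝟙
Euler-≈𝟙 {x} {c} o = ≈[]-trans (≈⇒≈[] (Sum-uncons (eulerTerm-Ord c (Ord-≤ (s≤s z≤n) o))))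
  (≈[]-⊞-Ord (≈⇒≈[] (eulerTerm-zero x c)) (Ord-Sum λ k → Ord-⊠ˡ (Ord-⊠ˡ (Ord-⊠ˡ o))))

Euler-unit : ∀ {x c} → Ord 1 x → Euler x c 0 ≡ 1ℤ
Euler-unit {x} {c} o = agree (Euler-≈𝟙 {x} {c} {0} o) (s≤s z≤n)

partial : (ℕ → Series) → ℕ → Series
partial a zero    = 𝟙
partial a (suc n) = partial a n ⊠ a n

unroll : ∀ (X a : ℕ → Series) → (∀ n → X n ≈ a n ⊠ X (suc n)) → ∀ n → X 0 ≈ partial a n ⊠ X n
unroll X a p zero    = ≈-sym (*-identityˡ _)
unroll X a p (suc n) = ≈-trans (unroll X a p n) (≈-trans (⊠-congˡ (p n)) (≈-sym (*-assoc _ _ _)))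

-- Both sides are the infinite product of the a n.
unroll-unique : ∀ (X Y a : ℕ → Series) → (∀ n → X n ≈ a n ⊠ X (suc n)) → (∀ n → Y n ≈ a n ⊠ Y (suc n)) →
                (∀ n → X n ≈[ n ] 𝟙) → (∀ n → Y n ≈[ n ] 𝟙) → X 0 ≈ Y 0
unroll-unique X Y a p r x y = ≈-from-≈[] λ n →
  ≈[]-trans (≈⇒≈[] (unroll X a p n))
  (≈[]-trans (≈[]-⊠ {f = partial a n} (≈⇒≈[] ≈-refl) (≈[]-trans (x n) (≈[]-sym (y n))))
             (≈⇒≈[] (≈-sym (unroll Y a r n))))

Ord-⊠⇡ : ∀ {x c} → Ord 1 c → Ord 1 x → ∀ n → Ord (suc n) (x ⊠ c ⇡ n)
Ord-⊠⇡ oc ox n = Ord-⊠ ox (Ord-⇡ n oc)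

Euler-tail-≈𝟙 : ∀ {x c} d → Ord 1 c → Ord 1 x → ∀ n → Euler (x ⊠ c ⇡ n) d ≈[ n ] 𝟙
Euler-tail-≈𝟙 {x} {c} d oc ox n = upTo λ m<n → agree (Euler-≈𝟙 {c = d} (Ord-⊠⇡ oc ox n)) (ℕ.m<n⇒m<1+n m<n)

≈[]-⊠-𝟙 : ∀ {k f g} → f ≈[ k ] 𝟙 → g ≈[ k ] 𝟙 → f ⊠ g ≈[ k ] 𝟙
≈[]-⊠-𝟙 p r = ≈[]-trans (≈[]-⊠ p r) (≈⇒≈[] (*-identityˡ 𝟙))

module _ {x c : Series} (oc : Ord 1 c) (ox : Ord 1 x) where
  private
    z : ℕ → Series
    z n = x ⊠ c ⇡ n

    oz : ∀ n → Ord 1 (z n)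
    oz n = Ord-⊠ˡ ox

    oc^ : ∀ n → Ord 1 (c ⇡ suc n)
    oc^ n = Ord-⇡suc n oc

    z₀ : z 0 ≈ x
    z₀ = *-identityʳ x

  Euler-unroll : ∀ n → Euler (z n) c ≈ (𝟙 ⊞ z n) ⊠ Euler (z (suc n)) c
  Euler-unroll n = ≈-trans (Euler-step oc (oz n))
    (⊠-congˡ (Euler-cong oc (solve 3 (λ x c C → x :* C :* c := x :* (c :* C)) ≈-refl x c (c ⇡ n)) ≈-refl))

  -- Products are compared through the functional equation `X n ≈ (1 + x cⁿ) X (n+1)`. On the right,
  -- one `Euler-step` of the first factor produces `1 + x cⁿ` and makes that factor the second one
  -- of `Y (n+1)`. The split into three works alike.
  Euler-split₂ : Euler x c ≈ Euler x (c ⇡ 2) ⊠ Euler (x ⊠ c) (c ⇡ 2)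
  Euler-split₂ = begin
    Euler x c                                         ≈⟨ Euler-cong oc z₀ ≈-refl ⟨
    Euler (z 0) c                                     ≈⟨ unroll-unique (λ n → Euler (z n) c) Y
        (λ n → 𝟙 ⊞ z n) Euler-unroll step
                                                           (Euler-tail-≈𝟙 c oc ox) (λ n → ≈[]-⊠-𝟙
                                                               (Y₁ n) (Y₂ n)) ⟩
    Y 0                                               ≈⟨ Euler-cong (oc^ 1) z₀ ≈-refl ⟨⊠⟩ Euler-cong
        (oc^ 1) (⊠-congˡ (*-identityʳ c)) ≈-refl ⟩
    Euler x (c ⇡ 2) ⊠ Euler (x ⊠ c) (c ⇡ 2)           ∎
    where
    Y : ℕ → Series
    Y n = Euler (z n) (c ⇡ 2) ⊠ Euler (z (suc n)) (c ⇡ 2)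
    Y₁ : ∀ n → Euler (z n) (c ⇡ 2) ≈[ n ] 𝟙
    Y₁ = Euler-tail-≈𝟙 (c ⇡ 2) oc ox
    Y₂ : ∀ n → Euler (z (suc n)) (c ⇡ 2) ≈[ n ] 𝟙
    Y₂ n = upTo λ m<n → agree (Euler-tail-≈𝟙 (c ⇡ 2) oc ox (suc n)) (ℕ.m<n⇒m<1+n m<n)
    step : ∀ n → Y n ≈ (𝟙 ⊞ z n) ⊠ Y (suc n)
    step n = ≈-trans
      (⊠-congʳ (≈-trans (Euler-step (oc^ 1) (oz n)) (⊠-congˡ (Euler-cong (oc^ 1)
        (solve 3 (λ x c C → x :* C :* c :^ 2 := x :* (c :* (c :* C))) ≈-refl x c (c ⇡ n)) ≈-refl))))
      (solve 3 (λ u a b → u :* a :* b := u :* (b :* a)) ≈-refl (𝟙 ⊞ z n) _ _)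

  Euler-split₃ : Euler x c ≈ Euler x (c ⇡ 3) ⊠ Euler (x ⊠ c) (c ⇡ 3) ⊠ Euler (x ⊠ c ⇡ 2) (c ⇡ 3)
  Euler-split₃ = begin
    Euler x c                                         ≈⟨ Euler-cong oc z₀ ≈-refl ⟨
    Euler (z 0) c                                     ≈⟨ unroll-unique (λ n → Euler (z n) c) Y
        (λ n → 𝟙 ⊞ z n) Euler-unroll step
                                                           (Euler-tail-≈𝟙 c oc ox) (λ n → ≈[]-⊠-𝟙
                                                               (≈[]-⊠-𝟙 (Yᵢ 0 n) (Yᵢ 1 n)) (Yᵢ 2 n)) ⟩
    Y 0                                               ≈⟨
        (Euler-cong (oc^ 2) z₀ ≈-refl ⟨⊠⟩ Euler-cong (oc^ 2) (⊠-congˡ (*-identityʳ c)) ≈-refl)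
                                                         ⟨⊠⟩ ≈-refl ⟩
    Euler x (c ⇡ 3) ⊠ Euler (x ⊠ c) (c ⇡ 3) ⊠ Euler (x ⊠ c ⇡ 2) (c ⇡ 3) ∎
    where
    Y : ℕ → Series
    Y n = Euler (z n) (c ⇡ 3) ⊠ Euler (z (1 + n)) (c ⇡ 3) ⊠ Euler (z (2 + n)) (c ⇡ 3)
    Yᵢ : ∀ i n → Euler (z (i + n)) (c ⇡ 3) ≈[ n ] 𝟙
    Yᵢ i n = upTo λ m<n → agree (Euler-tail-≈𝟙 (c ⇡ 3) oc ox (i + n)) (ℕ.<-≤-trans m<n (ℕ.m≤n+m n i))
    step : ∀ n → Y n ≈ (𝟙 ⊞ z n) ⊠ Y (suc n)
    step n = ≈-trans
      (⊠-congʳ (⊠-congʳ (≈-trans (Euler-step (oc^ 2) (oz n)) (⊠-congˡ (Euler-cong (oc^ 2)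
        (solve 3 (λ x c C → x :* C :* c :^ 3 := x :* (c :* (c :* (c :* C)))) ≈-refl x c (c ⇡ n)) ≈-refl)))))
      (solve 4 (λ u a b d → u :* a :* b :* d := u :* (b :* d :* a)) ≈-refl (𝟙 ⊞ z n) _ _ _)

  -- Factor by factor, `(1 + x cⁱ)(1 - x cⁱ) = 1 - x² c^(2i)`.
  Euler-conjugate : Euler x c ⊠ Euler (⊟ x) c ≈ Euler (⊟ x ⇡ 2) (c ⇡ 2)
  Euler-conjugate = begin
    Euler x c ⊠ Euler (⊟ x) c                         ≈⟨ Euler-cong oc z₀ ≈-refl ⟨⊠⟩ Euler-cong oc
        (*-identityʳ (⊟ x)) ≈-refl ⟨
    X 0                                               ≈⟨ unroll-unique X Y
        (λ n → (𝟙 ⊞ z n) ⊠ (𝟙 ⊞ z′ n)) stepX stepY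
                                                           (λ n → ≈[]-⊠-𝟙 (Euler-tail-≈𝟙 c oc ox n)
                                                               (Euler-tail-≈𝟙 c oc (Ord-⊟ ox) n))
                                                           (Euler-tail-≈𝟙 (c ⇡ 2) (oc^ 1) oy) ⟩
    Y 0                                               ≈⟨ Euler-cong (oc^ 1) (*-identityʳ _) ≈-refl ⟩
    Euler (⊟ x ⇡ 2) (c ⇡ 2)                           ∎
    where
    oy : Ord 1 (⊟ x ⇡ 2)
    oy = Ord-⊟ (Ord-⇡suc 1 ox)
    z′ X Y : ℕ → Series
    z′ n = ⊟ x ⊠ c ⇡ n
    X n = Euler (z n) c ⊠ Euler (z′ n) c
    Y n = Euler (⊟ x ⇡ 2 ⊠ (c ⇡ 2) ⇡ n) (c ⇡ 2)
    stepX : ∀ n → X n ≈ (𝟙 ⊞ z n) ⊠ (𝟙 ⊞ z′ n) ⊠ X (suc n)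
    stepX n = ≈-trans (Euler-unroll n ⟨⊠⟩ ≈-trans (Euler-step oc (Ord-⊠ˡ (Ord-⊟ ox)))
        (⊠-congˡ (Euler-cong oc (solve 3 (λ x c C → :- x :* C :* c := :- x :* (c :* C)) ≈-refl x c
            (c ⇡ n)) ≈-refl)))
      (solve 4 (λ a b u v → a :* b :* (u :* v) := a :* u :* (b :* v)) ≈-refl _ _ _ _)
    stepY : ∀ n → Y n ≈ (𝟙 ⊞ z n) ⊠ (𝟙 ⊞ z′ n) ⊠ Y (suc n)
    stepY n = ≈-trans (Euler-step (oc^ 1) (Ord-⊠ˡ oy))
      (≈-trans (⊞-congˡ (⊠-congˡ (⇡-distrib c (c ⇡ 1) n)) ⟨⊠⟩ Euler-cong (oc^ 1)
          (solve 3 (λ x d D → :- (x :^ 2) :* D :* d := :- (x :^ 2) :* (d :* D)) ≈-refl x (c ⇡ 2)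
              ((c ⇡ 2) ⇡ n)) ≈-refl)
        (⊠-congʳ (≈-trans (⊞-congˡ (⊠-congˡ (⊠-congˡ (⇡-congˡ n (*-identityʳ c)))))
          (solve 2 (λ x C → x :^ 0 :+ :- (x :^ 2) :* (C :* C) := (x :^ 0 :+ x :* C) :*
              (x :^ 0 :+ :- x :* C)) ≈-refl x (c ⇡ n)))))

-- The triple product identity

-- Θ x y = Σ_{n ∈ ℤ} x^{n(n+1)/2} y^{n(n-1)/2}
thetaTerm : Series → Series → ℕ → Series
thetaTerm x c n = x ⇡ n ⊠ c ⇡ tri n

Θ : Series → Series → Series
Θ x y = Sum 0 (thetaTerm x (x ⊠ y)) ⊞ Sum 0 (λ n → thetaTerm y (x ⊠ y) (suc n))

thetaTerm-Ord : ∀ {x} c n → Ord 1 x → Ord n (thetaTerm x c n)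
thetaTerm-Ord c n o = Ord-⊠ˡ (Ord-⇡ n o)

thetaTerm-suc : ∀ x c n → thetaTerm x c (suc n) ≈ thetaTerm x c n ⊠ (x ⊠ c ⇡ n)
thetaTerm-suc x c n = ≈-trans (⊠-congˡ (⇡-+ c n (tri n)))
  (solve 4 (λ x X C T → x :* X :* (C :* T) := X :* T :* (x :* C)) ≈-refl x (x ⇡ n) (c ⇡ n) (c ⇡ tri n))

thetaTerm-cong : ∀ {x x′ c c′} → x ≈ x′ → c ≈ c′ → ∀ n → thetaTerm x c n ≈ thetaTerm x′ c′ n
thetaTerm-cong p r n = ⇡-congˡ n p ⟨⊠⟩ ⇡-congˡ (tri n) r

Θ-cong : ∀ {x x′ y y′} → x ≈ x′ → y ≈ y′ → Θ x y ≈ Θ x′ y′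
Θ-cong p r = Sum-cong (thetaTerm-cong p (p ⟨⊠⟩ r)) ⟨⊞⟩ Sum-cong (λ n → thetaTerm-cong r (p ⟨⊠⟩ r) (suc n))

-- The term of index l - n of the bilateral series Θ x y.
bilateral : Series → Series → ℕ → ℕ → Series
bilateral x y zero    l       = thetaTerm x (x ⊠ y) l
bilateral x y (suc n) zero    = thetaTerm y (x ⊠ y) (suc n)
bilateral x y (suc n) (suc l) = bilateral x y n l

bilateral-zero : ∀ x y n → bilateral x y n 0 ≈ thetaTerm y (x ⊠ y) n
bilateral-zero x y zero    = ≈-refl
bilateral-zero x y (suc n) = ≈-refl

-- The quotient of the terms of index `l - n - 1` and `l - n` is `y c^(n-l)` with `c = x y`; it is
-- stated without negative exponents.
bilateral-shift : ∀ x y n l → bilateral x y (suc n) l ⊠ (x ⊠ y) ⇡ l ≈ bilateral x y n l ⊠ (y ⊠ (x ⊠ y) ⇡ n)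
bilateral-shift x y n zero = begin
  thetaTerm y (x ⊠ y) (suc n) ⊠ 𝟙                     ≈⟨ *-identityʳ _ ⟩
  thetaTerm y (x ⊠ y) (suc n)                         ≈⟨ thetaTerm-suc y (x ⊠ y) n ⟩
  thetaTerm y (x ⊠ y) n ⊠ (y ⊠ (x ⊠ y) ⇡ n)           ≈⟨ ⊠-congʳ (bilateral-zero x y n) ⟨
  bilateral x y n 0 ⊠ (y ⊠ (x ⊠ y) ⇡ n)               ∎
bilateral-shift x y zero (suc l) = ≈-trans
  (solve 4 (λ x y T C → T :* (x :* y :* C) := T :* (x :* C) :* (y :* x :^ 0)) ≈-refl x y
      (thetaTerm x (x ⊠ y) l) ((x ⊠ y) ⇡ l))
  (⊠-congʳ (≈-sym (thetaTerm-suc x (x ⊠ y) l)))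
bilateral-shift x y (suc n) (suc l) = ≈-trans
  (solve 3 (λ c B C → B :* (c :* C) := c :* (B :* C)) ≈-refl (x ⊠ y) (bilateral x y (suc n) l) ((x ⊠ y) ⇡ l))
  (≈-trans (⊠-congˡ (bilateral-shift x y n l))
  (solve 4 (λ c B y C → c :* (B :* (y :* C)) := B :* (y :* (c :* C))) ≈-refl (x ⊠ y)
      (bilateral x y n l) y ((x ⊠ y) ⇡ n)))

-- Of the two bounds on the same terms, this one makes the sum over `l` converge, while
-- `bilateral-Ordˡ` makes the terms with `l < n` small, as needed when `n` grows.
bilateral-Ordʳ : ∀ {x y} → Ord 1 x → ∀ n l → Ord (l ∸ n) (bilateral x y n l)
bilateral-Ordʳ ox zero    l       = thetaTerm-Ord _ l ox
bilateral-Ordʳ ox (suc n) zero    = Ord-zero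
bilateral-Ordʳ ox (suc n) (suc l) = bilateral-Ordʳ ox n l

bilateral-Ordˡ : ∀ {x y} → Ord 1 y → ∀ n l → Ord (n ∸ l) (bilateral x y n l)
bilateral-Ordˡ {x} {y} oy zero l  = Ord-≤ (ℕ.≤-reflexive (ℕ.0∸n≡0 l)) Ord-zero
bilateral-Ordˡ oy (suc n) zero    = thetaTerm-Ord _ (suc n) oy
bilateral-Ordˡ oy (suc n) (suc l) = bilateral-Ordˡ oy n l

module _ {x y : Series} (ox : Ord 1 x) (oy : Ord 1 y) where
  private
    c : Series
    c = x ⊠ y

    oc : Ord 1 c
    oc = Ord-⊠ˡ ox

    β : ℕ → ℕ → Series
    β = bilateral x y

  -- (-y ; c)ₙ (-x ; c)_∞, expanded
  shiftedEuler : ℕ → Series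
  shiftedEuler n = Sum n (λ l → β n l ⊠ rfac c l)

  private
    summable : ∀ n → Summable n (λ l → β n l ⊠ rfac c l)
    summable n l = Ord-⊠ˡ (bilateral-Ordʳ ox n l)

  -- Since `1/(c)ₗ₊₁ = 1/(c)ₗ + c^(l+1)/(c)ₗ₊₁`, one part reproduces `shiftedEuler n`; in the other
  -- `bilateral-shift` trades `c^(l+1)` for `y cⁿ` and advances the bilateral index.
  shiftedEuler-suc : ∀ n → shiftedEuler (suc n) ≈ (𝟙 ⊞ y ⊠ c ⇡ n) ⊠ shiftedEuler n
  shiftedEuler-suc n = begin
    shiftedEuler (suc n)
      ≈⟨ Sum-suc-offset _ ⟩
    β (suc n) 0 ⊠ rfac c 0 ⊞ Sum n (λ l → β n l ⊠ rfac c (suc l))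
      ≈⟨ ⊠-congʳ (≈-trans (≈-sym (*-identityʳ _)) (bilateral-shift x y n 0)) ⟨⊞⟩ Sum-cong recurrence ⟩
    β n 0 ⊠ (y ⊠ c ⇡ n) ⊠ rfac c 0 ⊞ Sum n (λ l → β n l ⊠ rfac c l ⊞ y ⊠ c ⇡ n ⊠
        (β n (suc l) ⊠ rfac c (suc l)))
      ≈⟨ ⊞-congˡ (≈-trans (Sum-⊞ _ _) (⊞-congˡ (≈-sym
           (Sum-⊠ (y ⊠ c ⇡ n) λ l → Ord-≤ (ℕ.∸-monoˡ-≤ n (ℕ.n≤1+n l)) (summable n (suc l)))))) ⟩
    β n 0 ⊠ (y ⊠ c ⇡ n) ⊠ rfac c 0 ⊞ (shiftedEuler n ⊞ y ⊠ c ⇡ n ⊠ Sum n (λ l → β n (suc l) ⊠ rfac c (suc l)))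
      ≈⟨ solve 5 (λ b u r s t → b :* u :* r :+ (s :+ u :* t) := s :+ u :* (b :* r :+ t)) ≈-refl
           (β n 0) (y ⊠ c ⇡ n) (rfac c 0) _ _ ⟩
    shiftedEuler n ⊞ y ⊠ c ⇡ n ⊠ (β n 0 ⊠ rfac c 0 ⊞ Sum n (λ l → β n (suc l) ⊠ rfac c (suc l)))
      ≈⟨ ⊞-congˡ (⊠-congˡ (Sum-uncons (summable n))) ⟨
    shiftedEuler n ⊞ y ⊠ c ⇡ n ⊠ shiftedEuler n
      ≈⟨ ≈-trans (⊠-distribʳ _ _ _) (⊞-congʳ (*-identityˡ _)) ⟨
    (𝟙 ⊞ y ⊠ c ⇡ n) ⊠ shiftedEuler n ∎
    where
    recurrence : ∀ l → β n l ⊠ rfac c (suc l) ≈ β n l ⊠ rfac c l ⊞ y ⊠ c ⇡ n ⊠ (β n (suc l) ⊠ rfac c (suc l))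
    recurrence l = begin
      β n l ⊠ r
        ≈⟨ solve 3 (λ b r u → b :* r := b :* (r :* (b :^ 0 :- u)) :+ b :* u :* r) ≈-refl (β n l) r
             (c ⇡ suc l) ⟩
      β n l ⊠ (r ⊠ (𝟙 ⊞ ⊟ c ⇡ suc l)) ⊞ β n l ⊠ c ⇡ suc l ⊠ r
        ≈⟨ ⊠-congˡ (rfac-step oc l) ⟨⊞⟩ ⊠-congʳ (≈-sym (bilateral-shift x y n (suc l))) ⟨
      β n l ⊠ rfac c l ⊞ β n (suc l) ⊠ (y ⊠ c ⇡ n) ⊠ r
        ≈⟨ ⊞-congˡ (solve 3 (λ b u r → b :* u :* r := u :* (b :* r)) ≈-refl (β n (suc l)) (y ⊠ c ⇡ n) r) ⟩
      β n l ⊠ rfac c l ⊞ y ⊠ c ⇡ n ⊠ (β n (suc l) ⊠ r) ∎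
      where r = rfac c (suc l)

  shiftedEuler-product : ∀ n → shiftedEuler n ≈ partial (λ i → 𝟙 ⊞ y ⊠ c ⇡ i) n ⊠ Euler x c
  shiftedEuler-product zero    = ≈-sym (*-identityˡ _)
  shiftedEuler-product (suc n) = ≈-trans (shiftedEuler-suc n) (≈-trans (⊠-congˡ (shiftedEuler-product n))
    (solve 3 (λ u p e → u :* (p :* e) := p :* u :* e) ≈-refl (𝟙 ⊞ y ⊠ c ⇡ n) _ _))

  private
    J : Series
    J = Euler (⊟ c) c

    J-rfac : ∀ l → J ⊠ rfac c l ≈ Euler (⊟ c ⊠ c ⇡ l) c
    J-rfac l = begin
      J ⊠ rfac c l                                    ≈⟨ ⊠-congʳ (split l) ⟩
      qfac c l ⊠ Euler (⊟ c ⊠ c ⇡ l) c ⊠ rfac c l     ≈⟨ solve 3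
          (λ f e r → f :* e :* r := f :* r :* e) ≈-refl (qfac c l) _ _ ⟩
      qfac c l ⊠ rfac c l ⊠ Euler (⊟ c ⊠ c ⇡ l) c     ≈⟨ ⊠-congʳ (rfac-inverse oc l) ⟩
      𝟙 ⊠ Euler (⊟ c ⊠ c ⇡ l) c                       ≈⟨ *-identityˡ _ ⟩
      Euler (⊟ c ⊠ c ⇡ l) c                           ∎
      where
      split : ∀ l → J ≈ qfac c l ⊠ Euler (⊟ c ⊠ c ⇡ l) c
      split zero    = ≈-sym (≈-trans (*-identityˡ _) (Euler-cong oc (*-identityʳ _) ≈-refl))
      split (suc l) = ≈-trans (split l) (≈-trans (⊠-congˡ (≈-trans (Euler-unroll oc (Ord-⊟ oc) l)
        (⊠-congʳ (⊞-congˡ (solve 2 (λ c C → :- c :* C := :- (c :* C)) ≈-refl c (c ⇡ l))))))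
        (≈-sym (*-assoc _ _ _)))

    J-rfac-≈𝟙 : ∀ l → J ⊠ rfac c l ≈[ suc l ] 𝟙
    J-rfac-≈𝟙 l = ≈[]-trans (≈⇒≈[] (J-rfac l))
      (upTo λ m< → agree (Euler-≈𝟙 (Ord-⊠ (Ord-⊟ oc) (Ord-⇡ l oc))) m<)

    -- Replacing `J ⊠ rfac c l` by 1 alters the term of index `l` by a series of order at least
    -- `(n ∸ l) + (l + 1)`, which exceeds `n`.
    truncated : ∀ n → J ⊠ shiftedEuler n ≈[ n ] Sum n (β n)
    truncated n = upTo λ {m} m<n → trans (at (Sum-⊠ J (summable n)) m)
      (trans (Sum-def n _ m) (trans (fsum-cong-at (n + suc m) _ (β n) m λ l _ → term l m m<n)
          (sym (Sum-def n (β n) m))))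
      where
      term : ∀ l m → m < n → (J ⊠ (β n l ⊠ rfac c l)) m ≡ β n l m
      term l m m<n = trans
        (at (solve 3 (λ j b r → j :* (b :* r) := b :+ b :* (j :* r :- j :^ 0)) ≈-refl J (β n l) (rfac c l)) m)
        (agree (≈[]-⊞-Ord {f = β n l} (≈⇒≈[] ≈-refl)
            (Ord-≤ (ℕ.≤-trans (ℕ.n≤1+n n) (ℕ.≤-trans (s≤s (ℕ.m≤n+m∸n n l))
                (ℕ.≤-reflexive (trans (cong suc (ℕ.+-comm l (n ∸ l))) (sym (ℕ.+-suc (n ∸ l) l))))))
          (Ord-⊠ (bilateral-Ordˡ oy n l) (diff-Ord (J-rfac-≈𝟙 l))))) m<n)
        where
        diff-Ord : ∀ {k f} → f ≈[ k ] 𝟙 → Ord k (f ⊞ ⊟ 𝟙)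
        diff-Ord {f = f} p = ord λ {m} m<k → trans (⊞-at f (⊟ 𝟙) m)
          (trans (cong₂ ℤ._+_ (agree p m<k) (⊟-at 𝟙 m)) (ℤ.+-inverseʳ (𝟙 m)))

    bilateral-sum : ∀ n → Sum n (β n) ≈ Sum 0 (thetaTerm x c) ⊞ fsum n (λ l → thetaTerm y c (suc l))
    bilateral-sum zero    = ≈-sym (≈-trans (⊞-comm _ _) (+-identityˡ _))
    bilateral-sum (suc n) = ≈-trans (Sum-suc-offset (β (suc n))) (≈-trans (⊞-congˡ (bilateral-sum n))
      (≈-trans (solve 3 (λ a b d → a :+ (b :+ d) := b :+ (d :+ a)) ≈-refl (thetaTerm y c (suc n)) _ _)
        (⊞-congˡ (≈-sym (fsum-last n (λ l → thetaTerm y c (suc l)))))))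

    bilateral-≈Θ : ∀ n → Sum n (β n) ≈[ n ] Θ x y
    bilateral-≈Θ n = ≈[]-trans (≈⇒≈[] (bilateral-sum n)) (≈[]-⊞ {f = Sum 0 (thetaTerm x c)} (≈⇒≈[] ≈-refl)
      (upTo λ {m} m<n → Sum-at m (λ l → Ord-≤ (ℕ.n≤1+n l) (thetaTerm-Ord c (suc l) oy)) m<n))

  -- Jacobi's identity. The product over `y` is cut after `n` factors; these go into
  -- `shiftedEuler n`, the remaining ones are 1 modulo `qⁿ`, and multiplication by `J` removes the
  -- q-factorials modulo `qⁿ`.
  triple-product : Euler x c ⊠ Euler y c ⊠ J ≈ Θ x y
  triple-product = ≈-from-≈[] λ n → ≈[]-trans
    (≈⇒≈[] (≈-trans (⊠-congʳ (⊠-congˡ (unroll-y n)))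
      (≈-trans (solve 4 (λ e p f j → e :* (p :* f) :* j := j :* (p :* e) :* f) ≈-refl (Euler x c) _ _ J)
        (⊠-congʳ (⊠-congˡ (≈-sym (shiftedEuler-product n)))))))
    (≈[]-trans (≈[]-⊠ (≈[]-trans (truncated n) (bilateral-≈Θ n)) (Euler-tail-≈𝟙 c oc oy n))
      (≈⇒≈[] (*-identityʳ _)))
    where
    unroll-y : ∀ n → Euler y c ≈ partial (λ i → 𝟙 ⊞ y ⊠ c ⇡ i) n ⊠ Euler (y ⊠ c ⇡ n) c
    unroll-y n = ≈-trans (Euler-cong oc (≈-sym (*-identityʳ y)) ≈-refl)
      (unroll (λ n → Euler (y ⊠ c ⇡ n) c) _ (Euler-unroll oc oy) n)

-- Substitution

infix 10 _[_]

-- f (s), for s without constant term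
_[_] : Series → Series → Series
f [ s ] = Sum 0 (λ n → ι (f n) ⊠ s ⇡ n)

[]-summable : ∀ (f : Series) {s} → Ord 1 s → Summable 0 (λ n → ι (f n) ⊠ s ⇡ n)
[]-summable f o n = Ord-⊠ʳ (Ord-⇡ n o)

[]-cong : ∀ {f g s t} → f ≈ g → s ≈ t → f [ s ] ≈ g [ t ]
[]-cong {f} {g} p r = Sum-cong λ n → pointwise (λ m → cong (λ a → ι a m) (at p n)) ⟨⊠⟩ ⇡-congˡ n r

[]-congʳ : ∀ {f g s} → f ≈ g → f [ s ] ≈ g [ s ]
[]-congʳ p = []-cong p ≈-refl

ι-+ : ∀ a b → ι (a ℤ.+ b) ≈ ι a ⊞ ι b
ι-+ a b = solve 0 (con (a ℤ.+ b) := con a :+ con b) ≈-refl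

ι-* : ∀ a b → ι (a ℤ.* b) ≈ ι a ⊠ ι b
ι-* a b = solve 0 (con (a ℤ.* b) := con a :* con b) ≈-refl

ι-cong : ∀ {a b} → a ≡ b → ι a ≈ ι b
ι-cong refl = ≈-refl

[]-⊞ : ∀ f g s → (f ⊞ g) [ s ] ≈ f [ s ] ⊞ g [ s ]
[]-⊞ f g s = ≈-trans
  (Sum-cong λ n → ≈-trans (⊠-congʳ (≈-trans (ι-cong (⊞-at f g n)) (ι-+ (f n) (g n))))
      (⊠-distribʳ (s ⇡ n) _ _))
  (Sum-⊞ _ _)

[]-uncons : ∀ f {s} → Ord 1 s → f [ s ] ≈ ι (f 0) ⊞ s ⊠ tail f [ s ]
[]-uncons f {s} o = ≈-trans (Sum-uncons ([]-summable f o)) (*-identityʳ _ ⟨⊞⟩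
  ≈-trans (Sum-cong λ n → solve 3 (λ a s S → a :* (s :* S) := s :* (a :* S)) ≈-refl (ι (f (suc n))) s (s ⇡ n))
          (≈-sym (Sum-⊠ s ([]-summable (tail f) o))))

[]-ι : ∀ a s → Ord 1 s → ι a [ s ] ≈ ι a
[]-ι a s o = ≈-trans ([]-uncons (ι a) o) (≈-trans (⊞-congˡ (≈-trans (⊠-congˡ zero[]) (zeroʳ s)))
  (≈-trans (⊞-comm _ _) (+-identityˡ (ι a))))
  where
  zero[] : tail (ι a) [ s ] ≈ ι 0ℤ
  zero[] = pointwise λ N → trans (Sum-def 0 _ N) (trans
      (at (fsum-cong (suc N) λ n → zeroˡ (s ⇡ n)) N) (at (fsum-zero (suc N)) N))

[]-𝟙 : ∀ s → Ord 1 s → 𝟙 [ s ] ≈ 𝟙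
[]-𝟙 s o = ≈-trans ([]-congʳ 𝟙≈ι) (≈-trans ([]-ι 1ℤ s o) (≈-sym 𝟙≈ι))

[]-q : ∀ s → Ord 1 s → q [ s ] ≈ s
[]-q s o = ≈-trans ([]-uncons q o) (≈-trans (+-identityˡ _)
    (≈-trans (⊠-congˡ (≈-trans ([]-congʳ tail-q) ([]-𝟙 s o))) (*-identityʳ s)))
  where
  tail-q : tail q ≈ 𝟙
  tail-q = pointwise λ { zero → refl ; (suc _) → refl }

ι-diag : ∀ N f g → ι ((f ⊠ g) N) ≈ diag N (λ k l → ι (f k) ⊠ ι (g l))
ι-diag zero    f g = ≈-trans (ι-cong (⊠-at-zero f g)) (ι-* (f 0) (g 0))
ι-diag (suc N) f g = ≈-trans (ι-cong (⊠-at-suc f g N)) (≈-trans (ι-+ (f 0 ℤ.* g (suc N)) _)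
  (ι-* (f 0) (g (suc N)) ⟨⊞⟩ ι-diag N (tail f) g))

[]-⊠ : ∀ f g {s} → Ord 1 s → (f ⊠ g) [ s ] ≈ f [ s ] ⊠ g [ s ]
[]-⊠ f g {s} o = ≈-sym (begin
  f [ s ] ⊠ g [ s ]
    ≈⟨ ≈-trans (*-comm _ _) (Sum-⊠ (g [ s ]) ([]-summable f o)) ⟩
  Sum 0 (λ k → g [ s ] ⊠ (ι (f k) ⊠ s ⇡ k))
    ≈⟨ Sum-cong (λ k → ≈-trans (*-comm _ _) (Sum-⊠ (ι (f k) ⊠ s ⇡ k) ([]-summable g o))) ⟩
  Sum 0 (λ k → Sum 0 (λ l → ι (f k) ⊠ s ⇡ k ⊠ (ι (g l) ⊠ s ⇡ l)))
    ≈⟨ Sum-diag (λ k l → Ord-⊠ (Ord-⊠ʳ (Ord-⇡ k o)) (Ord-⊠ʳ (Ord-⇡ l o))) ⟩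
  Sum 0 (λ N → diag N (λ k l → ι (f k) ⊠ s ⇡ k ⊠ (ι (g l) ⊠ s ⇡ l)))
    ≈⟨ Sum-cong (λ N → collect N) ⟩
  (f ⊠ g) [ s ] ∎)
  where
  collect : ∀ N → diag N (λ k l → ι (f k) ⊠ s ⇡ k ⊠ (ι (g l) ⊠ s ⇡ l)) ≈ ι ((f ⊠ g) N) ⊠ s ⇡ N
  collect N = begin
    diag N (λ k l → ι (f k) ⊠ s ⇡ k ⊠ (ι (g l) ⊠ s ⇡ l))
      ≈⟨ diag-cong N (λ { k l refl → ≈-trans
           (solve 4 (λ a S b T → a :* S :* (b :* T) := S :* T :* (a :* b)) ≈-refl (ι (f k)) (s ⇡ k)
               (ι (g l)) (s ⇡ l))
           (⊠-congʳ (≈-sym (⇡-+ s k l))) }) ⟩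
    diag N (λ k l → s ⇡ N ⊠ (ι (f k) ⊠ ι (g l)))
      ≈⟨ diag-⊠ N (s ⇡ N) _ ⟨
    s ⇡ N ⊠ diag N (λ k l → ι (f k) ⊠ ι (g l))
      ≈⟨ ≈-trans (*-comm _ _) (⊠-congʳ (≈-sym (ι-diag N f g))) ⟩
    ι ((f ⊠ g) N) ⊠ s ⇡ N ∎

⊟≈ι : ∀ f → ⊟ f ≈ ι (ℤ.- 1ℤ) ⊠ f
⊟≈ι f = solve 1 (λ f → :- f := con (ℤ.- 1ℤ) :* f) ≈-refl f

[]-⊟ : ∀ f {s} → Ord 1 s → (⊟ f) [ s ] ≈ ⊟ f [ s ]
[]-⊟ f {s} o = ≈-trans ([]-congʳ (⊟≈ι f)) (≈-trans ([]-⊠ (ι (ℤ.- 1ℤ)) f o)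
  (≈-trans (⊠-congʳ ([]-ι (ℤ.- 1ℤ) s o)) (≈-sym (⊟≈ι (f [ s ])))))

[]-⇡ : ∀ f n {s} → Ord 1 s → (f ⇡ n) [ s ] ≈ f [ s ] ⇡ n
[]-⇡ f zero    o = []-𝟙 _ o
[]-⇡ f (suc n) o = ≈-trans ([]-⊠ f (f ⇡ n) o) (⊠-congˡ ([]-⇡ f n o))

-- At the coefficient of `q^N` one cut-off `b + suc N` serves all the coefficients of index `n ≤ N`
-- that occur, and two finite sums are exchanged.
[]-Sum : ∀ {b F} s → Summable b F → Sum b F [ s ] ≈ Sum b (λ n → F n [ s ])
[]-Sum {b} {F} s o = pointwise λ N → let X = suc N ; Y = b + suc N in trans (Sum-def 0 _ N) (trans
  (fsum-cong-at X (λ n → ι (Sum b F n) ⊠ s ⇡ n) (λ n → fsum Y (λ j → ι (F j n) ⊠ s ⇡ n)) N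
    λ { n (s≤s n≤N) → at (≈-trans (⊠-congʳ (≈-trans
        (ι-cong (sym (Sum-at n o (ℕ.≤-trans (s≤s (ℕ.+-monoʳ-≤ b n≤N)) (ℕ.≤-reflexive (sym (ℕ.+-suc b N)))))))
                                  (ι-fsum Y F n)))
         (≈-trans (*-comm _ _) (≈-trans (fsum-⊠ Y (s ⇡ n) _) (fsum-cong Y λ j → *-comm _ _)))) N })
  (trans (at (fsum-swap X Y (λ n j → ι (F j n) ⊠ s ⇡ n)) N)
  (trans (fsum-cong-at Y (λ j → fsum X (λ n → ι (F j n) ⊠ s ⇡ n)) (λ j → F j [ s ]) N λ j _ → sym
      (Sum-def 0 _ N))
  (sym (Sum-def b (λ j → F j [ s ]) N)))))
  where
  ι-fsum : ∀ Y F n → ι (fsum Y F n) ≈ fsum Y (λ j → ι (F j n))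
  ι-fsum zero    F zero    = ≈-refl
  ι-fsum zero    F (suc n) = ≈-refl
  ι-fsum (suc Y) F n = ≈-trans (ι-cong (⊞-at (F 0) _ n))
      (≈-trans (ι-+ (F 0 n) _) (⊞-congˡ (ι-fsum Y (λ j → F (suc j)) n)))

[]-Ord : ∀ {f s} → Ord 1 f → Ord 1 s → Ord 1 (f [ s ])
[]-Ord {f} {s} of os = Ord-≈ (≈-sym (≈-trans ([]-uncons f os)
  (≈-trans (⊞-congʳ (ι-cong (vanish of (s≤s z≤n)))) (+-identityˡ _)))) (Ord-⊠ˡ os)

[]-qfac : ∀ c k {s} → Ord 1 s → qfac c k [ s ] ≈ qfac (c [ s ]) k
[]-qfac c zero    o = []-𝟙 _ o
[]-qfac c (suc k) {s} o = ≈-trans ([]-⊠ (qfac c k) _ o) ([]-qfac c k o ⟨⊠⟩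
  ≈-trans ([]-⊞ 𝟙 _ s) ([]-𝟙 s o ⟨⊞⟩ ≈-trans ([]-⊟ (c ⇡ suc k) o) (⟨⊟⟩ []-⇡ c (suc k) o)))

[]-rfac : ∀ {c s} → Ord 1 c → Ord 1 s → ∀ k → rfac c k [ s ] ≈ rfac (c [ s ]) k
[]-rfac {c} {s} oc os k = inverse-unique (qfac (c [ s ]) k) (qfac-unit ([]-Ord oc os) k) (≈-trans
  (⊠-congʳ (≈-sym ([]-qfac c k os))) (≈-trans (≈-sym ([]-⊠ (qfac c k) _ os))
  (≈-trans ([]-congʳ (rfac-inverse oc k)) ([]-𝟙 s os))))

[]-thetaTerm : ∀ x c n {s} → Ord 1 s → thetaTerm x c n [ s ] ≈ thetaTerm (x [ s ]) (c [ s ]) n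
[]-thetaTerm x c n os = ≈-trans ([]-⊠ (x ⇡ n) _ os) ([]-⇡ x n os ⟨⊠⟩ []-⇡ c (tri n) os)

[]-Euler : ∀ {x c s} → Ord 1 x → Ord 1 c → Ord 1 s → Euler x c [ s ] ≈ Euler (x [ s ]) (c [ s ])
[]-Euler {x} {c} {s} ox oc os = ≈-trans ([]-Sum s (eulerTerm-Ord c ox))
  (Sum-cong λ k → ≈-trans ([]-⊠ (thetaTerm x c k) _ os) ([]-thetaTerm x c k os ⟨⊠⟩ []-rfac oc os k))

[]-Θ : ∀ {x y s} → Ord 1 x → Ord 1 y → Ord 1 s → Θ x y [ s ] ≈ Θ (x [ s ]) (y [ s ])
[]-Θ {x} {y} {s} ox oy os = ≈-trans ([]-⊞ _ _ s)
  (≈-trans ([]-Sum s (λ n → thetaTerm-Ord (x ⊠ y) n ox)) (Sum-cong (term x))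
   ⟨⊞⟩ ≈-trans ([]-Sum s (λ n → Ord-≤ (ℕ.n≤1+n n) (thetaTerm-Ord (x ⊠ y) (suc n) oy)))
       (Sum-cong (λ n → term y (suc n))))
  where
  term : ∀ z n → thetaTerm z (x ⊠ y) n [ s ] ≈ thetaTerm (z [ s ]) (x [ s ] ⊠ y [ s ]) n
  term z n = ≈-trans ([]-thetaTerm z (x ⊠ y) n os) (thetaTerm-cong ≈-refl ([]-⊠ x y os) n)

-- Arithmetic progressions of coefficients

section : ℕ → ℕ → Series → Series
section k r f n = f (n * k + r)

section-cong : ∀ k r {f g} → f ≈ g → section k r f ≈ section k r g
section-cong k r p = pointwise λ n → at p (n * k + r)

section-⊞ : ∀ k r f g → section k r (f ⊞ g) ≈ section k r f ⊞ section k r g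
section-⊞ k r f g = pointwise λ n → trans (⊞-at f g _) (sym (⊞-at (section k r f) (section k r g) n))

section-ι : ∀ k r a f → section k r (ι a ⊠ f) ≈ ι a ⊠ section k r f
section-ι k r a f = pointwise λ n → trans (ι-at a f _) (sym (ι-at a (section k r f) n))

q⊠-at-suc : ∀ f n → (q ⊠ f) (suc n) ≡ f n
q⊠-at-suc f n = trans (⊠-at-suc q f n) (trans (ℤ.+-identityˡ _)
  (trans (⊠-local n (λ { zero _ → refl ; (suc _) _ → refl }) (λ _ _ → refl)) (at (*-identityˡ f) n)))

q⇡⊠-at : ∀ k f n → (q ⇡ k ⊠ f) (k + n) ≡ f n
q⇡⊠-at zero    f n = at (*-identityˡ f) n
q⇡⊠-at (suc k) f n = trans (at (*-assoc q (q ⇡ k) f) (suc k + n))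
    (trans (q⊠-at-suc (q ⇡ k ⊠ f) (k + n)) (q⇡⊠-at k f n))

-- A Horner step writes `g(q^k) f` as `g₀ f` plus `q^k` times the same expression for `tail g`, and
-- the factor `q^k` moves the section by one place. At coefficient 0 this second part vanishes
-- because `r < k`.
section-[]⊠ : ∀ {k r} → r < k → ∀ g f → section k r (g [ q ⇡ k ] ⊠ f) ≈ g ⊠ section k r f
section-[]⊠ {suc k′} {r} r<k g f = pointwise (prove g)
  where
  k = suc k′
  expand : ∀ g → g [ q ⇡ k ] ⊠ f ≈ ι (g 0) ⊠ f ⊞ q ⇡ k ⊠ (tail g [ q ⇡ k ] ⊠ f)
  expand g = ≈-trans (⊠-congʳ ([]-uncons g (Ord-⇡suc k′ Ord-q)))
    (solve 4 (λ a s h f → (a :+ s :* h) :* f := a :* f :+ s :* (h :* f)) ≈-refl (ι (g 0)) (q ⇡ k) _ f)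

  expand-at : ∀ g n → (g [ q ⇡ k ] ⊠ f) n ≡ g 0 ℤ.* f n ℤ.+ (q ⇡ k ⊠ (tail g [ q ⇡ k ] ⊠ f)) n
  expand-at g n = trans (at (expand g) n) (trans (⊞-at (ι (g 0) ⊠ f) _ n)
      (cong (ℤ._+ (q ⇡ k ⊠ (tail g [ q ⇡ k ] ⊠ f)) n) (ι-at (g 0) f n)))

  prove : ∀ g n → (g [ q ⇡ k ] ⊠ f) (n * k + r) ≡ (g ⊠ section k r f) n
  prove g zero = trans (expand-at g r) (trans
    (cong (λ z → g 0 ℤ.* f r ℤ.+ z) (vanish (Ord-⊠ˡ (Ord-⇡ k Ord-q)) r<k))
    (trans (ℤ.+-identityʳ _) (sym (⊠-at-zero g (section k r f)))))
  prove g (suc n) = trans (expand-at g (suc n * k + r)) (trans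
    (cong (λ z → g 0 ℤ.* f (suc n * k + r) ℤ.+ z)
        (trans (cong (q ⇡ k ⊠ (tail g [ q ⇡ k ] ⊠ f)) (ℕ.+-assoc k (n * k) r))
      (trans (q⇡⊠-at k _ (n * k + r)) (prove (tail g) n))))
    (sym (⊠-at-suc g (section k r f) n)))

section-𝟙-zero : ∀ k → section (suc k) 0 𝟙 ≈ 𝟙
section-𝟙-zero k = pointwise λ { zero → refl ; (suc n) → refl }

section-𝟙-suc : ∀ k r → section k (suc r) 𝟙 ≈ ι 0ℤ
section-𝟙-suc k r = pointwise λ n → trans (cong 𝟙 (ℕ.+-suc (n * k) r)) (sym (zero-at n))
  where
  zero-at : ∀ n → ι 0ℤ n ≡ 0ℤ
  zero-at zero    = refl
  zero-at (suc n) = refl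

section-q⊠-suc : ∀ k r f → section k (suc r) (q ⊠ f) ≈ section k r f
section-q⊠-suc k r f = pointwise λ n → trans (cong (q ⊠ f) (ℕ.+-suc (n * k) r)) (q⊠-at-suc f (n * k + r))

section-q⊠-zero : ∀ k f → section (suc k) 0 (q ⊠ f) ≈ q ⊠ section (suc k) k f
section-q⊠-zero k f = pointwise λ
  { zero → trans (⊠-at-zero q f) (sym (⊠-at-zero q (section (suc k) k f)))
  ; (suc n) → trans (q⊠-at-suc f (k + n * suc k + 0))
      (trans (cong f (trans (ℕ.+-identityʳ _) (ℕ.+-comm k (n * suc k))))
          (sym (q⊠-at-suc (section (suc k) k f) n))) }

section-[]-zero : ∀ k g → section (suc k) 0 (g [ q ⇡ suc k ]) ≈ g
section-[]-zero k g = ≈-trans (section-cong (suc k) 0 (≈-sym (*-identityʳ _)))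
  (≈-trans (section-[]⊠ (s≤s z≤n) g 𝟙) (≈-trans (⊠-congˡ (section-𝟙-zero k)) (*-identityʳ g)))

section-[]-suc : ∀ {k r} → suc r < k → ∀ g → section k (suc r) (g [ q ⇡ k ]) ≈ ι 0ℤ
section-[]-suc {k} {r} r<k g = ≈-trans (section-cong k (suc r) (≈-sym (*-identityʳ _)))
  (≈-trans (section-[]⊠ r<k g 𝟙) (≈-trans (⊠-congˡ (section-𝟙-suc k r)) (zeroʳ g)))

-- The bilateral series V(q) + V(-q) - 1

module BilateralSeries where
  private
    c : Series
    c = q ⊠ q

    oc : Ord 1 c
    oc = Ord-⊠ˡ Ord-q

    β : ℕ → ℕ → Series
    β = bilateral q q

    r : ℕ → Series
    r = rfac c

  -- This is `q^(n²)`, by `square≈q⇡`. As a theta term it has literally the shape of the bilateral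
  -- terms for `x = y = q`.
  square : ℕ → Series
  square = thetaTerm q c

  sign : ℕ → Series
  sign k = (⊟ 𝟙) ⇡ k

  sign-involutive : ∀ k → sign k ⊠ sign k ≈ 𝟙
  sign-involutive zero    = *-identityˡ 𝟙
  sign-involutive (suc k) = ≈-trans
    (solve 2 (λ u s → (:- u) :* s :* ((:- u) :* s) := u :* u :* (s :* s)) ≈-refl 𝟙 (sign k))
    (≈-trans ((*-identityˡ 𝟙) ⟨⊠⟩ sign-involutive k) (*-identityˡ 𝟙))

  tri-double : ∀ n → n + (tri n + tri n) ≡ n * n
  tri-double zero    = refl
  tri-double (suc n) = cong suc (trans (shuffle n (tri n))
      (cong (λ j → n + j) (trans (cong (λ j → n + j) (tri-double n)) (sym (ℕ.*-suc n n)))))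
    where
    shuffle : ∀ n t → n + (n + t + (n + t)) ≡ n + (n + (n + (t + t)))
    shuffle = ℕ-solve 2 (λ n t → n ∔ (n ∔ t ∔ (n ∔ t)) ≜ n ∔ (n ∔ (n ∔ (t ∔ t)))) refl

  square≈q⇡ : ∀ n → square n ≈ q ⇡ (n * n)
  square≈q⇡ n = begin
    q ⇡ n ⊠ (q ⊠ q) ⇡ tri n                ≈⟨ ⊠-congˡ (⇡-distrib q q (tri n)) ⟩
    q ⇡ n ⊠ (q ⇡ tri n ⊠ q ⇡ tri n)        ≈⟨ ⊠-congˡ (⇡-+ q (tri n) (tri n)) ⟨
    q ⇡ n ⊠ q ⇡ (tri n + tri n)            ≈⟨ ⇡-+ q n (tri n + tri n) ⟨
    q ⇡ (n + (tri n + tri n))              ≈⟨ ⇡-congʳ q (tri-double n) ⟩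
    q ⇡ (n * n)                            ∎

  square-suc : ∀ n → square (suc n) ≈ square n ⊠ (q ⊠ c ⇡ n)
  square-suc = thetaTerm-suc q c

  square-+suc : ∀ n k → square (n + suc k) ≈ square (n + k) ⊠ (q ⊠ (c ⇡ n ⊠ c ⇡ k))
  square-+suc n k = ≈-trans (pointwise λ m → cong (λ j → square j m) (ℕ.+-suc n k))
    (≈-trans (square-suc (n + k)) (⊠-congˡ (⊠-congˡ (⇡-+ c n k))))

  square-Ord : ∀ n → Ord n (square n)
  square-Ord n = thetaTerm-Ord c n Ord-q

  oddPoch⁺ oddPoch⁻ : ℕ → Series
  oddPoch⁺ = partial (λ i → 𝟙 ⊞ q ⊠ c ⇡ i)
  oddPoch⁻ = partial (λ i → 𝟙 ⊞ ⊟ q ⊠ c ⇡ i)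

  private
    ↑≡⇡ : ∀ f k → f ↑ k ≡ f ⇡ k
    ↑≡⇡ f zero    = refl
    ↑≡⇡ f (suc k) = trans (cong (f ⊛_) (↑≡⇡ f k)) (sym (⊠≡⊛ f (f ⇡ k)))

    ⊛-≈ : ∀ {f f′ g g′} → f ≈ f′ → g ≈ g′ → f ⊛ g ≈ f′ ⊠ g′
    ⊛-≈ {f} {f′} {g} {g′} p s = ≈-trans (pointwise λ n → cong (λ h → h n) (sym (⊠≡⊛ f g))) (p ⟨⊠⟩ s)

    ↑-≈ : ∀ f k → f ↑ k ≈ f ⇡ k
    ↑-≈ f k = pointwise λ n → cong (λ h → h n) (↑≡⇡ f k)

    ⊖-≈ : ∀ f g → f ⊖ g ≈ f ⊞ ⊟ g
    ⊖-≈ f g = pointwise λ n → sym (trans (⊞-at f (⊟ g) n) (cong (λ z → f n ℤ.+ z) (⊟-at g n)))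

    poch-≈ : ∀ a s → a ≈ s → ∀ n → poch a (q ↑ 2) n ≈ partial (λ i → 𝟙 ⊞ ⊟ s ⊠ c ⇡ i) n
    poch-≈ a s p zero    = ≈-refl
    poch-≈ a s p (suc n) = ⊛-≈ (poch-≈ a s p n) (≈-trans (⊖-≈ 𝟙 _) (⊞-congˡ (≈-trans
      (⟨⊟⟩ ⊛-≈ p (≈-trans (↑-≈ (q ↑ 2) n) (⇡-congˡ n (≈-trans (↑-≈ q 2) (⊠-congˡ (*-identityʳ q))))))
      (solve 2 (λ s C → :- (s :* C) := (:- s) :* C) ≈-refl s (c ⇡ n)))))

    partial-cong : ∀ {a b : ℕ → Series} → (∀ i → a i ≈ b i) → ∀ n → partial a n ≈ partial b n
    partial-cong p zero    = ≈-refl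
    partial-cong p (suc n) = partial-cong p n ⟨⊠⟩ p n

    v₀-numerator : ∀ n → poch (⊝ q) (q ↑ 2) n ≈ oddPoch⁺ n
    v₀-numerator n = ≈-trans (poch-≈ (⊝ q) (⊟ q) (pointwise λ m → sym (⊟-at q m)) n)
      (partial-cong (λ i → ⊞-congˡ (⊠-congʳ (solve 1 (λ s → :- (:- s) := s) ≈-refl q))) n)

  v₀-term-≈ : ∀ n → v₀-term n ⊠ oddPoch⁻ n ≈ square n ⊠ oddPoch⁺ n
  v₀-term-≈ n = begin
    v₀-term n ⊠ oddPoch⁻ n
      ≈⟨ ⊛-≈ (⊛-≈ (≈-trans (↑-≈ q (n * n)) (≈-sym (square≈q⇡ n))) (v₀-numerator n)) ≈-refl ⟨⊠⟩ ≈-sym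
           (poch-≈ q q ≈-refl n) ⟩
    square n ⊠ oddPoch⁺ n ⊠ inverse p ⊠ p
      ≈⟨ solve 4 (λ a b i p → a :* b :* i :* p := a :* b :* (p :* i)) ≈-refl (square n) (oddPoch⁺ n)
           (inverse p) p ⟩
    square n ⊠ oddPoch⁺ n ⊠ (p ⊠ inverse p)
      ≈⟨ ≈-trans (⊠-congˡ (⊠-inverse (poch-q-constant (q ↑ 2) n))) (*-identityʳ _) ⟩
    square n ⊠ oddPoch⁺ n ∎
    where p = poch q (q ↑ 2) n

  -- (q ; q²)_∞ and (-q ; q²)_∞
  e₀ ē₀ : Series
  e₀ = Euler (⊟ q) c
  ē₀ = Euler q c

  -- Expansion of `V` times `(q ; q²)_∞ (-q ; q²)_∞`

  private
    o⊟q : Ord 1 (⊟ q)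
    o⊟q = Ord-⊟ Ord-q

    front : ℕ → ℕ → Series
    front n k = sign k ⊠ square (n + k) ⊠ r k

    weight : ℕ → ℕ → ℕ → Series
    weight n k l = front n k ⊠ (β n l ⊠ r l)

    front-Ord : ∀ n k → Ord (n + k) (front n k)
    front-Ord n k = Ord-⊠ˡ (Ord-⊠ʳ (square-Ord (n + k)))

    weight-Ord : ∀ n k l → Ord (n + k + (l ∸ n)) (weight n k l)
    weight-Ord n k l = Ord-⊠ (front-Ord n k) (Ord-⊠ˡ (bilateral-Ordʳ Ord-q n l))

    n+k+[l∸n]≥k+l : ∀ n k l → k + l ≤ n + k + (l ∸ n)
    n+k+[l∸n]≥k+l n k l = ℕ.≤-trans (ℕ.+-monoʳ-≤ k (ℕ.m≤n+m∸n l n))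
      (ℕ.≤-reflexive (trans (sym (ℕ.+-assoc k n (l ∸ n))) (cong (_+ (l ∸ n)) (ℕ.+-comm k n))))

    weight-Ord-kl : ∀ n k l → Ord (k + l) (weight n k l)
    weight-Ord-kl n k l = Ord-≤ (n+k+[l∸n]≥k+l n k l) (weight-Ord n k l)

    -- Completing the square: the exponents `n²`, `2nk` and `k²` add up to `(n + k)²`.
    front-≈ : ∀ n k → square n ⊠ eulerTerm (⊟ q ⊠ c ⇡ n) c k ≈ front n k
    front-≈ n k = ≈-trans (≈-sym (*-assoc _ _ _)) (⊠-congʳ (go k))
      where
      go : ∀ k → square n ⊠ thetaTerm (⊟ q ⊠ c ⇡ n) c k ≈ sign k ⊠ square (n + k)
      go zero    = ≈-trans (solve 2 (λ s x → s :* (x :^ 0 :* x :^ 0) := x :^ 0 :* s) ≈-refl (square n) q)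
                           (⊠-congˡ (pointwise λ m → cong (λ j → square j m) (sym (ℕ.+-identityʳ n))))
      go (suc k) = begin
        square n ⊠ thetaTerm (⊟ q ⊠ c ⇡ n) c (suc k)
          ≈⟨ ⊠-congˡ (thetaTerm-suc _ c k) ⟩
        square n ⊠ (thetaTerm (⊟ q ⊠ c ⇡ n) c k ⊠ (⊟ q ⊠ c ⇡ n ⊠ c ⇡ k))
          ≈⟨ solve 5 (λ s t q a b → s :* (t :* (:- q :* a :* b)) := (s :* t) :*
               (:- (q :^ 0) :* (q :* (a :* b)))) ≈-refl
               (square n) (thetaTerm (⊟ q ⊠ c ⇡ n) c k) q (c ⇡ n) (c ⇡ k) ⟩
        square n ⊠ thetaTerm (⊟ q ⊠ c ⇡ n) c k ⊠ (⊟ 𝟙 ⊠ (q ⊠ (c ⇡ n ⊠ c ⇡ k)))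
          ≈⟨ ⊠-congʳ (go k) ⟩
        sign k ⊠ square (n + k) ⊠ (⊟ 𝟙 ⊠ (q ⊠ (c ⇡ n ⊠ c ⇡ k)))
          ≈⟨ solve 4 (λ s t u v → s :* t :* (u :* v) := u :* s :* (t :* v)) ≈-refl (sign k) _ (⊟ 𝟙) _ ⟩
        ⊟ 𝟙 ⊠ sign k ⊠ (square (n + k) ⊠ (q ⊠ (c ⇡ n ⊠ c ⇡ k)))
          ≈⟨ ⊠-congˡ (square-+suc n k) ⟨
        sign (suc k) ⊠ square (n + suc k) ∎

    -- The first `n` factors of `(q ; q²)_∞` cancel the denominator and leave `(q^(2n+1) ; q²)_∞`,
    -- expanded in `k`. The numerator joins `(-q ; q²)_∞` to form `shiftedEuler n`, expanded in `l`.
    term-expansion : ∀ n → v₀-term n ⊠ (e₀ ⊠ ē₀) ≈ Sum 0 (λ k → Sum 0 (weight n k))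
    term-expansion n = begin
      v₀-term n ⊠ (e₀ ⊠ ē₀)
        ≈⟨ ⊠-congˡ (⊠-congʳ (≈-trans (Euler-cong oc (≈-sym (*-identityʳ _)) ≈-refl)
             (unroll (λ n → Euler (⊟ q ⊠ c ⇡ n) c) _ (Euler-unroll oc o⊟q) n))) ⟩
      v₀-term n ⊠ (oddPoch⁻ n ⊠ E ⊠ ē₀)
        ≈⟨ solve 4 (λ v p e f → v :* (p :* e :* f) := v :* p :* e :* f) ≈-refl (v₀-term n) (oddPoch⁻ n) E ē₀ ⟩
      v₀-term n ⊠ oddPoch⁻ n ⊠ E ⊠ ē₀
        ≈⟨ ⊠-congʳ (⊠-congʳ (v₀-term-≈ n)) ⟩
      square n ⊠ oddPoch⁺ n ⊠ E ⊠ ē₀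
        ≈⟨ solve 4 (λ s p e f → s :* p :* e :* f := s :* e :* (p :* f)) ≈-refl (square n) (oddPoch⁺ n) E ē₀ ⟩
      square n ⊠ E ⊠ (oddPoch⁺ n ⊠ ē₀)
        ≈⟨ ≈-trans (Sum-⊠ (square n) (eulerTerm-Ord c (Ord-⊠ˡ o⊟q))) (Sum-cong (front-≈ n))
             ⟨⊠⟩ ≈-sym (shiftedEuler-product Ord-q Ord-q n) ⟩
      Sum 0 (front n) ⊠ shiftedEuler Ord-q Ord-q n
        ≈⟨ ≈-trans (*-comm _ _) (Sum-⊠ _ (λ k → Ord-≤ (ℕ.m≤n+m k n) (front-Ord n k))) ⟩
      Sum 0 (λ k → shiftedEuler Ord-q Ord-q n ⊠ front n k)
        ≈⟨ Sum-cong (λ k → ≈-trans (*-comm _ _) (≈-trans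
             (Sum-⊠ (front n k) (λ l → Ord-⊠ˡ (bilateral-Ordʳ Ord-q n l)))
             (Sum-offset λ l → Ord-≤ (ℕ.m≤n+m l k) (weight-Ord-kl n k l)))) ⟩
      Sum 0 (λ k → Sum 0 (weight n k)) ∎
      where E = Euler (⊟ q ⊠ c ⇡ n) c

    core : ℕ → ℕ → Series
    core k l = sign k ⊠ (r k ⊠ r l)

  -- Σ_{n ≥ 0} q^{(n+k)² + (n-l)²}
  halfLattice : ℕ → ℕ → Series
  halfLattice k l = Sum 0 (λ n → square (n + k) ⊠ β n l)

  private
    Y : ℕ → ℕ → Series
    Y = halfLattice

    Y-summable : ∀ k l → Summable 0 (λ n → square (n + k) ⊠ β n l)
    Y-summable k l n = Ord-⊠ˡ (Ord-≤ (ℕ.m≤m+n n k) (square-Ord (n + k)))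

    Y-Ord : ∀ k l → Ord (k + l) (Y k l)
    Y-Ord k l = Ord-Sum λ n → Ord-≤ (n+k+[l∸n]≥k+l n k l)
        (Ord-⊠ (square-Ord (n + k)) (bilateral-Ordʳ Ord-q n l))

    v₀-summable : Summable 0 v₀-term
    v₀-summable n = ord (v₀-term-vanishes n)

    v₀-expansion : v₀ ⊠ (e₀ ⊠ ē₀) ≈ Sum 0 (λ N → diag N (λ k l → core k l ⊠ Y k l))
    v₀-expansion = begin
      v₀ ⊠ (e₀ ⊠ ē₀)
        ≈⟨ ≈-trans (⊠-congʳ (∑∞≈Sum v₀-term)) (≈-trans (*-comm _ _) (Sum-⊠ (e₀ ⊠ ē₀) v₀-summable)) ⟩
      Sum 0 (λ n → e₀ ⊠ ē₀ ⊠ v₀-term n)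
        ≈⟨ Sum-cong (λ n → ≈-trans (*-comm _ _) (≈-trans (term-expansion n) (Sum-diag (weight-Ord-kl n)))) ⟩
      Sum 0 (λ n → Sum 0 (λ N → diag N (weight n)))
        ≈⟨ Sum-swap (λ n N → diag N (weight n)) ⟩
      Sum 0 (λ N → Sum 0 (λ n → diag N (weight n)))
        ≈⟨ Sum-cong (λ N → ≈-trans (≈-sym (diag-Sum N (λ k l n → weight n k l)))
             (diag-cong N λ k l _ → factor k l)) ⟩
      Sum 0 (λ N → diag N (λ k l → core k l ⊠ Y k l)) ∎
      where
      factor : ∀ k l → Sum 0 (λ n → weight n k l) ≈ core k l ⊠ Y k l
      factor k l = ≈-trans (Sum-cong λ n → solve 5
          (λ s t a b u → s :* t :* a :* (b :* u) := s :* (a :* u) :* (t :* b)) ≈-refl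
          (sign k) (square (n + k)) (r k) (β n l) (r l))
        (≈-sym (Sum-⊠ (core k l) (Y-summable k l)))

    -- This is the expansion of the term `n = 0`, which equals 1. It is to be subtracted once, since
    -- both halves of the sum over all integers contain it.
    one-expansion : e₀ ⊠ ē₀ ≈ Sum 0 (λ N → diag N (λ k l → core k l ⊠ (square k ⊠ square l)))
    one-expansion = begin
      e₀ ⊠ ē₀
        ≈⟨ ≈-trans (⊠-congʳ one) (*-identityˡ _) ⟨
      v₀-term 0 ⊠ (e₀ ⊠ ē₀)
        ≈⟨ ≈-trans (term-expansion 0) (Sum-diag (weight-Ord-kl 0)) ⟩
      Sum 0 (λ N → diag N (weight 0))
        ≈⟨ Sum-cong (λ N → diag-cong N λ k l _ → solve 5
             (λ s t a b u → s :* t :* a :* (b :* u) := s :* (a :* u) :* (t :* b)) ≈-refl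
             (sign k) (square k) (r k) (square l) (r l)) ⟩
      Sum 0 (λ N → diag N (λ k l → core k l ⊠ (square k ⊠ square l))) ∎
      where
      one : v₀-term 0 ≈ 𝟙
      one = ≈-trans (≈-sym (*-identityʳ _)) (≈-trans (v₀-term-≈ 0)
          (solve 1 (λ x → x :^ 0 :* x :^ 0 :* x :^ 0 := x :^ 0) ≈-refl q))

    -- The substitution of `-q` for `q`

    q-flip : q [ ⊟ q ] ≈ ⊟ q
    q-flip = []-q (⊟ q) o⊟q

    c-flip : c [ ⊟ q ] ≈ c
    c-flip = ≈-trans ([]-⊠ q q o⊟q) (≈-trans (q-flip ⟨⊠⟩ q-flip)
        (solve 1 (λ x → (:- x) :* (:- x) := x :* x) ≈-refl q))

    e-flip : e₀ [ ⊟ q ] ≈ ē₀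
    e-flip = ≈-trans ([]-Euler o⊟q oc o⊟q) (Euler-cong ([]-Ord oc o⊟q)
      (≈-trans ([]-⊟ q o⊟q) (≈-trans (⟨⊟⟩ q-flip) (solve 1 (λ x → :- (:- x) := x) ≈-refl q))) c-flip)

    ē-flip : ē₀ [ ⊟ q ] ≈ e₀
    ē-flip = ≈-trans ([]-Euler Ord-q oc o⊟q) (Euler-cong ([]-Ord oc o⊟q) q-flip c-flip)

    sign-flip : ∀ k → sign k [ ⊟ q ] ≈ sign k
    sign-flip k = ≈-trans ([]-⇡ (⊟ 𝟙) k o⊟q) (⇡-congˡ k (≈-trans ([]-⊟ 𝟙 o⊟q) (⟨⊟⟩ []-𝟙 _ o⊟q)))

    r-flip : ∀ k → r k [ ⊟ q ] ≈ r k
    r-flip k = ≈-trans ([]-rfac oc o⊟q k) (rfac-cong ([]-Ord oc o⊟q) c-flip k)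

    square-flip : ∀ n → square n [ ⊟ q ] ≈ sign n ⊠ square n
    square-flip n = ≈-trans ([]-thetaTerm q c n o⊟q) (≈-trans
      ((≈-trans (⇡-congˡ n (≈-trans q-flip (solve 1 (λ x → :- x := :- (x :^ 0) :* x) ≈-refl q)))
          (⇡-distrib (⊟ 𝟙) q n)) ⟨⊠⟩ ⇡-congˡ (tri n) c-flip)
      (*-assoc _ _ _))

    β-flip : ∀ n l → β n l [ ⊟ q ] ≈ sign n ⊠ sign l ⊠ β n l
    β-flip zero    l       = ≈-trans (square-flip l) (⊠-congʳ (≈-sym (*-identityˡ _)))
    β-flip (suc n) zero    = ≈-trans (square-flip (suc n)) (⊠-congʳ (≈-sym (*-identityʳ _)))
    β-flip (suc n) (suc l) = ≈-trans (β-flip n l) (⊠-congʳ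
      (solve 3 (λ x s t → s :* t := (:- (x :^ 0) :* s) :* (:- (x :^ 0) :* t)) ≈-refl q (sign n) (sign l)))

    -- The exponent `(n + k)² + (n - l)²` has the parity of `k + l`, whatever `n` is.
    Y-flip : ∀ k l → Y k l [ ⊟ q ] ≈ sign k ⊠ sign l ⊠ Y k l
    Y-flip k l = ≈-trans ([]-Sum (⊟ q) (Y-summable k l))
        (≈-trans (Sum-cong term) (≈-sym (Sum-⊠ _ (Y-summable k l))))
      where
      term : ∀ n → (square (n + k) ⊠ β n l) [ ⊟ q ] ≈ sign k ⊠ sign l ⊠ (square (n + k) ⊠ β n l)
      term n = begin
        (square (n + k) ⊠ β n l) [ ⊟ q ]
          ≈⟨ ≈-trans ([]-⊠ (square (n + k)) (β n l) o⊟q)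
               (≈-trans (square-flip (n + k)) (⊠-congʳ (⇡-+ (⊟ 𝟙) n k)) ⟨⊠⟩ β-flip n l) ⟩
        sign n ⊠ sign k ⊠ square (n + k) ⊠ (sign n ⊠ sign l ⊠ β n l)
          ≈⟨ solve 5 (λ s t x u b → s :* t :* x :* (s :* u :* b) := (s :* s) :* (t :* u :* (x :* b))) ≈-refl
               (sign n) (sign k) (square (n + k)) (sign l) (β n l) ⟩
        sign n ⊠ sign n ⊠ (sign k ⊠ sign l ⊠ (square (n + k) ⊠ β n l))
          ≈⟨ ≈-trans (⊠-congʳ (sign-involutive n)) (*-identityˡ _) ⟩
        sign k ⊠ sign l ⊠ (square (n + k) ⊠ β n l) ∎

    []-diag : ∀ N F s → diag N F [ s ] ≈ diag N (λ k l → F k l [ s ])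
    []-diag zero    F s = ≈-refl
    []-diag (suc N) F s = ≈-trans ([]-⊞ (F 0 (suc N)) _ s) (⊞-congˡ ([]-diag N (λ k → F (suc k)) s))

    -- The sign `(-1)^(k+l)` turns `(-1)ᵏ` into `(-1)ˡ`, and exchanging `k` with `l` restores
    -- `core k l`. The half sum becomes `Y l k`, which is the part `n ≤ 0` of the sum that `Y k l`
    -- begins.
    flipped-expansion : v₀ [ ⊟ q ] ⊠ (e₀ ⊠ ē₀) ≈ Sum 0 (λ N → diag N (λ k l → core k l ⊠ Y l k))
    flipped-expansion = begin
      v₀ [ ⊟ q ] ⊠ (e₀ ⊠ ē₀)
        ≈⟨ ⊠-congˡ (≈-trans ([]-⊠ e₀ ē₀ o⊟q) (≈-trans (e-flip ⟨⊠⟩ ē-flip) (*-comm _ _))) ⟨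
      v₀ [ ⊟ q ] ⊠ (e₀ ⊠ ē₀) [ ⊟ q ]
        ≈⟨ []-⊠ v₀ (e₀ ⊠ ē₀) o⊟q ⟨
      (v₀ ⊠ (e₀ ⊠ ē₀)) [ ⊟ q ]
        ≈⟨ []-congʳ v₀-expansion ⟩
      Sum 0 (λ N → diag N (λ k l → core k l ⊠ Y k l)) [ ⊟ q ]
        ≈⟨ []-Sum (⊟ q) (λ N → Ord-diag N λ { k l refl → Ord-⊠ʳ (Y-Ord k l) }) ⟩
      Sum 0 (λ N → diag N (λ k l → core k l ⊠ Y k l) [ ⊟ q ])
        ≈⟨ Sum-cong (λ N → ≈-trans ([]-diag N _ (⊟ q))
             (≈-trans (diag-cong N λ k l _ → term k l) (diag-flip N _))) ⟩
      Sum 0 (λ N → diag N (λ k l → core k l ⊠ Y l k)) ∎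
      where
      term : ∀ k l → (core k l ⊠ Y k l) [ ⊟ q ] ≈ core l k ⊠ Y k l
      term k l = begin
        (core k l ⊠ Y k l) [ ⊟ q ]
          ≈⟨ ≈-trans ([]-⊠ (core k l) (Y k l) o⊟q) (≈-trans ([]-⊠ (sign k) _ o⊟q)
               (sign-flip k ⟨⊠⟩ ≈-trans ([]-⊠ (r k) (r l) o⊟q) (r-flip k ⟨⊠⟩ r-flip l)) ⟨⊠⟩ Y-flip k l) ⟩
        sign k ⊠ (r k ⊠ r l) ⊠ (sign k ⊠ sign l ⊠ Y k l)
          ≈⟨ solve 5 (λ s a b t y → s :* (a :* b) :* (s :* t :* y) := (s :* s) :* (t :* (b :* a) :* y)) ≈-refl
               (sign k) (r k) (r l) (sign l) (Y k l) ⟩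
        sign k ⊠ sign k ⊠ (core l k ⊠ Y k l)
          ≈⟨ ≈-trans (⊠-congʳ (sign-involutive k)) (*-identityˡ _) ⟩
        core l k ⊠ Y k l ∎

  -- Σ_{n ∈ ℤ} q^{(n+k)² + (n-l)²}
  lattice : ℕ → ℕ → Series
  lattice k l = halfLattice k l ⊞ halfLattice l k ⊞ ⊟ (square k ⊠ square l)

  halfLattice-suc : ∀ k l → halfLattice k (suc l) ≈ square k ⊠ square (suc l) ⊞ halfLattice (suc k) l
  halfLattice-suc k l = ≈-trans (Sum-uncons (Y-summable k (suc l))) (⊞-congˡ (Sum-cong λ n →
    ⊠-congʳ (pointwise λ m → cong (λ j → square j m) (sym (ℕ.+-suc n k)))))

  -- Over all integers this is the substitution of `n + 1` for `n`; on half sums, one boundary term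
  -- changes sides.
  lattice-shift : ∀ k l → lattice (suc k) l ≈ lattice k (suc l)
  lattice-shift k l = begin
    Y (suc k) l ⊞ Y l (suc k) ⊞ ⊟ (square (suc k) ⊠ square l)
      ≈⟨ ⊞-congʳ (⊞-congˡ (halfLattice-suc l k)) ⟩
    Y (suc k) l ⊞ (square l ⊠ square (suc k) ⊞ Y (suc l) k) ⊞ ⊟ (square (suc k) ⊠ square l)
      ≈⟨ solve 6 (λ a b s t u v → a :+ (s :* t :+ b) :- t :* s := u :* v :+ a :+ b :- u :* v) ≈-refl
           (Y (suc k) l) (Y (suc l) k) (square l) (square (suc k)) (square k) (square (suc l)) ⟩
    square k ⊠ square (suc l) ⊞ Y (suc k) l ⊞ Y (suc l) k ⊞ ⊟ (square k ⊠ square (suc l))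
      ≈⟨ ⊞-congʳ (⊞-congʳ (halfLattice-suc k l)) ⟨
    Y k (suc l) ⊞ Y (suc l) k ⊞ ⊟ (square k ⊠ square (suc l)) ∎

  lattice-antidiagonal : ∀ k l → lattice 0 (k + l) ≈ lattice k l
  lattice-antidiagonal zero    l = ≈-refl
  lattice-antidiagonal (suc k) l = ≈-trans (pointwise λ m → cong (λ j → lattice 0 j m) (sym (ℕ.+-suc k l)))
    (≈-trans (lattice-antidiagonal k (suc l)) (≈-sym (lattice-shift k l)))

  private
    φ₂ : Series
    φ₂ = Sum 0 (λ n → square n ⊠ square n)

    -- The parallelogram law `(n + m)² + (n - m)² = 2n² + 2m²`, by induction on `n`.
    Y-diagonal : ∀ m → Y m m ≈ square m ⊠ square m ⊠ φ₂
    Y-diagonal m = ≈-trans (Sum-cong term) (≈-sym (Sum-⊠ _ λ n → Ord-⊠ˡ (square-Ord n)))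
      where
      term : ∀ n → square (n + m) ⊠ β n m ≈ square m ⊠ square m ⊠ (square n ⊠ square n)
      term zero    = solve 2 (λ x s → s :* s := s :* s :*
          (x :^ 0 :* x :^ 0 :* (x :^ 0 :* x :^ 0))) ≈-refl q (square m)
      term (suc n) = begin
        square (suc (n + m)) ⊠ β (suc n) m
          ≈⟨ ⊠-congʳ (≈-trans (square-suc (n + m)) (⊠-congˡ (⊠-congˡ (⇡-+ c n m)))) ⟩
        square (n + m) ⊠ (q ⊠ (c ⇡ n ⊠ c ⇡ m)) ⊠ β (suc n) m
          ≈⟨ solve 5 (λ s q C D b → s :* (q :* (C :* D)) :* b := s :* (q :* C) :* (b :* D)) ≈-refl
               (square (n + m)) q (c ⇡ n) (c ⇡ m) (β (suc n) m) ⟩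
        square (n + m) ⊠ (q ⊠ c ⇡ n) ⊠ (β (suc n) m ⊠ c ⇡ m)
          ≈⟨ ⊠-congˡ (bilateral-shift q q n m) ⟩
        square (n + m) ⊠ (q ⊠ c ⇡ n) ⊠ (β n m ⊠ (q ⊠ c ⇡ n))
          ≈⟨ solve 3 (λ s b u → s :* u :* (b :* u) := s :* b :* (u :* u)) ≈-refl (square (n + m))
               (β n m) (q ⊠ c ⇡ n) ⟩
        square (n + m) ⊠ β n m ⊠ (q ⊠ c ⇡ n ⊠ (q ⊠ c ⇡ n))
          ≈⟨ ⊠-congʳ (term n) ⟩
        square m ⊠ square m ⊠ (square n ⊠ square n) ⊠ (q ⊠ c ⇡ n ⊠ (q ⊠ c ⇡ n))
          ≈⟨ solve 3 (λ a s u → a :* (s :* s) :* (u :* u) := a :* (s :* u :* (s :* u))) ≈-refl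
               (square m ⊠ square m) (square n) (q ⊠ c ⇡ n) ⟩
        square m ⊠ square m ⊠ (square n ⊠ (q ⊠ c ⇡ n) ⊠ (square n ⊠ (q ⊠ c ⇡ n)))
          ≈⟨ ⊠-congˡ (square-suc n ⟨⊠⟩ square-suc n) ⟨
        square m ⊠ square m ⊠ (square (suc n) ⊠ square (suc n)) ∎

    square² : ∀ n → square n ⊠ square n ≈ thetaTerm c (c ⊠ c) n
    square² n = ≈-trans (solve 2 (λ a b → a :* b :* (a :* b) := a :* a :* (b :* b)) ≈-refl (q ⇡ n)
        (c ⇡ tri n))
      (≈-sym (⇡-distrib q q n) ⟨⊠⟩ ≈-sym (⇡-distrib c c (tri n)))

  Θ-diagonal : ∀ {s} → Ord 1 s → Θ s s ≈ Sum 0 (thetaTerm s (s ⊠ s)) ⊞ Sum 0 (thetaTerm s (s ⊠ s)) ⊞ ⊟ 𝟙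
  Θ-diagonal {s} o = ≈-sym (≈-trans (⊞-congʳ (⊞-congˡ (Sum-uncons λ n → thetaTerm-Ord (s ⊠ s) n o)))
    (solve 3 (λ x a b → a :+ (x :^ 0 :* x :^ 0 :+ b) :- x :^ 0 := a :+ b) ≈-refl s _ _))

  private
    lattice-diagonal : ∀ m → lattice m m ≈ Θ c c ⊠ (square m ⊠ square m)
    lattice-diagonal m = begin
      Y m m ⊞ Y m m ⊞ ⊟ (square m ⊠ square m)
        ≈⟨ ⊞-congʳ (Y-diagonal m ⟨⊞⟩ Y-diagonal m) ⟩
      square m ⊠ square m ⊠ φ₂ ⊞ square m ⊠ square m ⊠ φ₂ ⊞ ⊟ (square m ⊠ square m)
        ≈⟨ solve 2 (λ s p → s :* p :+ s :* p :- s := (p :+ p :- s :^ 0) :* s) ≈-refl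
             (square m ⊠ square m) φ₂ ⟩
      (φ₂ ⊞ φ₂ ⊞ ⊟ 𝟙) ⊠ (square m ⊠ square m)
        ≈⟨ ⊠-congʳ (≈-trans (⊞-congʳ (Sum-cong square² ⟨⊞⟩ Sum-cong square²)) (≈-sym (Θ-diagonal oc))) ⟩
      Θ c c ⊠ (square m ⊠ square m) ∎

    -- Gauss: Σ_{k+l=N} (-1)ᵏ / ((c)ₖ (c)ₗ)
    gauss : ℕ → Series
    gauss N = diag N core

    u : ℕ → Series
    u k = 𝟙 ⊞ ⊟ c ⇡ k

    -- Split `1 - c^(k+l)` as `(1 - cᵏ) + cᵏ (1 - cˡ)`. Each bracket cancels a factor of a
    -- q-factorial; after reindexing, the two parts have opposite signs and combine to a new factor
    -- `1 - cᵏ`, which cancels once more.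
    gauss-step : ∀ N → u (2 + N) ⊠ gauss (2 + N) ≈ gauss N
    gauss-step N = begin
      u (2 + N) ⊠ gauss (2 + N)
        ≈⟨ diag-⊠ (2 + N) (u (2 + N)) core ⟩
      diag (2 + N) (λ k l → u (2 + N) ⊠ core k l)
        ≈⟨ diag-cong (2 + N) (λ k l p → ≈-trans (⊠-congʳ
             (≈-trans (pointwise λ m → cong (λ j → u j m) (sym p)) (⊞-congˡ (⟨⊟⟩ ⇡-+ c k l))))
             (solve 6 (λ x s a b C D → (x :^ 0 :- C :* D) :* (s :* (a :* b)) :=
                s :* (a :* (x :^ 0 :- C) :* b) :+ s :* (C :* a :* (b :* (x :^ 0 :- D)))) ≈-refl q
                    (sign k) (r k) (r l) (c ⇡ k) (c ⇡ l))) ⟩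
      diag (2 + N) (λ k l → F₁ k l ⊞ F₂ k l)
        ≈⟨ diag-⊞ (2 + N) F₁ F₂ ⟩
      diag (2 + N) F₁ ⊞ diag (2 + N) F₂
        ≈⟨ ⊞-congˡ (diag-last (suc N) F₂) ⟩
      F₁ 0 (2 + N) ⊞ diag (suc N) (λ k l → F₁ (suc k) l) ⊞
          (diag (suc N) (λ k l → F₂ k (suc l)) ⊞ F₂ (2 + N) 0)
        -- The two end terms carry the factor `1 - c⁰ = 0`.
        ≈⟨ solve 7 (λ x D E s t b a → x :^ 0 :* (s :* (x :^ 0 :- x :^ 0) :* b) :+ D :+
             (E :+ t :* (a :* (s :* (x :^ 0 :- x :^ 0)))) := D :+ E) ≈-refl
             q _ _ (r 0) (sign (2 + N)) (r (2 + N)) (c ⇡ (2 + N) ⊠ r (2 + N)) ⟩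
      diag (suc N) (λ k l → F₁ (suc k) l) ⊞ diag (suc N) (λ k l → F₂ k (suc l))
        ≈⟨ diag-⊞ (suc N) (λ k → F₁ (suc k)) (λ k l → F₂ k (suc l)) ⟨
      diag (suc N) (λ k l → F₁ (suc k) l ⊞ F₂ k (suc l))
        ≈⟨ diag-cong (suc N) (λ k l _ → ≈-trans
             ((⊠-congˡ (⊠-congʳ (≈-sym (rfac-step oc k)))) ⟨⊞⟩ ⊠-congˡ (⊠-congˡ (≈-sym (rfac-step oc l))))
             (solve 5 (λ x s a b C → :- (x :^ 0) :* s :* (a :* b) :+ s :* (C :* a :* b) := :-
                 (s :* (a :* (x :^ 0 :- C) :* b))) ≈-refl
                q (sign k) (r k) (r l) (c ⇡ k))) ⟩
      ⊟ F₁ 0 (suc N) ⊞ diag N (λ k l → ⊟ F₁ (suc k) l)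
        ≈⟨ solve 4 (λ x s b D → :- (x :^ 0 :* (s :* (x :^ 0 :- x :^ 0) :* b)) :+ D := D) ≈-refl q
             (r 0) (r (suc N)) _ ⟩
      diag N (λ k l → ⊟ F₁ (suc k) l)
        ≈⟨ diag-cong N (λ k l _ → ≈-trans (⟨⊟⟩ ⊠-congˡ (⊠-congʳ (≈-sym (rfac-step oc k))))
             (solve 3 (λ x s a → :- (:- (x :^ 0) :* s :* a) := s :* a) ≈-refl q (sign k) (r k ⊠ r l))) ⟩
      gauss N ∎
      where
      F₁ F₂ : ℕ → ℕ → Series
      F₁ k l = sign k ⊠ (r k ⊠ u k ⊠ r l)
      F₂ k l = sign k ⊠ (c ⇡ k ⊠ r k ⊠ (r l ⊠ u l))

    u-unit : ∀ k → u (suc k) 0 ≡ 1ℤ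
    u-unit k = 1-unit (Ord-⇡suc k oc)

    gauss-even : ∀ m → gauss (m * 2) ≈ rfac (c ⇡ 2) m
    gauss-even zero    = ≈-trans (⊠-congˡ (rfac-zero c ⟨⊠⟩ rfac-zero c))
      (≈-trans (solve 1 (λ x → x :^ 0 :* (x :^ 0 :* x :^ 0) := x :^ 0) ≈-refl q) (≈-sym (rfac-zero (c ⇡ 2))))
    gauss-even (suc m) = ⊠-cancel (u (2 + m * 2)) (u-unit (suc (m * 2))) (begin
      u (2 + m * 2) ⊠ gauss (2 + m * 2)                                 ≈⟨ gauss-step (m * 2) ⟩
      gauss (m * 2)                                                     ≈⟨ gauss-even m ⟩
      rfac (c ⇡ 2) m                                                    ≈⟨ rfac-step (Ord-⇡suc 1 oc) m ⟩
      rfac (c ⇡ 2) (suc m) ⊠ (𝟙 ⊞ ⊟ (c ⇡ 2) ⇡ suc m)                    ≈⟨ ⊠-congˡ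
          (⊞-congˡ (⟨⊟⟩ ≈-trans (⇡-* c 2 (suc m)) (⇡-congʳ c (ℕ.*-comm 2 (suc m))))) ⟩
      rfac (c ⇡ 2) (suc m) ⊠ u (2 + m * 2)                              ≈⟨ *-comm _ _ ⟩
      u (2 + m * 2) ⊠ rfac (c ⇡ 2) (suc m)                              ∎)

    gauss-odd : ∀ m → gauss (m * 2 + 1) ≈ ι 0ℤ
    gauss-odd zero    = solve 3 (λ x a b → x :^ 0 :* (a :* b) :+ :- (x :^ 0) :* x :^ 0 :* (b :* a)
        := con 0ℤ) ≈-refl q (r 0) (r 1)
    gauss-odd (suc m) = ⊠-cancel (u (2 + (m * 2 + 1))) (u-unit (suc (m * 2 + 1)))
      (≈-trans (gauss-step (m * 2 + 1)) (≈-trans (gauss-odd m) (≈-sym (zeroʳ _))))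

  -- On odd antidiagonals the Gauss sum is 0. The antidiagonal `2m` contributes
  -- `φ(q²) q^(2m²) / (q⁴ ; q⁴)ₘ`, and Euler's expansion sums these to `φ(q²) (-q² ; q⁴)_∞`.
  bilateral-V : (v₀ ⊞ v₀ [ ⊟ q ] ⊞ ⊟ 𝟙) ⊠ (e₀ ⊠ ē₀) ≈ Θ c c ⊠ Euler c (c ⇡ 2)
  bilateral-V = begin
    (v₀ ⊞ v₀ [ ⊟ q ] ⊞ ⊟ 𝟙) ⊠ (e₀ ⊠ ē₀)
      ≈⟨ solve 3 (λ a b z → (a :+ b :- z :^ 0) :* z := a :* z :+ b :* z :+ con
           (ℤ.- 1ℤ) :* z) ≈-refl v₀ (v₀ [ ⊟ q ]) (e₀ ⊠ ē₀) ⟩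
    v₀ ⊠ (e₀ ⊠ ē₀) ⊞ v₀ [ ⊟ q ] ⊠ (e₀ ⊠ ē₀) ⊞ ι (ℤ.- 1ℤ) ⊠ (e₀ ⊠ ē₀)
      ≈⟨ (v₀-expansion ⟨⊞⟩ flipped-expansion) ⟨⊞⟩
           (≈-trans (⊠-congˡ one-expansion) (Sum-⊠ (ι (ℤ.- 1ℤ)) λ N → Ord-diag N λ { k l refl →
           Ord-⊠ʳ (Ord-⊠ (square-Ord k) (square-Ord l)) })) ⟩
    Sum 0 (λ N → diag N (G₁)) ⊞ Sum 0 (λ N → diag N G₂) ⊞ Sum 0 (λ N → ι (ℤ.- 1ℤ) ⊠ diag N G₃)
      ≈⟨ ≈-trans (Sum-⊞ _ _) (⊞-congʳ (Sum-⊞ _ _)) ⟨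
    Sum 0 (λ N → diag N G₁ ⊞ diag N G₂ ⊞ ι (ℤ.- 1ℤ) ⊠ diag N G₃)
      ≈⟨ Sum-cong (λ N → ≈-trans (≈-sym (diag-⊞ N G₁ G₂) ⟨⊞⟩ diag-⊠ N _ G₃)
           (≈-trans (≈-sym (diag-⊞ N _ _)) (≈-trans
           (diag-cong N λ k l _ → solve 4 (λ w a b s → w :* a :+ w :* b :+ con (ℤ.- 1ℤ) :* (w :* s)
               := w :* (a :+ b :- s)) ≈-refl
             (core k l) (Y k l) (Y l k) (square k ⊠ square l))
           (diag-factor N core lattice lattice-shift)))) ⟩
    Sum 0 (λ N → gauss N ⊠ lattice 0 N)
      ≈⟨ Sum-residues 1 (λ N → Ord-⊠ʳ (lattice-Ord N)) ⟩
    Sum 0 (λ m → gauss (m * 2 + 0) ⊠ lattice 0 (m * 2 + 0)) ⊞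
        (Sum 0 (λ m → gauss (m * 2 + 1) ⊠ lattice 0 (m * 2 + 1)) ⊞ ι 0ℤ)
      -- The sum of the vanishing odd terms is presented as 0 times an arbitrarily chosen summable
      -- family, so that `Sum-⊠` extracts the factor 0.
      ≈⟨ Sum-cong even ⟨⊞⟩ ⊞-congʳ (≈-trans (Sum-cong odd)
           (≈-sym (Sum-⊠ (ι 0ℤ) λ m → Ord-≈ (≈-sym (*-identityʳ _)) (square-Ord m)))) ⟩
    Sum 0 (λ m → Θ c c ⊠ eulerTerm c (c ⇡ 2) m) ⊞ (ι 0ℤ ⊠ Sum 0 (λ m → square m ⊠ 𝟙) ⊞ ι 0ℤ)
      ≈⟨ ≈-sym (Sum-⊠ (Θ c c) (eulerTerm-Ord (c ⇡ 2) oc)) ⟨⊞⟩ ≈-refl ⟩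
    Θ c c ⊠ Euler c (c ⇡ 2) ⊞ (ι 0ℤ ⊠ Sum 0 (λ m → square m ⊠ 𝟙) ⊞ ι 0ℤ)
      ≈⟨ solve 2 (λ a b → a :+ (con 0ℤ :* b :+ con 0ℤ) := a) ≈-refl _ _ ⟩
    Θ c c ⊠ Euler c (c ⇡ 2) ∎
    where
    G₁ G₂ G₃ : ℕ → ℕ → Series
    G₁ k l = core k l ⊠ Y k l
    G₂ k l = core k l ⊠ Y l k
    G₃ k l = core k l ⊠ (square k ⊠ square l)

    lattice-Ord : ∀ N → Ord N (lattice 0 N)
    lattice-Ord N = Ord-⊞ (Ord-⊞ (Y-Ord 0 N) (Ord-≤ (ℕ.m≤m+n N 0) (Y-Ord N 0)))
        (Ord-⊟ (Ord-⊠ʳ (square-Ord N)))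

    even : ∀ m → gauss (m * 2 + 0) ⊠ lattice 0 (m * 2 + 0) ≈ Θ c c ⊠ eulerTerm c (c ⇡ 2) m
    even m = begin
      gauss (m * 2 + 0) ⊠ lattice 0 (m * 2 + 0)
        ≈⟨ pointwise (λ i → cong (λ j → (gauss j ⊠ lattice 0 j) i) (ℕ.+-identityʳ (m * 2))) ⟩
      gauss (m * 2) ⊠ lattice 0 (m * 2)
        ≈⟨ gauss-even m ⟨⊠⟩ ≈-trans (pointwise λ i → cong (λ j → lattice 0 j i)
             (trans (ℕ.*-comm m 2) (cong (λ j → m + j) (ℕ.+-identityʳ m))))
             (≈-trans (lattice-antidiagonal m m) (lattice-diagonal m)) ⟩
      rfac (c ⇡ 2) m ⊠ (Θ c c ⊠ (square m ⊠ square m))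
        ≈⟨ solve 3 (λ r t s → r :* (t :* s) := t :* (s :* r)) ≈-refl (rfac (c ⇡ 2) m) (Θ c c) _ ⟩
      Θ c c ⊠ (square m ⊠ square m ⊠ rfac (c ⇡ 2) m)
        ≈⟨ ⊠-congˡ (⊠-congʳ (≈-trans (square² m) (thetaTerm-cong ≈-refl
             (⊠-congˡ (≈-sym (*-identityʳ c))) m))) ⟩
      Θ c c ⊠ eulerTerm c (c ⇡ 2) m ∎

    odd : ∀ m → gauss (m * 2 + 1) ⊠ lattice 0 (m * 2 + 1) ≈ ι 0ℤ ⊠ (square m ⊠ 𝟙)
    odd m = ≈-trans (⊠-congʳ (gauss-odd m)) (≈-trans (zeroˡ _) (≈-sym (zeroˡ _)))

open BilateralSeries

-- Theta functions and their products

-- In Ramanujan's notation `f(s, s)`, `f(s, s³)`, `f(s, s²)` and `f(-s, -s⁵)`. The last two, taken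
-- at `s³`, occur in the 3-dissections of `ψ(s)` and `φ(-s)` beside `ψ(s⁹)` and `φ(-s⁹)`.
φ ψ α κ : Series → Series
φ s = Θ s s
ψ s = Θ (s ⇡ 3) s
α s = Θ (s ⇡ 2) s
κ s = Θ (⊟ s ⇡ 5) (⊟ s)

-- (s ; s²)_∞ , (-s ; s²)_∞ , (s ; s)_∞ , (-s ; s)_∞
e ē J ρ : Series → Series
e s = Euler (⊟ s) (s ⊠ s)
ē s = Euler s (s ⊠ s)
J s = Euler (⊟ s) s
ρ s = Euler s s

module _ {s : Series} (o : Ord 1 s) where
  private
    o₂ : Ord 1 (s ⊠ s)
    o₂ = Ord-⊠ˡ o

  e-unit : e s 0 ≡ 1ℤ
  e-unit = Euler-unit (Ord-⊟ o)

  J-split : J s ≈ e s ⊠ J (s ⊠ s)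
  J-split = ≈-trans (Euler-split₂ o (Ord-⊟ o))
    (Euler-cong (Ord-⇡suc 1 o) ≈-refl s² ⟨⊠⟩ Euler-cong (Ord-⇡suc 1 o)
        (solve 1 (λ s → (:- s) :* s := :- (s :* s)) ≈-refl s) s²)
    where s² = ⊠-congˡ (*-identityʳ s)

  e-conjugate : e s ⊠ ē s ≈ e (s ⊠ s)
  e-conjugate = ≈-trans (*-comm _ _) (≈-trans (Euler-conjugate o₂ o)
    (Euler-cong (Ord-⇡suc 1 o₂) (⟨⊟⟩ ⊠-congˡ (*-identityʳ s)) (⊠-congˡ (*-identityʳ _))))

  -- Euler's theorem on distinct and odd parts. Both `ρ J` and `J / e` are `(s² ; s²)_∞`.
  ρ-e : ρ s ⊠ e s ≈ 𝟙
  ρ-e = ⊠-cancel (J (s ⊠ s)) (Euler-unit (Ord-⊟ o₂)) (begin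
    J (s ⊠ s) ⊠ (ρ s ⊠ e s)      ≈⟨ solve 3 (λ j r e → j :* (r :* e) := r :* (e :* j)) ≈-refl
        (J (s ⊠ s)) (ρ s) (e s) ⟩
    ρ s ⊠ (e s ⊠ J (s ⊠ s))      ≈⟨ ⊠-congˡ J-split ⟨
    ρ s ⊠ J s                    ≈⟨ Euler-conjugate o o ⟩
    Euler (⊟ s ⇡ 2) (s ⇡ 2)      ≈⟨ Euler-cong (Ord-⇡suc 1 o) (⟨⊟⟩ ⊠-congˡ (*-identityʳ s))
        (⊠-congˡ (*-identityʳ s)) ⟩
    J (s ⊠ s)                    ≈⟨ *-identityʳ _ ⟨
    J (s ⊠ s) ⊠ 𝟙                ∎)

  φ-product : φ s ≈ ē s ⊠ ē s ⊠ J (s ⊠ s)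
  φ-product = ≈-sym (triple-product o o)

  φ-neg-product : φ (⊟ s) ≈ e s ⊠ e s ⊠ J (s ⊠ s)
  φ-neg-product = ≈-trans (≈-sym (triple-product (Ord-⊟ o) (Ord-⊟ o)))
    ((Euler-cong o₂′ ≈-refl s² ⟨⊠⟩ Euler-cong o₂′ ≈-refl s²) ⟨⊠⟩ Euler-cong o₂′ (⟨⊟⟩ s²) s²)
    where
    o₂′ = Ord-⊠ˡ (Ord-⊟ o)
    s² = solve 1 (λ s → (:- s) :* (:- s) := s :* s) ≈-refl s

  ψ-product : ψ s ≈ ē s ⊠ J (s ⊠ s ⊠ (s ⊠ s))
  ψ-product = ≈-sym (begin
    ē s ⊠ J s₄
      ≈⟨ ⊠-congʳ (Euler-split₂ o₂ o) ⟩
    Euler s ((s ⊠ s) ⇡ 2) ⊠ Euler (s ⊠ (s ⊠ s)) ((s ⊠ s) ⇡ 2) ⊠ J s₄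
      ≈⟨ ((Euler-cong oc ≈-refl c) ⟨⊠⟩ Euler-cong oc (solve 1 (λ s → s :* (s :* s) := s :^ 3) ≈-refl s) c) ⟨⊠⟩
           Euler-cong (Ord-⊠ˡ o₂) (⟨⊟⟩ c₄) c₄ ⟩
    Euler s (s ⇡ 3 ⊠ s) ⊠ Euler (s ⇡ 3) (s ⇡ 3 ⊠ s) ⊠ J (s ⇡ 3 ⊠ s)
      ≈⟨ ⊠-congʳ (*-comm _ _) ⟩
    Euler (s ⇡ 3) (s ⇡ 3 ⊠ s) ⊠ Euler s (s ⇡ 3 ⊠ s) ⊠ J (s ⇡ 3 ⊠ s)
      ≈⟨ triple-product (Ord-⇡suc 2 o) o ⟩
    ψ s ∎)
    where
    s₄ = s ⊠ s ⊠ (s ⊠ s)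
    oc = Ord-⇡suc 1 o₂
    c₄ : s₄ ≈ s ⇡ 3 ⊠ s
    c₄ = solve 1 (λ s → s :* s :* (s :* s) := s :^ 3 :* s) ≈-refl s
    c : (s ⊠ s) ⇡ 2 ≈ s ⇡ 3 ⊠ s
    c = ≈-trans (⊠-congˡ (*-identityʳ _)) c₄

  -- The triple product for `α` contains the factors `1 + sⁱ` with `i` congruent to 1 or 2 modulo 3;
  -- `ρ(s³)` supplies the multiples of 3.
  α-product : α s ⊠ ρ (s ⇡ 3) ≈ ρ s ⊠ J (s ⇡ 3)
  α-product = begin
    α s ⊠ ρ s₃
      ≈⟨ ⊠-congʳ (triple-product (Ord-⇡suc 1 o) o) ⟨
    Euler (s ⇡ 2) (s ⇡ 2 ⊠ s) ⊠ Euler s (s ⇡ 2 ⊠ s) ⊠ J (s ⇡ 2 ⊠ s) ⊠ ρ s₃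
      ≈⟨ ⊠-congʳ (((Euler-cong oc (⊠-congˡ (*-identityʳ s)) c) ⟨⊠⟩ Euler-cong oc ≈-refl c)
           ⟨⊠⟩ Euler-cong oc (⟨⊟⟩ c) c) ⟩
    Euler (s ⊠ s) s₃ ⊠ Euler s s₃ ⊠ J s₃ ⊠ ρ s₃
      ≈⟨ solve 4 (λ a b j r → a :* b :* j :* r := b :* a :* r :* j) ≈-refl _ _ (J s₃) (ρ s₃) ⟩
    Euler s s₃ ⊠ Euler (s ⊠ s) s₃ ⊠ Euler s₃ s₃ ⊠ J s₃
      ≈⟨ ⊠-congʳ (Euler-split₃ o o) ⟨
    ρ s ⊠ J s₃ ∎
    where
    s₃ = s ⇡ 3
    oc = Ord-⊠ˡ (Ord-⇡suc 1 o)
    c : s ⇡ 2 ⊠ s ≈ s ⇡ 3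
    c = *-comm _ _

  -- Likewise `κ` contains the factors `1 - sⁱ` with `i` congruent to 1 or 5 modulo 6, and `e(s³)`
  -- supplies the class 3.
  κ-product : κ s ⊠ e (s ⇡ 3) ≈ e s ⊠ J (s ⇡ 3 ⊠ s ⇡ 3)
  κ-product = begin
    κ s ⊠ e s₃
      ≈⟨ ⊠-congʳ (triple-product (Ord-⊟ (Ord-⇡suc 4 o)) (Ord-⊟ o)) ⟨
    Euler (⊟ s ⇡ 5) c ⊠ Euler (⊟ s) c ⊠ J c ⊠ e s₃
      ≈⟨ ((Euler-cong oc (solve 1 (λ s → :- (s :^ 5) := (:- s) :* (s :* s) :^ 2) ≈-refl s) c₆
           ⟨⊠⟩ Euler-cong oc ≈-refl c₆)
          ⟨⊠⟩ Euler-cong oc (⟨⊟⟩ c₃) c₃)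
         ⟨⊠⟩ Euler-cong (Ord-⊠ˡ (Ord-⇡suc 2 o)) (solve 1
             (λ s → :- (s :^ 3) := (:- s) :* (s :* s)) ≈-refl s) (≈-trans (≈-sym c₃) c₆) ⟩
    Euler (⊟ s ⊠ (s ⊠ s) ⇡ 2) d ⊠ Euler (⊟ s) d ⊠ J (s₃ ⊠ s₃) ⊠ Euler (⊟ s ⊠ (s ⊠ s)) d
      ≈⟨ solve 4 (λ a b j r → a :* b :* j :* r := b :* r :* a :* j) ≈-refl _ _ (J (s₃ ⊠ s₃)) _ ⟩
    Euler (⊟ s) d ⊠ Euler (⊟ s ⊠ (s ⊠ s)) d ⊠ Euler (⊟ s ⊠ (s ⊠ s) ⇡ 2) d ⊠ J (s₃ ⊠ s₃)
      ≈⟨ ⊠-congʳ (Euler-split₃ o₂ (Ord-⊟ o)) ⟨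
    e s ⊠ J (s₃ ⊠ s₃) ∎
    where
    s₃ = s ⇡ 3
    d  = (s ⊠ s) ⇡ 3
    c  = ⊟ s ⇡ 5 ⊠ ⊟ s
    oc = Ord-⊠ˡ (Ord-⊟ (Ord-⇡suc 4 o))
    c₆ : c ≈ d
    c₆ = solve 1 (λ s → (:- (s :^ 5)) :* (:- s) := (s :* s) :^ 3) ≈-refl s
    c₃ : c ≈ s₃ ⊠ s₃
    c₃ = solve 1 (λ s → (:- (s :^ 5)) :* (:- s) := s :^ 3 :* s :^ 3) ≈-refl s

module _ {s : Series} (o : Ord 1 s) where
  private
    s₂ s₄ : Series
    s₂ = s ⊠ s
    s₄ = s₂ ⊠ s₂
    o₂ : Ord 1 s₂
    o₂ = Ord-⊠ˡ o
    o₃ : Ord 1 (s ⇡ 3)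
    o₃ = Ord-⇡suc 2 o

  ψ-e : ψ s ⊠ e s ≈ J s₂
  ψ-e = begin
    ψ s ⊠ e s                                ≈⟨ ⊠-congʳ (ψ-product o) ⟩
    ē s ⊠ J s₄ ⊠ e s                         ≈⟨ solve 3
        (λ a j b → a :* j :* b := b :* a :* j) ≈-refl (ē s) (J s₄) (e s) ⟩
    e s ⊠ ē s ⊠ J s₄                         ≈⟨ ⊠-congʳ (e-conjugate o) ⟩
    e s₂ ⊠ J s₄                              ≈⟨ J-split o₂ ⟨
    J s₂                                     ∎

  φ-φ-neg : φ s ⊠ φ (⊟ s) ≈ φ (⊟ s₂) ⊠ φ (⊟ s₂)
  φ-φ-neg = begin
    φ s ⊠ φ (⊟ s)
      ≈⟨ φ-product o ⟨⊠⟩ φ-neg-product o ⟩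
    ē s ⊠ ē s ⊠ J s₂ ⊠ (e s ⊠ e s ⊠ J s₂)
      ≈⟨ solve 3 (λ a b j → a :* a :* j :* (b :* b :* j) := b :* a :* (b :* a) :* (j :* j)) ≈-refl
           (ē s) (e s) (J s₂) ⟩
    e s ⊠ ē s ⊠ (e s ⊠ ē s) ⊠ (J s₂ ⊠ J s₂)
      ≈⟨ (e-conjugate o ⟨⊠⟩ e-conjugate o) ⟨⊠⟩ (J-split o₂ ⟨⊠⟩ J-split o₂) ⟩
    e s₂ ⊠ e s₂ ⊠ (e s₂ ⊠ J s₄ ⊠ (e s₂ ⊠ J s₄))
      ≈⟨ solve 2 (λ a j → a :* a :* (a :* j :* (a :* j)) := a :* a :* j :* (a :* a :* j)) ≈-refl
           (e s₂) (J s₄) ⟩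
    e s₂ ⊠ e s₂ ⊠ J s₄ ⊠ (e s₂ ⊠ e s₂ ⊠ J s₄)
      ≈⟨ φ-neg-product o₂ ⟨⊠⟩ φ-neg-product o₂ ⟨
    φ (⊟ s₂) ⊠ φ (⊟ s₂) ∎

  ψ-square : ψ s ⊠ ψ s ≈ φ s ⊠ ψ s₂
  ψ-square = begin
    ψ s ⊠ ψ s
      ≈⟨ ψ-product o ⟨⊠⟩ ψ-product o ⟩
    ē s ⊠ J s₄ ⊠ (ē s ⊠ J s₄)
      ≈⟨ ⊠-congˡ (⊠-congˡ (≈-trans (J-split (Ord-⊠ˡ o₂)) (⊠-congʳ (≈-sym (e-conjugate o₂))))) ⟩
    ē s ⊠ J s₄ ⊠ (ē s ⊠ (e s₂ ⊠ ē s₂ ⊠ J s₈))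
      ≈⟨ solve 5 (λ a j b c k → a :* j :* (a :* (b :* c :* k)) := a :* a :* (b :* j) :*
           (c :* k)) ≈-refl (ē s) (J s₄) (e s₂) (ē s₂) (J s₈) ⟩
    ē s ⊠ ē s ⊠ (e s₂ ⊠ J s₄) ⊠ (ē s₂ ⊠ J s₈)
      ≈⟨ ⊠-congˡ (≈-sym (J-split o₂)) ⟨⊠⟩ ≈-sym (ψ-product o₂) ⟩
    ē s ⊠ ē s ⊠ J s₂ ⊠ ψ s₂
      ≈⟨ ⊠-congʳ (φ-product o) ⟨
    φ s ⊠ ψ s₂ ∎
    where s₈ = s₄ ⊠ s₄

  φ-neg-ē : φ (⊟ s₂) ⊠ ē s ≈ φ s ⊠ e s
  φ-neg-ē = begin
    φ (⊟ s₂) ⊠ ē s                           ≈⟨ ⊠-congʳ (φ-neg-product o₂) ⟩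
    e s₂ ⊠ e s₂ ⊠ J s₄ ⊠ ē s                 ≈⟨ solve 3
        (λ a j b → a :* a :* j :* b := a :* (a :* j) :* b) ≈-refl (e s₂) (J s₄) (ē s) ⟩
    e s₂ ⊠ (e s₂ ⊠ J s₄) ⊠ ē s               ≈⟨ ⊠-congʳ (≈-sym (e-conjugate o) ⟨⊠⟩ ≈-sym (J-split o₂)) ⟩
    e s ⊠ ē s ⊠ J s₂ ⊠ ē s                   ≈⟨ solve 3
        (λ a b j → a :* b :* j :* b := b :* b :* j :* a) ≈-refl (e s) (ē s) (J s₂) ⟩
    ē s ⊠ ē s ⊠ J s₂ ⊠ e s                   ≈⟨ ⊠-congʳ (φ-product o) ⟨
    φ s ⊠ e s                                ∎

  ψ-ρ : ψ s ≈ ρ s ⇡ 3 ⊠ φ (⊟ s)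
  ψ-ρ = ≈-sym (begin
    ρ s ⇡ 3 ⊠ φ (⊟ s)                        ≈⟨ ⊠-congˡ (≈-trans (φ-neg-product o) (⊠-congˡ (≈-sym ψ-e))) ⟩
    ρ s ⇡ 3 ⊠ (e s ⊠ e s ⊠ (ψ s ⊠ e s))      ≈⟨ solve 3
        (λ r e p → r :^ 3 :* (e :* e :* (p :* e)) := (r :* e) :^ 3 :* p) ≈-refl (ρ s) (e s) (ψ s) ⟩
    (ρ s ⊠ e s) ⇡ 3 ⊠ ψ s                    ≈⟨ ⊠-congʳ (⇡-congˡ 3 (ρ-e o)) ⟩
    𝟙 ⇡ 3 ⊠ ψ s                              ≈⟨ solve 1 (λ p → (p :^ 0) :^ 3 :* p := p) ≈-refl (ψ s) ⟩
    ψ s                                      ∎)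

  α-ρ : α s ≈ ρ s ⊠ φ (⊟ s ⇡ 3)
  α-ρ = begin
    α s                                      ≈⟨ ≈-trans (⊠-congˡ (ρ-e o₃)) (*-identityʳ _) ⟨
    α s ⊠ (ρ s₃ ⊠ e s₃)                      ≈⟨ *-assoc _ _ _ ⟨
    α s ⊠ ρ s₃ ⊠ e s₃                        ≈⟨ ⊠-congʳ (≈-trans (α-product o) (⊠-congˡ (J-split o₃))) ⟩
    ρ s ⊠ (e s₃ ⊠ J (s₃ ⊠ s₃)) ⊠ e s₃        ≈⟨ solve 3
        (λ r e j → r :* (e :* j) :* e := r :* (e :* e :* j)) ≈-refl (ρ s) (e s₃) _ ⟩
    ρ s ⊠ (e s₃ ⊠ e s₃ ⊠ J (s₃ ⊠ s₃))        ≈⟨ ⊠-congˡ (φ-neg-product o₃) ⟨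
    ρ s ⊠ φ (⊟ s₃)                           ∎
    where s₃ = s ⇡ 3

module _ {s : Series} (o : Ord 1 s) where
  private
    o₃ : Ord 1 (s ⇡ 3)
    o₃ = Ord-⇡suc 2 o

  ρ-κ : ρ s ⊠ κ s ≈ ψ (s ⇡ 3)
  ρ-κ = ⊠-cancel (e s₃) (e-unit o₃) (begin
    e s₃ ⊠ (ρ s ⊠ κ s)                       ≈⟨ solve 3
        (λ e r k → e :* (r :* k) := r :* (k :* e)) ≈-refl (e s₃) (ρ s) (κ s) ⟩
    ρ s ⊠ (κ s ⊠ e s₃)                       ≈⟨ ⊠-congˡ (κ-product o) ⟩
    ρ s ⊠ (e s ⊠ J (s₃ ⊠ s₃))                ≈⟨ *-assoc _ _ _ ⟨
    ρ s ⊠ e s ⊠ J (s₃ ⊠ s₃)                  ≈⟨ ⊠-congʳ (ρ-e o) ⟩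
    𝟙 ⊠ J (s₃ ⊠ s₃)                          ≈⟨ ≈-trans (*-identityˡ _) (≈-sym (ψ-e o₃)) ⟩
    ψ s₃ ⊠ e s₃                              ≈⟨ *-comm _ _ ⟩
    e s₃ ⊠ ψ s₃                              ∎)
    where s₃ = s ⇡ 3

-- On the left of `bilateral-V` the products combine to `e(q²)`. On the right, `φ(-q⁴)` changes
-- `ē(q²)` into `φ(q²) e(q²)`, and `e(q²)` cancels.
bilateral-V-φ : φ (⊟ (q ⊠ q ⊠ (q ⊠ q))) ⊠ (v₀ ⊞ v₀ [ ⊟ q ] ⊞ ⊟ 𝟙) ≈ φ (q ⊠ q) ⊠ φ (q ⊠ q)
bilateral-V-φ = ⊠-cancel (e c) (e-unit oc) (begin
  e c ⊠ (φ⁻ ⊠ W)                 ≈⟨ solve 3 (λ e f w → e :* (f :* w) := f :* (w :* e)) ≈-refl (e c) φ⁻ W ⟩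
  φ⁻ ⊠ (W ⊠ e c)                 ≈⟨ ⊠-congˡ (⊠-congˡ (e-conjugate Ord-q)) ⟨
  φ⁻ ⊠ (W ⊠ (e q ⊠ ē q))         ≈⟨ ⊠-congˡ (≈-trans bilateral-V
      (⊠-congˡ (Euler-cong (Ord-⇡suc 1 oc) ≈-refl (⊠-congˡ (*-identityʳ c))))) ⟩
  φ⁻ ⊠ (φ c ⊠ ē c)               ≈⟨ solve 3 (λ f g h → f :* (g :* h) := g :* (f :* h)) ≈-refl φ⁻ (φ c) (ē c) ⟩
  φ c ⊠ (φ⁻ ⊠ ē c)               ≈⟨ ⊠-congˡ (φ-neg-ē oc) ⟩
  φ c ⊠ (φ c ⊠ e c)              ≈⟨ solve 2 (λ f e → f :* (f :* e) := e :* (f :* f)) ≈-refl (φ c) (e c) ⟩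
  e c ⊠ (φ c ⊠ φ c)              ∎)
  where
  c = q ⊠ q
  oc = Ord-⊠ˡ Ord-q
  φ⁻ = φ (⊟ (c ⊠ c))
  W = v₀ ⊞ v₀ [ ⊟ q ] ⊞ ⊟ 𝟙

-- Dissections

tri-*2 : ∀ m → tri (m * 2) ≡ 4 * tri m + m
tri-*2 zero    = refl
tri-*2 (suc m) = trans (cong (λ t → suc (m * 2) + (m * 2 + t)) (tri-*2 m))
  (ℕ-solve 2 (λ m t → ♯ 1 ∔ m ∙ ♯ 2 ∔ (m ∙ ♯ 2 ∔ (♯ 4 ∙ t ∔ m)) ≜ ♯ 4 ∙ (m ∔ t) ∔ (♯ 1 ∔ m)) refl m (tri m))

tri-*3 : ∀ m → tri (m * 3) ≡ 9 * tri m + 3 * m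
tri-*3 zero    = refl
tri-*3 (suc m) = trans (cong (λ t → suc (suc (m * 3)) + (suc (m * 3) + (m * 3 + t))) (tri-*3 m))
  (ℕ-solve 2 (λ m t → ♯ 2 ∔ m ∙ ♯ 3 ∔ (♯ 1 ∔ m ∙ ♯ 3 ∔ (m ∙ ♯ 3 ∔ (♯ 9 ∙ t ∔ ♯ 3 ∙ m)))
    ≜ ♯ 9 ∙ (m ∔ t) ∔ ♯ 3 ∙ (♯ 1 ∔ m)) refl m (tri m))

thetaTerm-⇡ : ∀ s a b n → thetaTerm (s ⇡ a) (s ⇡ b) n ≈ s ⇡ (a * n + b * tri n)
thetaTerm-⇡ s a b n = ≈-trans (⇡-* s a n ⟨⊠⟩ ⇡-* s b (tri n)) (≈-sym (⇡-+ s (a * n) (b * tri n)))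

φ-sum : ∀ {s} → Ord 1 s → φ s ≈ Sum 0 (λ n → s ⇡ (n + 2 * tri n)) ⊞ Sum 0 (λ n → s ⇡ (n + 2 * tri n)) ⊞ ⊟ 𝟙
φ-sum {s} o = ≈-trans (Θ-diagonal o) (⊞-congʳ (Sum-cong term ⟨⊞⟩ Sum-cong term))
  where
  term : ∀ n → thetaTerm s (s ⊠ s) n ≈ s ⇡ (n + 2 * tri n)
  term n = ≈-trans (⊠-congˡ (≈-trans (⇡-congˡ (tri n) (⊠-congˡ (≈-sym (*-identityʳ s))))
      (⇡-* s 2 (tri n)))) (≈-sym (⇡-+ s n (2 * tri n)))

tri-suc≥ : ∀ {s} → Ord 1 s → Summable 0 (λ m → s ⇡ tri (suc m))
tri-suc≥ o m = Ord-≤ (ℕ.m≤m+n m (tri m)) (Ord-⇡ (tri (suc m)) o)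

exponent-summable : ∀ {s} b → Ord 1 s → Summable 0 (λ n → s ⇡ (n + b * tri n))
exponent-summable b o n = Ord-≤ (ℕ.m≤m+n n (b * tri n)) (Ord-⇡ (n + b * tri n) o)

⇡-≡ : ∀ s {m n} → m ≡ n → s ⇡ m ≈ s ⇡ n
⇡-≡ s = ⇡-congʳ s

module _ {s : Series} (o : Ord 1 s) where
  -- Even and odd `m` enumerate the two halves of the bilateral series `Θ (s³) s`.
  ψ-sum : ψ s ≈ Sum 0 (λ m → s ⇡ tri (suc m))
  ψ-sum = ≈-sym (≈-trans (Sum-residues 1 (tri-suc≥ o))
      (Sum-cong even ⟨⊞⟩ ≈-trans (≈-trans (⊞-comm _ _) (+-identityˡ _)) (Sum-cong odd)))
    where
    c : s ⇡ 4 ≈ s ⇡ 3 ⊠ s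
    c = *-comm _ _
    even : ∀ m → s ⇡ tri (suc (m * 2 + 0)) ≈ thetaTerm (s ⇡ 3) (s ⇡ 3 ⊠ s) m
    even m = ≈-trans (⇡-≡ s (trans (cong (λ j → tri (suc j)) (ℕ.+-identityʳ (m * 2)))
        (trans (cong (λ t → m * 2 + t) (tri-*2 m))
            (ℕ-solve 2 (λ m t → m ∙ ♯ 2 ∔ (♯ 4 ∙ t ∔ m) ≜ ♯ 3 ∙ m ∔ ♯ 4 ∙ t) refl m (tri m)))))
      (≈-trans (≈-sym (thetaTerm-⇡ s 3 4 m)) (thetaTerm-cong ≈-refl c m))
    odd : ∀ m → s ⇡ tri (suc (m * 2 + 1)) ≈ thetaTerm s (s ⇡ 3 ⊠ s) (suc m)
    odd m = ≈-trans (⇡-≡ s (trans (cong (λ j → tri (suc j)) (ℕ.+-comm (m * 2) 1))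
        (trans (cong (λ t → suc (m * 2) + (m * 2 + t)) (tri-*2 m))
            (ℕ-solve 2 (λ m t → ♯ 1 ∔ m ∙ ♯ 2 ∔ (m ∙ ♯ 2 ∔ (♯ 4 ∙ t ∔ m)) ≜ ♯ 1 ∙ (♯ 1 ∔ m) ∔ ♯ 4 ∙
                (m ∔ t)) refl m (tri m)))))
      (≈-trans (≈-sym (thetaTerm-⇡ s 1 4 (suc m))) (thetaTerm-cong (*-identityʳ s) c (suc m)))

module _ {s : Series} (o : Ord 1 s) where
  -- Even squares are `4m²`; odd ones are `1 + 8 tri (m+1)`, which yields `ψ(s⁸)` by `ψ-sum`.
  φ-dissect₂ : φ s ≈ φ (s ⇡ 4) ⊞ ι (ℤ.+ 2) ⊠ (s ⊠ ψ (s ⇡ 8))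
  φ-dissect₂ = begin
    φ s
      ≈⟨ φ-sum o ⟩
    S ⊞ S ⊞ ⊟ 𝟙
      ≈⟨ ⊞-congʳ (split ⟨⊞⟩ split) ⟩
    (S₄ ⊞ s ⊠ ψ (s ⇡ 8)) ⊞ (S₄ ⊞ s ⊠ ψ (s ⇡ 8)) ⊞ ⊟ 𝟙
      ≈⟨ solve 2 (λ a b → (a :+ b) :+ (a :+ b) :- a :^ 0 := a :+ a :- a :^ 0 :+ con
           (ℤ.+ 2) :* b) ≈-refl S₄ (s ⊠ ψ (s ⇡ 8)) ⟩
    S₄ ⊞ S₄ ⊞ ⊟ 𝟙 ⊞ ι (ℤ.+ 2) ⊠ (s ⊠ ψ (s ⇡ 8))
      ≈⟨ ⊞-congʳ (φ-sum (Ord-⇡suc 3 o)) ⟨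
    φ (s ⇡ 4) ⊞ ι (ℤ.+ 2) ⊠ (s ⊠ ψ (s ⇡ 8)) ∎
    where
    S S₄ : Series
    S  = Sum 0 (λ n → s ⇡ (n + 2 * tri n))
    S₄ = Sum 0 (λ n → (s ⇡ 4) ⇡ (n + 2 * tri n))
    even : ∀ m → s ⇡ (m * 2 + 0 + 2 * tri (m * 2 + 0)) ≈ (s ⇡ 4) ⇡ (m + 2 * tri m)
    even m = ≈-trans (⇡-≡ s (trans (cong (λ j → j + 2 * tri j) (ℕ.+-identityʳ (m * 2)))
        (trans (cong (λ t → m * 2 + 2 * t) (tri-*2 m))
      (ℕ-solve 2 (λ m t → m ∙ ♯ 2 ∔ ♯ 2 ∙ (♯ 4 ∙ t ∔ m) ≜ ♯ 4 ∙ (m ∔ ♯ 2 ∙ t)) refl m (tri m)))))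
          (≈-sym (⇡-* s 4 (m + 2 * tri m)))
    odd : ∀ m → s ⇡ (m * 2 + 1 + 2 * tri (m * 2 + 1)) ≈ s ⊠ (s ⇡ 8) ⇡ tri (suc m)
    odd m = ≈-trans (⇡-≡ s (trans (cong (λ j → j + 2 * tri j) (ℕ.+-comm (m * 2) 1))
        (trans (cong (λ t → suc (m * 2) + 2 * (m * 2 + t)) (tri-*2 m))
      (ℕ-solve 2 (λ m t → ♯ 1 ∔ m ∙ ♯ 2 ∔ ♯ 2 ∙ (m ∙ ♯ 2 ∔ (♯ 4 ∙ t ∔ m)) ≜ ♯ 1 ∔ ♯ 8 ∙
          (m ∔ t)) refl m (tri m))))) (⊠-congˡ (≈-sym (⇡-* s 8 (tri (suc m)))))
    split : S ≈ S₄ ⊞ s ⊠ ψ (s ⇡ 8)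
    split = ≈-trans (Sum-residues 1 (exponent-summable 2 o))
        (Sum-cong even ⟨⊞⟩ ≈-trans (≈-trans (⊞-comm _ _) (+-identityˡ _))
      (≈-trans (Sum-cong odd) (≈-trans (≈-sym (Sum-⊠ s (tri-suc≥ (Ord-⇡suc 7 o))))
          (⊠-congˡ (≈-sym (ψ-sum (Ord-⇡suc 7 o)))))))

  -- Besides the squares `9m²`, those of `3m + 1` and `3m + 2` run through the two halves of one
  -- bilateral series.
  φ-dissect₃ : φ s ≈ φ (s ⇡ 9) ⊞ ι (ℤ.+ 2) ⊠ (s ⊠ Θ (s ⇡ 15) (s ⇡ 3))
  φ-dissect₃ = begin
    φ s
      ≈⟨ φ-sum o ⟩
    S ⊞ S ⊞ ⊟ 𝟙
      ≈⟨ ⊞-congʳ (split ⟨⊞⟩ split) ⟩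
    (S₉ ⊞ s ⊠ Q) ⊞ (S₉ ⊞ s ⊠ Q) ⊞ ⊟ 𝟙
      ≈⟨ solve 2 (λ a b → (a :+ b) :+ (a :+ b) :- a :^ 0 := a :+ a :- a :^ 0 :+ con
           (ℤ.+ 2) :* b) ≈-refl S₉ (s ⊠ Q) ⟩
    S₉ ⊞ S₉ ⊞ ⊟ 𝟙 ⊞ ι (ℤ.+ 2) ⊠ (s ⊠ Q)
      ≈⟨ ⊞-congʳ (φ-sum (Ord-⇡suc 8 o)) ⟨
    φ (s ⇡ 9) ⊞ ι (ℤ.+ 2) ⊠ (s ⊠ Q) ∎
    where
    Q S S₉ : Series
    Q  = Θ (s ⇡ 15) (s ⇡ 3)
    S  = Sum 0 (λ n → s ⇡ (n + 2 * tri n))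
    S₉ = Sum 0 (λ n → (s ⇡ 9) ⇡ (n + 2 * tri n))
    c : s ⇡ 18 ≈ s ⇡ 15 ⊠ s ⇡ 3
    c = ⇡-+ s 15 3
    r₀ : ∀ m → s ⇡ (m * 3 + 0 + 2 * tri (m * 3 + 0)) ≈ (s ⇡ 9) ⇡ (m + 2 * tri m)
    r₀ m = ≈-trans (⇡-≡ s (trans (cong (λ j → j + 2 * tri j) (ℕ.+-identityʳ (m * 3)))
        (trans (cong (λ t → m * 3 + 2 * t) (tri-*3 m))
      (ℕ-solve 2 (λ m t → m ∙ ♯ 3 ∔ ♯ 2 ∙ (♯ 9 ∙ t ∔ ♯ 3 ∙ m) ≜ ♯ 9 ∙ (m ∔ ♯ 2 ∙ t)) refl m
          (tri m))))) (≈-sym (⇡-* s 9 (m + 2 * tri m)))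
    r₁ : ∀ m → s ⇡ (m * 3 + 1 + 2 * tri (m * 3 + 1)) ≈ s ⊠ thetaTerm (s ⇡ 15) (s ⇡ 15 ⊠ s ⇡ 3) m
    r₁ m = ≈-trans (⇡-≡ s (trans (cong (λ j → j + 2 * tri j) (ℕ.+-comm (m * 3) 1))
        (trans (cong (λ t → suc (m * 3) + 2 * (m * 3 + t)) (tri-*3 m))
      (ℕ-solve 2 (λ m t → ♯ 1 ∔ m ∙ ♯ 3 ∔ ♯ 2 ∙ (m ∙ ♯ 3 ∔ (♯ 9 ∙ t ∔ ♯ 3 ∙ m)) ≜ ♯ 1 ∔
          (♯ 15 ∙ m ∔ ♯ 18 ∙ t)) refl m (tri m)))))
      (⊠-congˡ (≈-trans (≈-sym (thetaTerm-⇡ s 15 18 m)) (thetaTerm-cong ≈-refl c m)))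
    r₂ : ∀ m → s ⇡ (m * 3 + 2 + 2 * tri (m * 3 + 2)) ≈ s ⊠ thetaTerm (s ⇡ 3) (s ⇡ 15 ⊠ s ⇡ 3) (suc m)
    r₂ m = ≈-trans (⇡-≡ s (trans (cong (λ j → j + 2 * tri j) (ℕ.+-comm (m * 3) 2))
        (trans (cong (λ t → 2 + m * 3 + 2 * (suc (m * 3) + (m * 3 + t))) (tri-*3 m))
      (ℕ-solve 2 (λ m t → ♯ 2 ∔ m ∙ ♯ 3 ∔ ♯ 2 ∙ (♯ 1 ∔ m ∙ ♯ 3 ∔ (m ∙ ♯ 3 ∔ (♯ 9 ∙ t ∔ ♯ 3 ∙ m)))
          ≜ ♯ 1 ∔ (♯ 3 ∙ (♯ 1 ∔ m) ∔ ♯ 18 ∙ (m ∔ t))) refl m (tri m)))))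
      (⊠-congˡ (≈-trans (≈-sym (thetaTerm-⇡ s 3 18 (suc m))) (thetaTerm-cong ≈-refl c (suc m))))
    split : S ≈ S₉ ⊞ s ⊠ Q
    split = begin
      S
        ≈⟨ Sum-residues 2 (exponent-summable 2 o) ⟩
      Sum 0 (λ m → s ⇡ (m * 3 + 0 + 2 * tri (m * 3 + 0))) ⊞
          (Sum 0 (λ m → s ⇡ (m * 3 + 1 + 2 * tri (m * 3 + 1)))
        ⊞ (Sum 0 (λ m → s ⇡ (m * 3 + 2 + 2 * tri (m * 3 + 2))) ⊞ ι 0ℤ))
        ≈⟨ Sum-cong r₀ ⟨⊞⟩ (≈-trans (Sum-cong r₁) (≈-sym (Sum-⊠ s (λ n → thetaTerm-Ord _ n (Ord-⇡suc 14 o))))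
            ⟨⊞⟩ ⊞-congʳ (≈-trans (Sum-cong r₂) (≈-sym
                (Sum-⊠ s (λ n → Ord-≤ (ℕ.n≤1+n n) (thetaTerm-Ord _ (suc n) (Ord-⇡suc 2 o))))))) ⟩
      S₉ ⊞ (s ⊠ _ ⊞ (s ⊠ _ ⊞ ι 0ℤ))
        ≈⟨ solve 4 (λ S s a b → S :+ (s :* a :+ (s :* b :+ con 0ℤ)) := S :+ s :* (a :+ b)) ≈-refl S₉ s _ _ ⟩
      S₉ ⊞ s ⊠ Q ∎

  -- Among the triangular numbers, the indices 0 and 2 modulo 3 give the two halves of `α(s³)`, and
  -- the index 1 modulo 3 gives `1 + 9` times a triangular number.
  ψ-dissect₃ : ψ s ≈ α (s ⇡ 3) ⊞ s ⊠ ψ (s ⇡ 9)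
  ψ-dissect₃ = begin
    ψ s
      ≈⟨ ≈-trans (ψ-sum o) (Sum-residues 2 (tri-suc≥ o)) ⟩
    Sum 0 (λ m → s ⇡ tri (suc (m * 3 + 0))) ⊞ (Sum 0 (λ m → s ⇡ tri (suc (m * 3 + 1))) ⊞
        (Sum 0 (λ m → s ⇡ tri (suc (m * 3 + 2))) ⊞ ι 0ℤ))
      ≈⟨ Sum-cong r₀ ⟨⊞⟩ (≈-trans (Sum-cong r₁) (≈-trans (≈-sym (Sum-⊠ s (tri-suc≥ (Ord-⇡suc 8 o))))
           (⊠-congˡ (≈-sym (ψ-sum (Ord-⇡suc 8 o)))))
           ⟨⊞⟩ ⊞-congʳ (Sum-cong r₂)) ⟩
    _ ⊞ (s ⊠ ψ (s ⇡ 9) ⊞ (_ ⊞ ι 0ℤ))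
      ≈⟨ solve 3 (λ a b d → a :+ (b :+ (d :+ con 0ℤ)) := a :+ d :+ b) ≈-refl _ (s ⊠ ψ (s ⇡ 9)) _ ⟩
    α (s ⇡ 3) ⊞ s ⊠ ψ (s ⇡ 9) ∎
    where
    x : s ⇡ 6 ≈ (s ⇡ 3) ⇡ 2
    x = ≈-sym (⇡-* s 3 2)
    c : s ⇡ 9 ≈ (s ⇡ 3) ⇡ 2 ⊠ s ⇡ 3
    c = ≈-trans (⇡-+ s 6 3) (⊠-congʳ x)
    r₀ : ∀ m → s ⇡ tri (suc (m * 3 + 0)) ≈ thetaTerm ((s ⇡ 3) ⇡ 2) ((s ⇡ 3) ⇡ 2 ⊠ s ⇡ 3) m
    r₀ m = ≈-trans (⇡-≡ s (trans (cong (λ j → tri (suc j)) (ℕ.+-identityʳ (m * 3)))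
        (trans (cong (λ t → m * 3 + t) (tri-*3 m))
      (ℕ-solve 2 (λ m t → m ∙ ♯ 3 ∔ (♯ 9 ∙ t ∔ ♯ 3 ∙ m) ≜ ♯ 6 ∙ m ∔ ♯ 9 ∙ t) refl m (tri m)))))
      (≈-trans (≈-sym (thetaTerm-⇡ s 6 9 m)) (thetaTerm-cong x c m))
    r₁ : ∀ m → s ⇡ tri (suc (m * 3 + 1)) ≈ s ⊠ (s ⇡ 9) ⇡ tri (suc m)
    r₁ m = ≈-trans (⇡-≡ s (trans (cong (λ j → tri (suc j)) (ℕ.+-comm (m * 3) 1))
        (trans (cong (λ t → suc (m * 3) + (m * 3 + t)) (tri-*3 m))
      (ℕ-solve 2 (λ m t → ♯ 1 ∔ m ∙ ♯ 3 ∔ (m ∙ ♯ 3 ∔ (♯ 9 ∙ t ∔ ♯ 3 ∙ m)) ≜ ♯ 1 ∔ ♯ 9 ∙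
          (m ∔ t)) refl m (tri m)))))
      (⊠-congˡ (≈-sym (⇡-* s 9 (tri (suc m)))))
    r₂ : ∀ m → s ⇡ tri (suc (m * 3 + 2)) ≈ thetaTerm (s ⇡ 3) ((s ⇡ 3) ⇡ 2 ⊠ s ⇡ 3) (suc m)
    r₂ m = ≈-trans (⇡-≡ s (trans (cong (λ j → tri (suc j)) (ℕ.+-comm (m * 3) 2))
        (trans (cong (λ t → 2 + m * 3 + (suc (m * 3) + (m * 3 + t))) (tri-*3 m))
      (ℕ-solve 2 (λ m t → ♯ 2 ∔ m ∙ ♯ 3 ∔ (♯ 1 ∔ m ∙ ♯ 3 ∔ (m ∙ ♯ 3 ∔ (♯ 9 ∙ t ∔ ♯ 3 ∙ m))) ≜ ♯ 3 ∙
          (♯ 1 ∔ m) ∔ ♯ 9 ∙ (m ∔ t)) refl m (tri m)))))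
      (≈-trans (≈-sym (thetaTerm-⇡ s 3 9 (suc m))) (thetaTerm-cong ≈-refl c (suc m)))

-- Even and odd parts

private
  -- These are `φ(q)`, `φ(-q)`, `ψ(q)`, `ψ(q²)`, `φ(q²)` and `ψ(q⁴)`. The last three are
  -- substitutions of `q²`, hence even by form, which is how even and odd parts are read off.
  F M Ψ Ψ₂ a b : Series
  F  = φ q
  M  = φ (⊟ q)
  Ψ  = ψ q
  Ψ₂ = Ψ [ q ⇡ 2 ]
  a  = F [ q ⇡ 2 ]
  b  = Ψ₂ [ q ⇡ 2 ]

  two four : Series
  two  = ι (ℤ.+ 2)
  four = ι (ℤ.+ 4)

  oQ : ∀ k → Ord 1 (q ⇡ suc k)
  oQ k = Ord-⇡suc k Ord-q

  o₂ : Ord 1 (q ⇡ 2)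
  o₂ = oQ 1

  o⊟ : Ord 1 (⊟ q)
  o⊟ = Ord-⊟ Ord-q

  φ-[] : ∀ {s t u} → Ord 1 s → Ord 1 t → s [ t ] ≈ u → φ s [ t ] ≈ φ u
  φ-[] os ot p = ≈-trans ([]-Θ os os ot) (Θ-cong p p)

  ψ-[] : ∀ {s t u} → Ord 1 s → Ord 1 t → s [ t ] ≈ u → ψ s [ t ] ≈ ψ u
  ψ-[] {s} os ot p = ≈-trans ([]-Θ (Ord-⇡suc 2 os) os ot) (Θ-cong (≈-trans ([]-⇡ s 3 ot) (⇡-congˡ 3 p)) p)

  q⇡-[] : ∀ j k → (q ⇡ j) [ q ⇡ suc k ] ≈ q ⇡ (suc k * j)
  q⇡-[] j k = ≈-trans ([]-⇡ q j (oQ k)) (≈-trans (⇡-congˡ j ([]-q _ (oQ k))) (⇡-* q (suc k) j))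

  ⊟q-[] : ∀ k → (⊟ q) [ q ⇡ suc k ] ≈ ⊟ (q ⇡ suc k)
  ⊟q-[] k = ≈-trans ([]-⊟ q (oQ k)) (⟨⊟⟩ []-q _ (oQ k))

  a-≈ : φ (q ⇡ 2) ≈ a
  a-≈ = ≈-sym (φ-[] Ord-q o₂ ([]-q _ o₂))

  Ψ₂-≈ : ψ (q ⇡ 2) ≈ Ψ₂
  Ψ₂-≈ = ≈-sym (ψ-[] Ord-q o₂ ([]-q _ o₂))

  b-≈ : ψ (q ⇡ 4) ≈ b
  b-≈ = ≈-sym (≈-trans ([]-congʳ (≈-sym Ψ₂-≈)) (ψ-[] o₂ o₂ (q⇡-[] 2 1)))

  section-even : ∀ X Y → section 2 0 (X [ q ⇡ 2 ] ⊞ q ⊠ Y [ q ⇡ 2 ]) ≈ X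
  section-even X Y = ≈-trans (section-⊞ 2 0 _ _) (≈-trans (section-[]-zero 1 X ⟨⊞⟩
    ≈-trans (section-q⊠-zero 1 _) (≈-trans (⊠-congˡ (section-[]-suc (s≤s (s≤s z≤n)) Y)) (zeroʳ q)))
        (≈-trans (⊞-comm _ _) (+-identityˡ X)))

  section-odd : ∀ X Y → section 2 1 (X [ q ⇡ 2 ] ⊞ q ⊠ Y [ q ⇡ 2 ]) ≈ Y
  section-odd X Y = ≈-trans (section-⊞ 2 1 _ _) (≈-trans (section-[]-suc (s≤s (s≤s z≤n)) X ⟨⊞⟩
    ≈-trans (section-q⊠-suc 2 0 _) (section-[]-zero 1 Y)) (+-identityˡ Y))

  D : Series → Series
  D f = f [ q ⇡ 2 ]

  D-⊞ : ∀ f g → D (f ⊞ g) ≈ D f ⊞ D g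
  D-⊞ f g = []-⊞ f g (q ⇡ 2)

  D-⊠ : ∀ f g → D (f ⊠ g) ≈ D f ⊠ D g
  D-⊠ f g = []-⊠ f g o₂

  D-ι⊠ : ∀ k f → D (ι k ⊠ f) ≈ ι k ⊠ D f
  D-ι⊠ k f = ≈-trans (D-⊠ (ι k) f) (⊠-congʳ ([]-ι k (q ⇡ 2) o₂))

  D-⇡ : ∀ f n → D (f ⇡ n) ≈ D f ⇡ n
  D-⇡ f n = []-⇡ f n o₂

  D-q⊠ : ∀ f → D (q ⊠ f) ≈ q ⇡ 2 ⊠ D f
  D-q⊠ f = ≈-trans (D-⊠ q f) (⊠-congʳ ([]-q _ o₂))

  φ-split : F ≈ D a ⊞ q ⊠ D (two ⊠ b)
  φ-split = begin
    F                                           ≈⟨ φ-dissect₂ Ord-q ⟩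
    φ (q ⇡ 4) ⊞ two ⊠ (q ⊠ ψ (q ⇡ 8))           ≈⟨ φ-[] o₂ o₂ (q⇡-[] 2 1) ⟨⊞⟩ ⊠-congˡ
        (⊠-congˡ (ψ-[] (oQ 3) o₂ (q⇡-[] 4 1))) ⟨
    D (φ (q ⇡ 2)) ⊞ two ⊠ (q ⊠ D (ψ (q ⇡ 4)))   ≈⟨ []-congʳ a-≈ ⟨⊞⟩ ⊠-congˡ (⊠-congˡ ([]-congʳ b-≈)) ⟩
    D a ⊞ two ⊠ (q ⊠ D b)                       ≈⟨ ⊞-congˡ
        (≈-trans (⊠-congˡ (D-ι⊠ _ b)) (solve 3 (λ t x d → x :* (t :* d) := t :*
            (x :* d)) ≈-refl two q (D b))) ⟨
    D a ⊞ q ⊠ D (two ⊠ b)                       ∎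

  φ-neg-split : M ≈ D a ⊞ ⊟ (q ⊠ D (two ⊠ b))
  φ-neg-split = begin
    M                                                   ≈⟨ φ-dissect₂ o⊟ ⟩
    φ ((⊟ q) ⇡ 4) ⊞ two ⊠ (⊟ q ⊠ ψ ((⊟ q) ⇡ 8))
      ≈⟨ Θ-cong (neg 2) (neg 2) ⟨⊞⟩ ⊠-congˡ (⊠-congˡ (Θ-cong (⇡-congˡ 3 (neg 4)) (neg 4))) ⟩
    φ (q ⇡ 4) ⊞ two ⊠ (⊟ q ⊠ ψ (q ⇡ 8))                 ≈⟨ φ-[] o₂ o₂ (q⇡-[] 2 1) ⟨⊞⟩ ⊠-congˡ
        (⊠-congˡ (ψ-[] (oQ 3) o₂ (q⇡-[] 4 1))) ⟨
    D (φ (q ⇡ 2)) ⊞ two ⊠ (⊟ q ⊠ D (ψ (q ⇡ 4)))         ≈⟨ []-congʳ a-≈ ⟨⊞⟩ ⊠-congˡ (⊠-congˡ ([]-congʳ b-≈)) ⟩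
    D a ⊞ two ⊠ (⊟ q ⊠ D b)
      ≈⟨ ⊞-congˡ (≈-trans (⟨⊟⟩ ⊠-congˡ (D-ι⊠ _ b))
           (solve 3 (λ t x d → :- (x :* (t :* d)) := t :* (:- x :* d)) ≈-refl two q (D b))) ⟨
    D a ⊞ ⊟ (q ⊠ D (two ⊠ b))                           ∎
    where
    neg : ∀ k → (⊟ q) ⇡ (2 * k) ≈ q ⇡ (2 * k)
    neg k = ≈-trans (≈-sym (⇡-* (⊟ q) 2 k)) (≈-trans
        (⇡-congˡ k (solve 1 (λ x → (:- x) :^ 2 := x :^ 2) ≈-refl q)) (⇡-* q 2 k))

  c≈ : q ⊠ q ≈ q ⇡ 2
  c≈ = ⊠-congˡ (≈-sym (*-identityʳ q))

  φ-neg-D : φ (⊟ (q ⊠ q)) ≈ D M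
  φ-neg-D = ≈-trans (Θ-cong (⟨⊟⟩ c≈) (⟨⊟⟩ c≈)) (≈-sym (φ-[] o⊟ o₂ (⊟q-[] 1)))

  F-M : F ⊠ M ≈ D (M ⊠ M)
  F-M = ≈-trans (φ-φ-neg Ord-q) (≈-trans (φ-neg-D ⟨⊠⟩ φ-neg-D) (≈-sym (D-⊠ M M)))

  -- `F M` is `D (M²)` and, by the splittings of `F` and `M`, also a difference of two even squares;
  -- the even section undoes `D`.
  M² : M ⊠ M ≈ a ⊠ a ⊞ ⊟ (q ⊠ (four ⊠ (b ⊠ b)))
  M² = begin
    M ⊠ M                                       ≈⟨ section-[]-zero 1 (M ⊠ M) ⟨
    section 2 0 (D (M ⊠ M))                     ≈⟨ section-cong 2 0
        (≈-trans (≈-sym F-M) (φ-split ⟨⊠⟩ φ-neg-split)) ⟩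
    section 2 0 ((D a ⊞ q ⊠ D (two ⊠ b)) ⊠ (D a ⊞ ⊟ (q ⊠ D (two ⊠ b))))
      ≈⟨ section-cong 2 0 (≈-trans ((⊞-congˡ (⊠-congˡ (D-ι⊠ _ b))) ⟨⊠⟩ ⊞-congˡ (⟨⊟⟩ ⊠-congˡ (D-ι⊠ _ b)))
           (solve 3 (λ x a b → (a :+ x :* (con (ℤ.+ 2) :* b)) :* (a :- x :* (con (ℤ.+ 2) :* b))
               := a :* a :- x :^ 2 :* (con (ℤ.+ 4) :* (b :* b))) ≈-refl q (D a) (D b))) ⟩
    section 2 0 (D a ⊠ D a ⊞ ⊟ (q ⇡ 2 ⊠ (four ⊠ (D b ⊠ D b))))
      ≈⟨ section-cong 2 0 (≈-trans (D-⊞ (a ⊠ a) _)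
           (D-⊠ a a ⟨⊞⟩ ≈-trans ([]-⊟ _ o₂) (⟨⊟⟩ ≈-trans (D-q⊠ _)
               (⊠-congˡ (≈-trans (D-ι⊠ _ _) (⊠-congˡ (D-⊠ b b))))))) ⟨
    section 2 0 (D (a ⊠ a ⊞ ⊟ (q ⊠ (four ⊠ (b ⊠ b)))))   ≈⟨ section-[]-zero 1 _ ⟩
    a ⊠ a ⊞ ⊟ (q ⊠ (four ⊠ (b ⊠ b)))            ∎

  F² : F ⊠ F ≈ a ⊠ a ⊞ q ⊠ (four ⊠ (b ⊠ b))
  F² = begin
    F ⊠ F                                       ≈⟨ M-flip ⟨⊠⟩ M-flip ⟨
    M [ ⊟ q ] ⊠ M [ ⊟ q ]                       ≈⟨ []-⊠ M M o⊟ ⟨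
    (M ⊠ M) [ ⊟ q ]                             ≈⟨ []-congʳ M² ⟩
    (a ⊠ a ⊞ ⊟ (q ⊠ (four ⊠ (b ⊠ b)))) [ ⊟ q ]
      ≈⟨ ≈-trans ([]-⊞ _ _ _) (≈-trans ([]-⊠ a a o⊟) (a-flip ⟨⊠⟩ a-flip) ⟨⊞⟩
           ≈-trans ([]-⊟ _ o⊟) (⟨⊟⟩ ≈-trans ([]-⊠ q _ o⊟) ([]-q _ o⊟ ⟨⊠⟩ ≈-trans ([]-⊠ four _ o⊟)
             ([]-ι _ _ o⊟ ⟨⊠⟩ ≈-trans ([]-⊠ b b o⊟) (b-flip ⟨⊠⟩ b-flip))))) ⟩
    a ⊠ a ⊞ ⊟ (⊟ q ⊠ (four ⊠ (b ⊠ b)))          ≈⟨ ⊞-congˡ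
        (solve 2 (λ x y → :- (:- x :* y) := x :* y) ≈-refl q _) ⟩
    a ⊠ a ⊞ q ⊠ (four ⊠ (b ⊠ b))                ∎
    where
    even-power : ∀ k → (q ⇡ (2 * k)) [ ⊟ q ] ≈ q ⇡ (2 * k)
    even-power k = ≈-trans ([]-⇡ q (2 * k) o⊟) (≈-trans (⇡-congˡ (2 * k) ([]-q _ o⊟))
        (≈-trans (≈-sym (⇡-* (⊟ q) 2 k))
      (≈-trans (⇡-congˡ k (solve 1 (λ x → (:- x) :^ 2 := x :^ 2) ≈-refl q)) (⇡-* q 2 k))))
    M-flip : M [ ⊟ q ] ≈ F
    M-flip = φ-[] o⊟ o⊟ (≈-trans ([]-⊟ q o⊟) (≈-trans (⟨⊟⟩ []-q _ o⊟)
        (solve 1 (λ x → :- (:- x) := x) ≈-refl q)))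
    a-flip : a [ ⊟ q ] ≈ a
    a-flip = ≈-trans ([]-congʳ (≈-sym a-≈)) (≈-trans (φ-[] o₂ o⊟ (even-power 1)) a-≈)
    b-flip : b [ ⊟ q ] ≈ b
    b-flip = ≈-trans ([]-congʳ (≈-sym b-≈)) (≈-trans (ψ-[] (oQ 3) o⊟ (even-power 2)) b-≈)

  Ψ² : Ψ ⊠ Ψ ≈ F ⊠ Ψ₂
  Ψ² = ≈-trans (ψ-square Ord-q) (⊠-congˡ (≈-trans (Θ-cong (⇡-congˡ 3 c≈) c≈) Ψ₂-≈))

  Ψ₂² : Ψ₂ ⊠ Ψ₂ ≈ a ⊠ b
  Ψ₂² = ≈-trans (≈-sym (D-⊠ Ψ Ψ)) (≈-trans ([]-congʳ Ψ²) (D-⊠ F Ψ₂))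

  -- Apart from the constant term of `W`, the coefficients are twice `v₀` at `2n`, `4n`, `8n + 4`,
  -- `16n + 4` and `32n + 4`. The odd section in `N₃` leaves the constant term behind.
  W N₁ N₂ N₃ N₄ N₅ : Series
  W  = v₀ ⊞ v₀ [ ⊟ q ] ⊞ ⊟ 𝟙
  N₁ = section 2 0 W
  N₂ = section 2 0 N₁
  N₃ = section 2 1 N₂
  N₄ = section 2 0 N₃
  N₅ = section 2 0 N₄

  N₁-≈ : D M ⊠ N₁ ≈ F ⊠ F
  N₁-≈ = begin
    D M ⊠ N₁                                    ≈⟨ section-[]⊠ (s≤s z≤n) (D M) W ⟨
    section 2 0 (D (D M) ⊠ W)                   ≈⟨ section-cong 2 0
        (⊠-congʳ (≈-trans ([]-congʳ (≈-sym φ-neg-D)) (φ-[] (Ord-⊟ (Ord-⊠ˡ Ord-q)) o₂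
                                                     (≈-trans ([]-⊟ (q ⊠ q) o₂) (⟨⊟⟩ ≈-trans
                                                         (D-⊠ q q) (≈-trans ([]-q _ o₂ ⟨⊠⟩ []-q _
                                                             o₂) (≈-sym c≈ ⟨⊠⟩ ≈-sym c≈))))))) ⟩
    section 2 0 (φ (⊟ (q ⊠ q ⊠ (q ⊠ q))) ⊠ W)   ≈⟨ section-cong 2 0 bilateral-V-φ ⟩
    section 2 0 (φ (q ⊠ q) ⊠ φ (q ⊠ q))         ≈⟨ section-cong 2 0
        (≈-trans (c-φ ⟨⊠⟩ c-φ) (≈-sym (D-⊠ F F))) ⟩
    section 2 0 (D (F ⊠ F))                     ≈⟨ section-[]-zero 1 (F ⊠ F) ⟩
    F ⊠ F                                       ∎
    where
    c-φ : φ (q ⊠ q) ≈ D F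
    c-φ = ≈-trans (Θ-cong c≈ c≈) a-≈

  N₂-≈ : M ⊠ N₂ ≈ F ⊠ F
  N₂-≈ = begin
    M ⊠ N₂                                      ≈⟨ section-[]⊠ (s≤s z≤n) M N₁ ⟨
    section 2 0 (D M ⊠ N₁)                      ≈⟨ section-cong 2 0 (≈-trans N₁-≈ F²-split) ⟩
    section 2 0 (D (F ⊠ F) ⊞ q ⊠ D (four ⊠ (Ψ₂ ⊠ Ψ₂)))   ≈⟨ section-even _ _ ⟩
    F ⊠ F                                       ∎
    where
    F²-split : F ⊠ F ≈ D (F ⊠ F) ⊞ q ⊠ D (four ⊠ (Ψ₂ ⊠ Ψ₂))
    F²-split = ≈-trans F² (≈-sym (D-⊠ F F) ⟨⊞⟩ ⊠-congˡ (≈-sym (≈-trans (D-ι⊠ _ _) (⊠-congˡ (D-⊠ Ψ₂ Ψ₂)))))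

  -- `D (M²) N₂ = F M N₂ = F³`, so the right side is the odd part of `φ(q)³`, rewritten in `a` and
  -- `b`.
  N₃-≈ : M ⊠ M ⊠ N₃ ≈ ι (ℤ.+ 6) ⊠ (a ⊠ a ⊠ b) ⊞ ι (ℤ.+ 8) ⊠ (q ⊠ (b ⊠ b ⊠ b))
  N₃-≈ = begin
    M ⊠ M ⊠ N₃
      ≈⟨ section-[]⊠ (s≤s (s≤s z≤n)) (M ⊠ M) N₂ ⟨
    section 2 1 (D (M ⊠ M) ⊠ N₂)
      ≈⟨ section-cong 2 1 (≈-trans (⊠-congʳ (≈-sym F-M))
           (≈-trans (*-assoc F M N₂) (≈-trans (⊠-congˡ N₂-≈) (≈-trans (φ-split ⟨⊠⟩ F²) expand)))) ⟩
    section 2 1 (D A ⊞ q ⊠ D B)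
      ≈⟨ section-odd A B ⟩
    B
      ≈⟨ ≈-trans (⊞-congʳ (⊠-congʳ F²)) (⊞-congˡ (⊠-congˡ (⊠-congˡ Ψ₂²))) ⟩
    (a ⊠ a ⊞ q ⊠ (four ⊠ (b ⊠ b))) ⊠ (two ⊠ b) ⊞ four ⊠ (a ⊠ (a ⊠ b))
      ≈⟨ solve 3 (λ x a b → (a :* a :+ x :* (con (ℤ.+ 4) :* (b :* b))) :* (con (ℤ.+ 2) :* b) :+ con
           (ℤ.+ 4) :* (a :* (a :* b))
           := con (ℤ.+ 6) :* (a :* a :* b) :+ con (ℤ.+ 8) :* (x :* (b :* b :* b))) ≈-refl q a b ⟩
    ι (ℤ.+ 6) ⊠ (a ⊠ a ⊠ b) ⊞ ι (ℤ.+ 8) ⊠ (q ⊠ (b ⊠ b ⊠ b)) ∎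
    where
    A B : Series
    A = F ⊠ F ⊠ a ⊞ q ⊠ (ι (ℤ.+ 8) ⊠ (Ψ₂ ⊠ Ψ₂ ⊠ b))
    B = F ⊠ F ⊠ (two ⊠ b) ⊞ four ⊠ (a ⊠ (Ψ₂ ⊠ Ψ₂))
    expand : (D a ⊞ q ⊠ D (two ⊠ b)) ⊠ (a ⊠ a ⊞ q ⊠ (four ⊠ (b ⊠ b))) ≈ D A ⊞ q ⊠ D B
    expand = ≈-trans ((⊞-congˡ (⊠-congˡ (D-ι⊠ _ b))) ⟨⊠⟩ ≈-refl)
      (≈-trans (solve 5 (λ x f p A B → (A :+ x :* (con (ℤ.+ 2) :* B)) :*
          (f :* f :+ x :* (con (ℤ.+ 4) :* (p :* p)))
          := f :* f :* A :+ x :^ 2 :* (con (ℤ.+ 8) :* (p :* p :* B)) :+ x :*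
              (f :* f :* (con (ℤ.+ 2) :* B) :+ con (ℤ.+ 4) :* (A :* (p :* p)))) ≈-refl
          q a b (D a) (D b))
        (≈-sym (
          ≈-trans (D-⊞ _ _) (≈-trans (D-⊠ _ a) (⊠-congʳ (D-⊠ F F)) ⟨⊞⟩ ≈-trans (D-q⊠ _)
              (⊠-congˡ (≈-trans (D-ι⊠ _ _) (⊠-congˡ (≈-trans (D-⊠ _ b) (⊠-congʳ (D-⊠ Ψ₂ Ψ₂)))))))
          ⟨⊞⟩ ⊠-congˡ (≈-trans (D-⊞ _ _) (≈-trans (D-⊠ _ _) (D-⊠ F F ⟨⊠⟩ D-ι⊠ _ b)
            ⟨⊞⟩ ≈-trans (D-ι⊠ _ _) (⊠-congˡ (≈-trans (D-⊠ a _) (⊠-congˡ (D-⊠ Ψ₂ Ψ₂)))))))))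

  N₄-≈ : M ⇡ 4 ⊠ N₄ ≈ ι (ℤ.+ 6) ⊠ (F ⇡ 4 ⊠ Ψ₂) ⊞ q ⊠ (ι (ℤ.+ 32) ⊠ Ψ₂ ⇡ 5)
  N₄-≈ = begin
    M ⇡ 4 ⊠ N₄
      ≈⟨ section-[]⊠ (s≤s z≤n) (M ⇡ 4) N₃ ⟨
    section 2 0 (D (M ⇡ 4) ⊠ N₃)
      ≈⟨ section-cong 2 0 (begin
           D (M ⇡ 4) ⊠ N₃
             ≈⟨ ⊠-congʳ (≈-trans ([]-congʳ (solve 1 (λ m → m :^ 4 := m :* m :* (m :* m)) ≈-refl M))
                  (≈-trans (D-⊠ _ _) (≈-sym F-M ⟨⊠⟩ ≈-sym F-M))) ⟩
           F ⊠ M ⊠ (F ⊠ M) ⊠ N₃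
             ≈⟨ solve 3 (λ f m n → f :* m :* (f :* m) :* n := f :* f :* (m :* m :* n)) ≈-refl F M N₃ ⟩
           F ⊠ F ⊠ (M ⊠ M ⊠ N₃)
             ≈⟨ F² ⟨⊠⟩ N₃-≈ ⟩
           (a ⊠ a ⊞ q ⊠ (four ⊠ (b ⊠ b))) ⊠ (ι (ℤ.+ 6) ⊠ (a ⊠ a ⊠ b) ⊞ ι (ℤ.+ 8) ⊠ (q ⊠ (b ⊠ b ⊠ b)))
             ≈⟨ solve 3 (λ x a b → (a :* a :+ x :* (con (ℤ.+ 4) :* (b :* b))) :*
                  (con (ℤ.+ 6) :* (a :* a :* b) :+ con (ℤ.+ 8) :* (x :* (b :* b :* b)))
                  := con (ℤ.+ 6) :* (a :^ 4 :* b) :+ x :^ 2 :* (con (ℤ.+ 32) :* b :^ 5) :+ x :*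
                      (con (ℤ.+ 32) :* (a :^ 2 :* b :^ 3))) ≈-refl q a b ⟩
           ι (ℤ.+ 6) ⊠ (a ⇡ 4 ⊠ b) ⊞ q ⇡ 2 ⊠ (ι (ℤ.+ 32) ⊠ b ⇡ 5) ⊞ q ⊠ (ι (ℤ.+ 32) ⊠ (a ⇡ 2 ⊠ b ⇡ 3))
             ≈⟨ ≈-trans (D-⊞ _ _) (≈-trans (D-ι⊠ _ _) (⊠-congˡ (≈-trans (D-⊠ _ _) (⊠-congʳ (D-⇡ F 4)))) ⟨⊞⟩
                  ≈-trans (D-q⊠ _) (⊠-congˡ (≈-trans (D-ι⊠ _ _) (⊠-congˡ (D-⇡ Ψ₂ 5)))))
                ⟨⊞⟩ ⊠-congˡ (≈-trans (D-ι⊠ _ _) (⊠-congˡ (≈-trans (D-⊠ _ _) (D-⇡ F 2 ⟨⊠⟩ D-⇡ Ψ₂ 3)))) ⟨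
           D A ⊞ q ⊠ D (ι (ℤ.+ 32) ⊠ (F ⇡ 2 ⊠ Ψ₂ ⇡ 3)) ∎) ⟩
    section 2 0 (D A ⊞ q ⊠ D (ι (ℤ.+ 32) ⊠ (F ⇡ 2 ⊠ Ψ₂ ⇡ 3)))
      ≈⟨ section-even A _ ⟩
    A ∎
    where
    A : Series
    A = ι (ℤ.+ 6) ⊠ (F ⇡ 4 ⊠ Ψ₂) ⊞ q ⊠ (ι (ℤ.+ 32) ⊠ Ψ₂ ⇡ 5)

  -- `g` is the even part of `φ(q)⁴`, and `h` is `g` with `q²` replaced by `q`.
  g h : Series
  h = F ⇡ 4 ⊞ ι (ℤ.+ 16) ⊠ (q ⊠ Ψ₂ ⇡ 4)
  g = D h

  g-≈ : g ≈ a ⇡ 4 ⊞ ι (ℤ.+ 16) ⊠ (q ⇡ 2 ⊠ b ⇡ 4)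
  g-≈ = ≈-trans (D-⊞ _ _) (D-⇡ F 4 ⟨⊞⟩ ≈-trans (D-ι⊠ _ _) (⊠-congˡ (≈-trans (D-q⊠ _) (⊠-congˡ (D-⇡ Ψ₂ 4)))))

  Ψ₂⁴ : a ⇡ 2 ⊠ b ⇡ 2 ≈ Ψ₂ ⇡ 4
  Ψ₂⁴ = ≈-trans (solve 2 (λ a b → a :^ 2 :* b :^ 2 := (a :* b) :* (a :* b)) ≈-refl a b)
    (≈-trans (≈-sym Ψ₂² ⟨⊠⟩ ≈-sym Ψ₂²) (solve 1 (λ p → (p :* p) :* (p :* p) := p :^ 4) ≈-refl Ψ₂))

  F⁴ : F ⇡ 4 ≈ g ⊞ ι (ℤ.+ 8) ⊠ (q ⊠ Ψ₂ ⇡ 4)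
  F⁴ = ≈-trans (solve 1 (λ f → f :^ 4 := f :* f :* (f :* f)) ≈-refl F) (≈-trans (F² ⟨⊠⟩ F²)
    (≈-trans (solve 3 (λ x a b → (a :* a :+ x :* (con (ℤ.+ 4) :* (b :* b))) :*
        (a :* a :+ x :* (con (ℤ.+ 4) :* (b :* b)))
       := (a :^ 4 :+ con (ℤ.+ 16) :* (x :^ 2 :* b :^ 4)) :+ con (ℤ.+ 8) :*
           (x :* (a :^ 2 :* b :^ 2))) ≈-refl q a b)
     (≈-sym g-≈ ⟨⊞⟩ ⊠-congˡ (⊠-congˡ Ψ₂⁴))))

  M⁴ : M ⇡ 4 ≈ g ⊞ ⊟ (ι (ℤ.+ 8) ⊠ (q ⊠ Ψ₂ ⇡ 4))
  M⁴ = ≈-trans (solve 1 (λ f → f :^ 4 := f :* f :* (f :* f)) ≈-refl M) (≈-trans (M² ⟨⊠⟩ M²)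
    (≈-trans (solve 3 (λ x a b → (a :* a :- x :* (con (ℤ.+ 4) :* (b :* b))) :*
        (a :* a :- x :* (con (ℤ.+ 4) :* (b :* b)))
       := (a :^ 4 :+ con (ℤ.+ 16) :* (x :^ 2 :* b :^ 4)) :- con (ℤ.+ 8) :*
           (x :* (a :^ 2 :* b :^ 2))) ≈-refl q a b)
     (≈-sym g-≈ ⟨⊞⟩ (⟨⊟⟩ ⊠-congˡ (⊠-congˡ Ψ₂⁴)))))

  -- Jacobi's quartic identity: `φ(q)⁴` and `φ(-q)⁴` share the even part `g` and have opposite odd
  -- parts.
  F⁴-M⁴ : F ⇡ 4 ≈ M ⇡ 4 ⊞ ι (ℤ.+ 16) ⊠ (q ⊠ Ψ₂ ⇡ 4)
  F⁴-M⁴ = ≈-trans F⁴ (≈-trans (solve 2 (λ g p → g :+ con (ℤ.+ 8) :* p :=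
      (g :- con (ℤ.+ 8) :* p) :+ con (ℤ.+ 16) :* p) ≈-refl g (q ⊠ Ψ₂ ⇡ 4))
    (⊞-congʳ (≈-sym M⁴)))

  -- With `z = 16 q ψ(q²)⁴`, `h` is `M⁴ + 2z`. Its square is `M⁸ + 4z (M⁴ + z)`, where `M⁴ + z = F⁴`
  -- and `F Ψ₂ = Ψ²`.
  h² : h ⇡ 2 ≈ M ⇡ 8 ⊞ ι (ℤ.+ 64) ⊠ (q ⊠ Ψ ⇡ 8)
  h² = begin
    h ⇡ 2
      ≈⟨ ⇡-congˡ 2 (⊞-congʳ F⁴-M⁴) ⟩
    (M ⇡ 4 ⊞ ι (ℤ.+ 16) ⊠ (q ⊠ Ψ₂ ⇡ 4) ⊞ ι (ℤ.+ 16) ⊠ (q ⊠ Ψ₂ ⇡ 4)) ⇡ 2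
      ≈⟨ solve 3 (λ m x p → (m :^ 4 :+ con (ℤ.+ 16) :* (x :* p) :+ con (ℤ.+ 16) :* (x :* p)) :^ 2
           := m :^ 8 :+ con (ℤ.+ 64) :* (x :* ((m :^ 4 :+ con (ℤ.+ 16) :* (x :* p)) :* p))) ≈-refl M
               q (Ψ₂ ⇡ 4) ⟩
    M ⇡ 8 ⊞ ι (ℤ.+ 64) ⊠ (q ⊠ ((M ⇡ 4 ⊞ ι (ℤ.+ 16) ⊠ (q ⊠ Ψ₂ ⇡ 4)) ⊠ Ψ₂ ⇡ 4))
      ≈⟨ ⊞-congˡ (⊠-congˡ (⊠-congˡ (⊠-congʳ F⁴-M⁴))) ⟨
    M ⇡ 8 ⊞ ι (ℤ.+ 64) ⊠ (q ⊠ (F ⇡ 4 ⊠ Ψ₂ ⇡ 4))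
      ≈⟨ ⊞-congˡ (⊠-congˡ (⊠-congˡ (≈-trans (solve 2 (λ f p → f :^ 4 :* p :^ 4 := (f :* p) :^ 4) ≈-refl F Ψ₂)
           (≈-trans (⇡-congˡ 4 (≈-sym Ψ²)) (solve 1 (λ p → (p :* p) :^ 4 := p :^ 8) ≈-refl Ψ))))) ⟩
    M ⇡ 8 ⊞ ι (ℤ.+ 64) ⊠ (q ⊠ Ψ ⇡ 8) ∎

  M-unit : M 0 ≡ 1ℤ
  M-unit = trans (at (φ-neg-product Ord-q) 0)
    (unit-⊠ {e q ⊠ e q} (unit-⊠ {e q} (e-unit Ord-q) (e-unit Ord-q)) (Euler-unit (Ord-⊟ (Ord-⊠ˡ Ord-q))))

  N₅-M : M ⇡ 8 ⊠ N₅ ≈ ι (ℤ.+ 6) ⊠ (Ψ ⊠ M ⇡ 8) ⊞ ι (ℤ.+ 1024) ⊠ (q ⊠ Ψ ⇡ 9)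
  N₅-M = begin
    M ⇡ 8 ⊠ N₅
      ≈⟨ section-[]⊠ (s≤s z≤n) (M ⇡ 8) N₄ ⟨
    section 2 0 (D (M ⇡ 8) ⊠ N₄)
      ≈⟨ section-cong 2 0 (begin
           D (M ⇡ 8) ⊠ N₄
             ≈⟨ ⊠-congʳ (≈-trans ([]-congʳ (solve 1 (λ m → m :^ 8 := (m :* m) :^ 4) ≈-refl M))
                  (≈-trans (D-⇡ _ 4) (⇡-congˡ 4 (≈-sym F-M)))) ⟩
           (F ⊠ M) ⇡ 4 ⊠ N₄
             ≈⟨ solve 3 (λ f m n → (f :* m) :^ 4 :* n := f :^ 4 :* (m :^ 4 :* n)) ≈-refl F M N₄ ⟩
           F ⇡ 4 ⊠ (M ⇡ 4 ⊠ N₄)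
             ≈⟨ ⊠-congˡ N₄-≈ ⟩
           F ⇡ 4 ⊠ (ι (ℤ.+ 6) ⊠ (F ⇡ 4 ⊠ Ψ₂) ⊞ q ⊠ (ι (ℤ.+ 32) ⊠ Ψ₂ ⇡ 5))
             ≈⟨ F⁴ ⟨⊠⟩ ⊞-congʳ (⊠-congˡ (⊠-congʳ F⁴)) ⟩
           (g ⊞ ι (ℤ.+ 8) ⊠ (q ⊠ Ψ₂ ⇡ 4)) ⊠ (ι (ℤ.+ 6) ⊠ ((g ⊞ ι (ℤ.+ 8) ⊠ (q ⊠ Ψ₂ ⇡ 4)) ⊠ Ψ₂) ⊞ q ⊠
               (ι (ℤ.+ 32) ⊠ Ψ₂ ⇡ 5))
             -- `640 = 6 · 8² + 8 · 32`.
             ≈⟨ solve 3 (λ x g p → (g :+ con (ℤ.+ 8) :* (x :* p :^ 4)) :*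
                  (con (ℤ.+ 6) :* ((g :+ con (ℤ.+ 8) :* (x :* p :^ 4)) :* p) :+ x :* (con (ℤ.+ 32) :* p :^ 5))
                  := con (ℤ.+ 6) :* (p :* g :^ 2) :+ x :^ 2 :* (con (ℤ.+ 640) :* p :^ 9) :+ x :*
                      (con (ℤ.+ 128) :* (g :* p :^ 5))) ≈-refl q g Ψ₂ ⟩
           ι (ℤ.+ 6) ⊠ (Ψ₂ ⊠ g ⇡ 2) ⊞ q ⇡ 2 ⊠ (ι (ℤ.+ 640) ⊠ Ψ₂ ⇡ 9) ⊞ q ⊠ (ι (ℤ.+ 128) ⊠ (g ⊠ Ψ₂ ⇡ 5))
             ≈⟨ ≈-trans (D-⊞ _ _) (≈-trans (D-ι⊠ _ _) (⊠-congˡ (≈-trans (D-⊠ _ _) (⊠-congˡ (D-⇡ h 2)))) ⟨⊞⟩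
                  ≈-trans (D-q⊠ _) (⊠-congˡ (≈-trans (D-ι⊠ _ _) (⊠-congˡ (D-⇡ Ψ 9)))))
                ⟨⊞⟩ ⊠-congˡ (≈-trans (D-ι⊠ _ _) (⊠-congˡ (≈-trans (D-⊠ _ _) (⊠-congˡ (D-⇡ Ψ 5))))) ⟨
           D A ⊞ q ⊠ D (ι (ℤ.+ 128) ⊠ (h ⊠ Ψ ⇡ 5)) ∎) ⟩
    section 2 0 (D A ⊞ q ⊠ D (ι (ℤ.+ 128) ⊠ (h ⊠ Ψ ⇡ 5)))
      ≈⟨ section-even A _ ⟩
    A
      ≈⟨ ⊞-congʳ (⊠-congˡ (⊠-congˡ h²)) ⟩
    ι (ℤ.+ 6) ⊠ (Ψ ⊠ (M ⇡ 8 ⊞ ι (ℤ.+ 64) ⊠ (q ⊠ Ψ ⇡ 8))) ⊞ q ⊠ (ι (ℤ.+ 640) ⊠ Ψ ⇡ 9)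
      -- `1024 = 6 · 64 + 640`.
      ≈⟨ solve 3 (λ x p m → con (ℤ.+ 6) :* (p :* (m :+ con (ℤ.+ 64) :* (x :* p :^ 8))) :+ x :*
           (con (ℤ.+ 640) :* p :^ 9)
           := con (ℤ.+ 6) :* (p :* m) :+ con (ℤ.+ 1024) :* (x :* p :^ 9)) ≈-refl q Ψ (M ⇡ 8) ⟩
    ι (ℤ.+ 6) ⊠ (Ψ ⊠ M ⇡ 8) ⊞ ι (ℤ.+ 1024) ⊠ (q ⊠ Ψ ⇡ 9) ∎
    where
    A : Series
    A = ι (ℤ.+ 6) ⊠ (Ψ ⊠ h ⇡ 2) ⊞ q ⊠ (ι (ℤ.+ 640) ⊠ Ψ ⇡ 9)

  ϱ : Series
  ϱ = ρ q

  Ψ-ϱ : Ψ ≈ ϱ ⇡ 3 ⊠ M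
  Ψ-ϱ = ψ-ρ Ord-q

N₅-≈ : N₅ ≈ ι (ℤ.+ 6) ⊠ Ψ ⊞ ι (ℤ.+ 1024) ⊠ (q ⊠ ((ϱ ⇡ 3) ⇡ 9 ⊠ M))
N₅-≈ = ⊠-cancel (M ⇡ 8) (unit-⇡ {M} 8 M-unit) (≈-trans N₅-M (≈-trans
  (⊞-congˡ (⊠-congˡ (⊠-congˡ (⇡-congˡ 9 Ψ-ϱ))))
  (solve 4 (λ x p m r → con (ℤ.+ 6) :* (p :* m :^ 8) :+ con (ℤ.+ 1024) :* (x :* (r :* m) :^ 9)
    := m :^ 8 :* (con (ℤ.+ 6) :* p :+ con (ℤ.+ 1024) :* (x :* (r :^ 9 :* m)))) ≈-refl q Ψ M (ϱ ⇡ 3))))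

-- Congruences modulo 27

private
  infix 4 _≡₂₇_
  -- Carrying the quotient as a series reduces each congruence to an identity of power series within
  -- reach of the ring solver.
  record _≡₂₇_ (f g : Series) : Set where
    constructor modulo
    field
      {quotient} : Series
      equation   : f ≈ g ⊞ ι (ℤ.+ 27) ⊠ quotient

  ≈⇒≡₂₇ : ∀ {f g} → f ≈ g → f ≡₂₇ g
  ≈⇒≡₂₇ {f} {g} p = modulo {quotient = ι 0ℤ} (≈-trans p
      (solve 1 (λ g → g := g :+ con (ℤ.+ 27) :* con 0ℤ) ≈-refl g))

  ≡₂₇-trans : ∀ {f g h} → f ≡₂₇ g → g ≡₂₇ h → f ≡₂₇ h
  ≡₂₇-trans {h = h} (modulo {x} p) (modulo {y} r) = modulo {quotient = y ⊞ x} (≈-trans p (≈-trans (⊞-congʳ r)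
    (solve 3 (λ h x y → h :+ con (ℤ.+ 27) :* y :+ con (ℤ.+ 27) :* x := h :+ con (ℤ.+ 27) :*
        (y :+ x)) ≈-refl h x y)))

  ≡₂₇-section : ∀ k r {f g} → f ≡₂₇ g → section k r f ≡₂₇ section k r g
  ≡₂₇-section k r {f} {g} (modulo {x} p) = modulo (≈-trans (section-cong k r p)
    (≈-trans (section-⊞ k r g _) (⊞-congˡ (section-ι k r (ℤ.+ 27) x))))

  ≡₂₇-⊞ : ∀ {f f′ g g′} → f ≡₂₇ f′ → g ≡₂₇ g′ → f ⊞ g ≡₂₇ f′ ⊞ g′
  ≡₂₇-⊞ {f′ = f} {g′ = g} (modulo {x} p) (modulo {y} r) = modulo {quotient = x ⊞ y} (≈-trans (p ⟨⊞⟩ r)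
    (solve 4 (λ f g x y → (f :+ con (ℤ.+ 27) :* x) :+ (g :+ con (ℤ.+ 27) :* y) := f :+ g :+ con
        (ℤ.+ 27) :* (x :+ y)) ≈-refl f g x y))

  ≡₂₇-⊠ : ∀ h {f g} → f ≡₂₇ g → h ⊠ f ≡₂₇ h ⊠ g
  ≡₂₇-⊠ h {g = g} (modulo {x} p) = modulo {quotient = h ⊠ x} (≈-trans (⊠-congˡ p)
    (solve 3 (λ h g x → h :* (g :+ con (ℤ.+ 27) :* x) := h :* g :+ con (ℤ.+ 27) :* (h :* x)) ≈-refl h g x))

  -- The 3-dissections of `ψ(q)`, `φ(-q)` and `ρ(q)³`

  C : Series → Series
  C f = f [ q ⇡ 3 ]

  o₃ : Ord 1 (q ⇡ 3)
  o₃ = oQ 2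

  C-⊠ : ∀ f g → C (f ⊠ g) ≈ C f ⊠ C g
  C-⊠ f g = []-⊠ f g o₃

  C-⇡ : ∀ f n → C (f ⇡ n) ≈ C f ⇡ n
  C-⇡ f n = []-⇡ f n o₃

  C-q⊠ : ∀ f → C (q ⊠ f) ≈ q ⇡ 3 ⊠ C f
  C-q⊠ f = ≈-trans (C-⊠ q f) (⊠-congʳ ([]-q _ o₃))

  C-ι⊠ : ∀ k f → C (ι k ⊠ f) ≈ ι k ⊠ C f
  C-ι⊠ k f = ≈-trans (C-⊠ (ι k) f) (⊠-congʳ ([]-ι k (q ⇡ 3) o₃))

  C-⊞ : ∀ f g → C (f ⊞ g) ≈ C f ⊞ C g
  C-⊞ f g = []-⊞ f g (q ⇡ 3)

  section₀-C⊠ : ∀ f g → section 3 0 (C f ⊠ g) ≈ f ⊠ section 3 0 g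
  section₀-C⊠ = section-[]⊠ (s≤s z≤n)

  section₀-C : ∀ f → section 3 0 (C f) ≈ f
  section₀-C = section-[]-zero 2

  section₀-qC : ∀ f → section 3 0 (q ⊠ C f) ≈ ι 0ℤ
  section₀-qC f = ≈-trans (section-q⊠-zero 2 (C f))
      (≈-trans (⊠-congˡ (section-[]-suc (s≤s (s≤s (s≤s z≤n))) f)) (zeroʳ q))

  section₁-C : ∀ f → section 3 1 (C f) ≈ ι 0ℤ
  section₁-C f = section-[]-suc (s≤s (s≤s z≤n)) f

  section₂-C : ∀ f → section 3 2 (C f) ≈ ι 0ℤ
  section₂-C f = section-[]-suc (s≤s (s≤s (s≤s z≤n))) f

  section₀-qqC : ∀ f → section 3 0 (q ⊠ (q ⊠ C f)) ≈ ι 0ℤ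
  section₀-qqC f = ≈-trans (section-q⊠-zero 2 _) (≈-trans
      (⊠-congˡ (≈-trans (section-q⊠-suc 3 1 (C f)) (section₁-C f))) (zeroʳ q))

  -- p, P, K and R are φ(-q³), φ(-q⁹), κ(q³) and ρ(q³).
  p k P K R : Series
  p = C M
  k = κ q
  P = C p
  K = C k
  R = C ϱ

  p-≈ : φ (⊟ q ⇡ 3) ≈ p
  p-≈ = ≈-sym (φ-[] o⊟ o₃ (⊟q-[] 2))

  α-≈ : α q ≈ ϱ ⊠ p
  α-≈ = ≈-trans (α-ρ Ord-q) (⊠-congˡ p-≈)

  κ-≈ : ϱ ⊠ k ≈ C Ψ
  κ-≈ = ≈-trans (ρ-κ Ord-q) (≈-sym (ψ-[] Ord-q o₃ ([]-q _ o₃)))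

  Ψ-split : Ψ ≈ C (ϱ ⊠ p) ⊞ q ⊠ C (C Ψ)
  Ψ-split = ≈-trans (ψ-dissect₃ Ord-q) (α₃ ⟨⊞⟩ ⊠-congˡ ψ₉)
    where
    α₃ : α (q ⇡ 3) ≈ C (ϱ ⊠ p)
    α₃ = ≈-trans (≈-sym (≈-trans ([]-Θ (Ord-⇡suc 1 Ord-q) Ord-q o₃)
        (Θ-cong (≈-trans ([]-⇡ q 2 o₃) (⇡-congˡ 2 ([]-q _ o₃))) ([]-q _ o₃)))) ([]-congʳ α-≈)
    ψ₉ : ψ (q ⇡ 9) ≈ C (C Ψ)
    ψ₉ = ≈-sym (≈-trans ([]-congʳ (ψ-[] Ord-q o₃ ([]-q _ o₃))) (ψ-[] o₃ o₃ (q⇡-[] 3 2)))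

  M-split : M ≈ P ⊞ q ⊠ C (ι (ℤ.- (ℤ.+ 2)) ⊠ k)
  M-split = begin
    M
      ≈⟨ φ-dissect₃ o⊟ ⟩
    φ ((⊟ q) ⇡ 9) ⊞ two ⊠ (⊟ q ⊠ Θ ((⊟ q) ⇡ 15) ((⊟ q) ⇡ 3))
      -- As 15 and 3 are odd, the second theta function at `-q` is `κ(q³)`.
      ≈⟨ Θ-cong n₉ n₉ ⟨⊞⟩ ⊠-congˡ (⊠-congˡ (Θ-cong
           (solve 1 (λ x → (:- x) :^ 15 := :- ((x :^ 3) :^ 5)) ≈-refl q)
               (solve 1 (λ x → (:- x) :^ 3 := :- (x :^ 3)) ≈-refl q))) ⟩
    φ (⊟ q ⇡ 9) ⊞ two ⊠ (⊟ q ⊠ κ (q ⇡ 3))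
      ≈⟨ ≈-trans ([]-congʳ (≈-sym p-≈)) (φ-[] (Ord-⊟ o₃) o₃ (≈-trans ([]-⊟ _ o₃) (⟨⊟⟩ q⇡-[] 3 2)))
           ⟨⊞⟩ ⊠-congˡ (⊠-congˡ
           (≈-trans ([]-Θ (Ord-⊟ (oQ 4)) o⊟ o₃) (Θ-cong
               (≈-trans ([]-⊟ _ o₃) (⟨⊟⟩ ≈-trans ([]-⇡ q 5 o₃) (⇡-congˡ 5 ([]-q _ o₃)))) (⊟q-[] 2)))) ⟨
    P ⊞ two ⊠ (⊟ q ⊠ K)
      ≈⟨ ⊞-congˡ (≈-trans (⊠-congˡ (C-ι⊠ _ k)) (solve 2
           (λ x c → x :* (con (ℤ.- (ℤ.+ 2)) :* c) := con (ℤ.+ 2) :* (:- x :* c)) ≈-refl q K)) ⟨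
    P ⊞ q ⊠ C (ι (ℤ.- (ℤ.+ 2)) ⊠ k) ∎
    where
    n₉ : (⊟ q) ⇡ 9 ≈ ⊟ q ⇡ 9
    n₉ = solve 1 (λ x → (:- x) :^ 9 := :- (x :^ 9)) ≈-refl q

  -- As `e` is inverse to `ρ`, `ê = 1/ρ(q³)` and `γ = ρ(q³)³ / ρ(q)`, while `S = ρ(q⁹)`. Then `w` is
  -- the quotient of the two components `q ψ(q⁹)` and `α(q³)` of `ψ(q)`.
  ê S γ w : Series
  ê = C (e q)
  S = C R
  γ = e q ⊠ R ⇡ 3
  w = q ⊠ C γ

  ϱe : ϱ ⊠ e q ≈ 𝟙
  ϱe = ρ-e Ord-q

  Rê : R ⊠ ê ≈ 𝟙
  Rê = ≈-trans (≈-sym (C-⊠ ϱ (e q))) (≈-trans ([]-congʳ ϱe) ([]-𝟙 _ o₃))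

  CΨ : C Ψ ≈ R ⇡ 3 ⊠ p
  CΨ = ≈-trans ([]-congʳ Ψ-ϱ) (≈-trans (C-⊠ _ M) (⊠-congʳ (C-⇡ ϱ 3)))

  k-≈ : k ≈ γ ⊠ p
  k-≈ = begin
    k                      ≈⟨ *-identityˡ k ⟨
    𝟙 ⊠ k                  ≈⟨ ⊠-congʳ ϱe ⟨
    ϱ ⊠ e q ⊠ k            ≈⟨ solve 3 (λ r e k → r :* e :* k := e :* (r :* k)) ≈-refl ϱ (e q) k ⟩
    e q ⊠ (ϱ ⊠ k)          ≈⟨ ⊠-congˡ (≈-trans κ-≈ CΨ) ⟩
    e q ⊠ (R ⇡ 3 ⊠ p)      ≈⟨ *-assoc _ _ _ ⟨
    γ ⊠ p                  ∎

  K-≈ : K ≈ C γ ⊠ P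
  K-≈ = ≈-trans ([]-congʳ k-≈) (C-⊠ γ p)

  Ψ-w : Ψ ≈ R ⊠ P ⊠ (𝟙 ⊞ w)
  Ψ-w = begin
    Ψ                                  ≈⟨ Ψ-split ⟩
    C (ϱ ⊠ p) ⊞ q ⊠ C (C Ψ)            ≈⟨ C-⊠ ϱ p ⟨⊞⟩ ⊠-congˡ
        (≈-trans ([]-congʳ (≈-sym κ-≈)) (≈-trans (C-⊠ ϱ k) (⊠-congˡ K-≈))) ⟩
    R ⊠ P ⊞ q ⊠ (R ⊠ (C γ ⊠ P))        ≈⟨ solve 4
        (λ r p x g → r :* p :+ x :* (r :* (g :* p)) := r :* p :* (x :^ 0 :+ x :* g)) ≈-refl R P q (C γ) ⟩
    R ⊠ P ⊠ (𝟙 ⊞ w)                    ∎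

  qψ₉ : q ⊠ C (C Ψ) ≈ R ⊠ P ⊠ w
  qψ₉ = ≈-trans (⊠-congˡ (≈-trans ([]-congʳ (≈-sym κ-≈)) (≈-trans (C-⊠ ϱ k) (⊠-congˡ K-≈))))
    (solve 4 (λ r p x g → x :* (r :* (g :* p)) := r :* p :* (x :* g)) ≈-refl R P q (C γ))

  v : Series
  v = 𝟙 ⊞ ι (ℤ.- (ℤ.+ 2)) ⊠ w

  M-w : M ≈ P ⊠ v
  M-w = ≈-trans M-split (≈-trans (⊞-congˡ (⊠-congˡ (≈-trans (C-ι⊠ _ k) (⊠-congˡ K-≈))))
    (solve 3 (λ p x g → p :+ x :* (con (ℤ.- (ℤ.+ 2)) :* (g :* p)) := p :*
        (x :^ 0 :+ con (ℤ.- (ℤ.+ 2)) :* (x :* g))) ≈-refl P q (C γ)))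

  P-unit : P 0 ≡ 1ℤ
  P-unit = []-unit p o₃ ([]-unit M o₃ M-unit)
    where
    []-unit : ∀ f {s} → Ord 1 s → f 0 ≡ 1ℤ → (f [ s ]) 0 ≡ 1ℤ
    []-unit f {s} o f₀ = trans (at ([]-uncons f o) 0) (trans (⊞-at (ι (f 0)) _ 0)
      (trans (cong₂ ℤ._+_ f₀ (vanish (Ord-⊠ˡ o) (s≤s z≤n))) refl))

  v-unit : v 0 ≡ 1ℤ
  v-unit = unit-⊞ {𝟙} refl (Ord-⊠ʳ (Ord-⊠ˡ Ord-q))

  y : Series
  y = w ⊠ inverse v

  y-v : y ⊠ v ≈ w
  y-v = ≈-trans (solve 3 (λ w i v → w :* i :* v := w :* (v :* i)) ≈-refl w (inverse v) v)
    (≈-trans (⊠-congˡ (⊠-inverse v-unit)) (*-identityʳ w))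

  three : Series
  three = ι (ℤ.+ 3)

  -- `ρ³` is the quotient of `ψ(q)` by `φ(-q)`, whose common factor `φ(-q⁹)` cancels, and
  -- `(1 + w) / (1 - 2w) = 1 + 3y`.
  ϱ³ : ϱ ⇡ 3 ≈ R ⊠ (𝟙 ⊞ three ⊠ y)
  ϱ³ = ⊠-cancel v v-unit (⊠-cancel P P-unit (begin
    P ⊠ (v ⊠ ϱ ⇡ 3)                        ≈⟨ solve 3
        (λ p v r → p :* (v :* r) := r :* (p :* v)) ≈-refl P v (ϱ ⇡ 3) ⟩
    ϱ ⇡ 3 ⊠ (P ⊠ v)                        ≈⟨ ⊠-congˡ M-w ⟨
    ϱ ⇡ 3 ⊠ M                              ≈⟨ ≈-trans (≈-sym Ψ-ϱ) Ψ-w ⟩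
    R ⊠ P ⊠ (𝟙 ⊞ w)                        ≈⟨ solve 3
        (λ r p w → r :* p :* (r :^ 0 :+ w) := p :*
            (r :* ((r :^ 0 :+ con (ℤ.- (ℤ.+ 2)) :* w) :+ con (ℤ.+ 3) :* w))) ≈-refl R P w ⟩
    P ⊠ (R ⊠ (v ⊞ three ⊠ w))              ≈⟨ ⊠-congˡ (⊠-congˡ (⊞-congˡ (⊠-congˡ y-v))) ⟨
    P ⊠ (R ⊠ (v ⊞ three ⊠ (y ⊠ v)))        ≈⟨ ⊠-congˡ
        (solve 3 (λ r v y → r :* (v :+ con (ℤ.+ 3) :* (y :* v)) := v :*
            (r :* (r :^ 0 :+ con (ℤ.+ 3) :* y))) ≈-refl R v y) ⟩
    P ⊠ (v ⊠ (R ⊠ (𝟙 ⊞ three ⊠ y)))        ∎))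

  -- The cube of 1 + 3 y is 1 + 9 t, and the cube of that is 1 modulo 27.
  t : Series
  t = y ⊞ three ⊠ (y ⇡ 2 ⊞ y ⇡ 3)

  ϱ⁹ : (ϱ ⇡ 3) ⇡ 3 ≈ R ⇡ 3 ⊠ (𝟙 ⊞ ι (ℤ.+ 9) ⊠ t)
  ϱ⁹ = ≈-trans (⇡-congˡ 3 ϱ³) (solve 2 (λ r y → (r :* (r :^ 0 :+ con (ℤ.+ 3) :* y)) :^ 3
    := r :^ 3 :* (r :^ 0 :+ con (ℤ.+ 9) :* (y :+ con (ℤ.+ 3) :* (y :^ 2 :+ y :^ 3)))) ≈-refl R y)

  ϱ²⁷ : (ϱ ⇡ 3) ⇡ 9 ≡₂₇ R ⇡ 9
  ϱ²⁷ = modulo {quotient = R ⇡ 9 ⊠ (t ⊞ ι (ℤ.+ 9) ⊠ t ⇡ 2 ⊞ ι (ℤ.+ 27) ⊠ t ⇡ 3)}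
      (≈-trans (≈-sym (⇡-* (ϱ ⇡ 3) 3 3)) (≈-trans (⇡-congˡ 3 ϱ⁹)
    (solve 2 (λ r t → (r :^ 3 :* (r :^ 0 :+ con (ℤ.+ 9) :* t)) :^ 3
      := r :^ 9 :+ con (ℤ.+ 27) :* (r :^ 9 :* (t :+ con (ℤ.+ 9) :* t :^ 2 :+ con
          (ℤ.+ 27) :* t :^ 3))) ≈-refl R t)))

  -- The two 3-sections modulo 27

  six -two -eighteen : Series
  six  = ι (ℤ.+ 6)
  -two = ι (ℤ.- (ℤ.+ 2))
  -eighteen = ι (ℤ.- (ℤ.+ 18))

  N₅-mod : N₅ ≡₂₇ six ⊠ Ψ ⊞ -two ⊠ (q ⊠ (C (ϱ ⇡ 9) ⊠ M))
  N₅-mod = ≡₂₇-trans (≈⇒≡₂₇ (≈-trans N₅-≈ (solve 4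
      (λ p x r m → con (ℤ.+ 6) :* p :+ con (ℤ.+ 1024) :* (x :* (r :* m))
      := con (ℤ.+ 6) :* p :+ con (ℤ.+ 1024) :* (x :* m) :* r) ≈-refl Ψ q _ M)))
    (≡₂₇-trans (≡₂₇-⊞ (≈⇒≡₂₇ ≈-refl) (≡₂₇-⊠ (ι (ℤ.+ 1024) ⊠ (q ⊠ M)) ϱ²⁷))
      -- `1024 = -2 + 27 · 38`.
      (modulo {quotient = ι (ℤ.+ 38) ⊠ (q ⊠ (C (ϱ ⇡ 9) ⊠ M))} (≈-trans (⊞-congˡ (⊠-congˡ (≈-sym (C-⇡ ϱ 9))))
        (solve 4 (λ p x r m → con (ℤ.+ 6) :* p :+ con (ℤ.+ 1024) :* (x :* m) :* r
          := con (ℤ.+ 6) :* p :+ con (ℤ.- (ℤ.+ 2)) :* (x :* (r :* m)) :+ con (ℤ.+ 27) :*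
              (con (ℤ.+ 38) :* (x :* (r :* m)))) ≈-refl Ψ q (C (ϱ ⇡ 9)) M))))

  section-linear : ∀ k r a b f g → section k r (ι a ⊠ f ⊞ ι b ⊠ g) ≈ ι a ⊠ section k r f ⊞ ι b ⊠ section k r g
  section-linear k r a b f g = ≈-trans (section-⊞ k r _ _) (section-ι k r a f ⟨⊞⟩ section-ι k r b g)

  section₁-Ψ : section 3 1 Ψ ≈ C Ψ
  section₁-Ψ = ≈-trans (section-cong 3 1 Ψ-split) (≈-trans (section-⊞ 3 1 _ _)
    (≈-trans (section₁-C _ ⟨⊞⟩ ≈-trans (section-q⊠-suc 3 0 _) (section₀-C (C Ψ))) (+-identityˡ _)))

  section₂-Ψ : section 3 2 Ψ ≈ ι 0ℤ
  section₂-Ψ = ≈-trans (section-cong 3 2 Ψ-split) (≈-trans (section-⊞ 3 2 _ _)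
    (≈-trans (section₂-C _ ⟨⊞⟩ ≈-trans (section-q⊠-suc 3 1 _) (section₁-C (C Ψ))) (+-identityˡ _)))

  N₆ N₇ : Series
  N₆ = section 3 1 N₅
  N₇ = section 3 0 N₆

  N₆-mod : N₆ ≡₂₇ six ⊠ C Ψ ⊞ -two ⊠ (ϱ ⇡ 9 ⊠ p)
  N₆-mod = ≡₂₇-trans (≡₂₇-section 3 1 N₅-mod) (≈⇒≡₂₇ (≈-trans (section-linear 3 1 _ _ _ _)
    (⊠-congˡ section₁-Ψ ⟨⊞⟩ ⊠-congˡ (≈-trans (section-q⊠-suc 3 0 _)
        (≈-trans (section₀-C⊠ (ϱ ⇡ 9) M) (⊠-congˡ section₀-M))))))
    where
    section₀-M : section 3 0 M ≈ p
    section₀-M = ≈-trans (section-cong 3 0 M-split) (≈-trans (section-⊞ 3 0 _ _)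
      (≈-trans (section₀-C p ⟨⊞⟩ section₀-qC _) (≈-trans (⊞-comm _ _) (+-identityˡ p))))

  η u : Series
  η = section 3 0 y
  u = q ⊠ γ ⇡ 3

  -- The cofactor `1 + 2w + 4w²` turns `1 - 2w` into `1 - 8w³`, a series in `q³` because
  -- `w³ = u(q³)`. In the cleared equation only `4w³` has exponents divisible by 3. The fixed-point
  -- form avoids dividing by `1 - 8u`.
  η-u : η ≈ ι (ℤ.+ 4) ⊠ u ⊞ ι (ℤ.+ 8) ⊠ (u ⊠ η)
  η-u = begin
    η
      ≈⟨ solve 2 (λ u h → h := (u :^ 0 :+ con (ℤ.- (ℤ.+ 8)) :* u) :* h :+ con (ℤ.+ 8) :*
           (u :* h)) ≈-refl u η ⟩
    (𝟙 ⊞ ι (ℤ.- (ℤ.+ 8)) ⊠ u) ⊠ η ⊞ ι (ℤ.+ 8) ⊠ (u ⊠ η)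
      ≈⟨ ⊞-congʳ (begin
           (𝟙 ⊞ ι (ℤ.- (ℤ.+ 8)) ⊠ u) ⊠ η
             ≈⟨ section₀-C⊠ (𝟙 ⊞ ι (ℤ.- (ℤ.+ 8)) ⊠ u) y ⟨
           section 3 0 (C (𝟙 ⊞ ι (ℤ.- (ℤ.+ 8)) ⊠ u) ⊠ y)
             ≈⟨ section-cong 3 0 cleared ⟩
           section 3 0 (q ⊠ C γ ⊞ (q ⊠ (q ⊠ C (two ⊠ γ ⇡ 2)) ⊞ C (four ⊠ u)))
             ≈⟨ ≈-trans (section-⊞ 3 0 _ _) (section₀-qC γ ⟨⊞⟩ ≈-trans (section-⊞ 3 0 _ _)
                  (section₀-qqC _ ⟨⊞⟩ section₀-C (four ⊠ u))) ⟩
           ι 0ℤ ⊞ (ι 0ℤ ⊞ four ⊠ u)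
             ≈⟨ ≈-trans (+-identityˡ _) (+-identityˡ _) ⟩
           four ⊠ u ∎) ⟩
    four ⊠ u ⊞ ι (ℤ.+ 8) ⊠ (u ⊠ η) ∎
    where
    Cu : C u ≈ q ⇡ 3 ⊠ C γ ⇡ 3
    Cu = ≈-trans (C-q⊠ _) (⊠-congˡ (C-⇡ γ 3))
    cleared : C (𝟙 ⊞ ι (ℤ.- (ℤ.+ 8)) ⊠ u) ⊠ y ≈ q ⊠ C γ ⊞ (q ⊠ (q ⊠ C (two ⊠ γ ⇡ 2)) ⊞ C (four ⊠ u))
    cleared = begin
      C (𝟙 ⊞ ι (ℤ.- (ℤ.+ 8)) ⊠ u) ⊠ y
        ≈⟨ ⊠-congʳ (≈-trans (C-⊞ _ _) ([]-𝟙 _ o₃ ⟨⊞⟩ ≈-trans (C-ι⊠ _ u) (⊠-congˡ Cu))) ⟩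
      (𝟙 ⊞ ι (ℤ.- (ℤ.+ 8)) ⊠ (q ⇡ 3 ⊠ C γ ⇡ 3)) ⊠ y
        ≈⟨ solve 3 (λ x g y → (x :^ 0 :+ con (ℤ.- (ℤ.+ 8)) :* (x :^ 3 :* g :^ 3)) :* y
             := y :* (x :^ 0 :+ con (ℤ.- (ℤ.+ 2)) :* (x :* g)) :*
                 (x :^ 0 :+ con (ℤ.+ 2) :* (x :* g) :+ con (ℤ.+ 4) :* (x :* g) :^ 2)) ≈-refl q (C γ) y ⟩
      y ⊠ v ⊠ (𝟙 ⊞ two ⊠ w ⊞ four ⊠ w ⇡ 2)
        ≈⟨ ⊠-congʳ y-v ⟩
      w ⊠ (𝟙 ⊞ two ⊠ w ⊞ four ⊠ w ⇡ 2)
        ≈⟨ solve 2 (λ x g → (x :* g) :* (x :^ 0 :+ con (ℤ.+ 2) :* (x :* g) :+ con (ℤ.+ 4) :* (x :* g) :^ 2)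
             := x :* g :+ (x :* (x :* (con (ℤ.+ 2) :* g :^ 2)) :+ con (ℤ.+ 4) :*
                 (x :^ 3 :* g :^ 3))) ≈-refl q (C γ) ⟩
      q ⊠ C γ ⊞ (q ⊠ (q ⊠ (two ⊠ C γ ⇡ 2)) ⊞ four ⊠ (q ⇡ 3 ⊠ C γ ⇡ 3))
        ≈⟨ ⊞-congˡ (⊠-congˡ (⊠-congˡ (≈-trans (C-ι⊠ _ _) (⊠-congˡ (C-⇡ γ 2)))) ⟨⊞⟩ ≈-trans
             (C-ι⊠ _ u) (⊠-congˡ Cu)) ⟨
      q ⊠ C γ ⊞ (q ⊠ (q ⊠ C (two ⊠ γ ⇡ 2)) ⊞ C (four ⊠ u)) ∎

  -- γ³ ≡ γ(q³) modulo 3, because ϱ³ ≡ ϱ(q³).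
  A B β τ : Series
  A = R ⊠ y
  B = C A
  β = ι (ℤ.- (ℤ.+ 3)) ⊠ (R ⇡ 6 ⊠ B) ⊞ ι (ℤ.+ 9) ⊠ (R ⇡ 3 ⊠ B ⇡ 2) ⊞ ι (ℤ.- (ℤ.+ 9)) ⊠ B ⇡ 3
  τ = ⊟ (q ⊠ (ê ⊠ β ⊞ e q ⇡ 3 ⊠ ê ⊠ A ⊠ R ⇡ 9))

  S-≈ : S ≈ R ⇡ 3 ⊞ ⊟ (three ⊠ B)
  S-≈ = begin
    S                                          ≈⟨ solve 2
        (λ s b → s := s :+ con (ℤ.+ 3) :* b :- con (ℤ.+ 3) :* b) ≈-refl S B ⟩
    S ⊞ three ⊠ B ⊞ ⊟ (three ⊠ B)              ≈⟨ ⊞-congʳ (≈-trans (C-⊞ R _) (⊞-congˡ (C-ι⊠ _ A))) ⟨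
    C (R ⊞ three ⊠ A) ⊞ ⊟ (three ⊠ B)
      ≈⟨ ⊞-congʳ ([]-congʳ (≈-trans ϱ³ (solve 2 (λ r y → r :* (r :^ 0 :+ con (ℤ.+ 3) :* y)
           := r :+ con (ℤ.+ 3) :* (r :* y)) ≈-refl R y))) ⟨
    C (ϱ ⇡ 3) ⊞ ⊟ (three ⊠ B)                  ≈⟨ ⊞-congʳ (C-⇡ ϱ 3) ⟩
    R ⇡ 3 ⊞ ⊟ (three ⊠ B)                      ∎

  -- `3β` is the cube of `R³ - 3B` without its leading term `R⁹`.
  Cγ : C γ ≈ ê ⊠ (R ⇡ 9 ⊞ three ⊠ β)
  Cγ = ≈-trans (C-⊠ (e q) _) (⊠-congˡ (≈-trans (C-⇡ R 3) (≈-trans (⇡-congˡ 3 S-≈)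
    (solve 2 (λ r b → (r :^ 3 :- con (ℤ.+ 3) :* b) :^ 3 := r :^ 9 :+ con (ℤ.+ 3) :*
       (con (ℤ.- (ℤ.+ 3)) :* (r :^ 6 :* b) :+ con (ℤ.+ 9) :* (r :^ 3 :* b :^ 2) :+ con
           (ℤ.- (ℤ.+ 9)) :* b :^ 3)) ≈-refl R B))))

  -- Insert `R ê = 1` and write `R` as `R (1 + 3y) - 3A`; then `e³ R (1 + 3y) = e³ ρ³ = 1`.
  e³ : e q ⇡ 3 ≈ ê ⊞ ⊟ (three ⊠ (e q ⇡ 3 ⊠ ê ⊠ A))
  e³ = begin
    e q ⇡ 3
      ≈⟨ ≈-trans (⊠-congˡ Rê) (*-identityʳ _) ⟨
    e q ⇡ 3 ⊠ (R ⊠ ê)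
      ≈⟨ solve 4 (λ e r h y → e :* (r :* h) := h :*
           (e :* (r :* (r :^ 0 :+ con (ℤ.+ 3) :* y))) :- con (ℤ.+ 3) :* (e :* h :* (r :* y))) ≈-refl
               (e q ⇡ 3) R ê y ⟩
    ê ⊠ (e q ⇡ 3 ⊠ (R ⊠ (𝟙 ⊞ three ⊠ y))) ⊞ ⊟ (three ⊠ (e q ⇡ 3 ⊠ ê ⊠ A))
      ≈⟨ ⊞-congʳ (≈-trans (⊠-congˡ (≈-trans (⊠-congˡ (≈-sym ϱ³))
           (≈-trans (solve 2 (λ e r → e :^ 3 :* r :^ 3 := (r :* e) :^ 3) ≈-refl (e q) ϱ)
           (≈-trans (⇡-congˡ 3 ϱe) (solve 1 (λ x → (x :^ 0) :^ 3 := x :^ 0) ≈-refl q))))) (*-identityʳ ê)) ⟩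
    ê ⊞ ⊟ (three ⊠ (e q ⇡ 3 ⊠ ê ⊠ A)) ∎

  u-w : u ≈ w ⊞ three ⊠ τ
  u-w = begin
    q ⊠ (e q ⊠ R ⇡ 3) ⇡ 3
      ≈⟨ ⊠-congˡ (≈-trans (solve 2 (λ e r → (e :* r :^ 3) :^ 3 := e :^ 3 :* r :^ 9) ≈-refl (e q) R)
           (⊠-congʳ e³)) ⟩
    q ⊠ ((ê ⊞ ⊟ (three ⊠ (e q ⇡ 3 ⊠ ê ⊠ A))) ⊠ R ⇡ 9)
      ≈⟨ solve 5 (λ x h d r b → x :* ((h :- con (ℤ.+ 3) :* d) :* r) := x :*
           (h :* (r :+ con (ℤ.+ 3) :* b)) :+ con (ℤ.+ 3) :* (:- (x :* (h :* b :+ d :* r)))) ≈-refl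
           q ê (e q ⇡ 3 ⊠ ê ⊠ A) (R ⇡ 9) β ⟩
    q ⊠ (ê ⊠ (R ⇡ 9 ⊞ three ⊠ β)) ⊞ three ⊠ τ
      ≈⟨ ⊞-congʳ (⊠-congˡ Cγ) ⟨
    w ⊞ three ⊠ τ ∎

  σ : Series
  σ = w ⊞ four ⊠ τ ⊞ three ⊠ (w ⊠ η) ⊞ ι (ℤ.+ 8) ⊠ (τ ⊠ η)

  -- Modulo 3, `η-u` reads `η ≡ u - u η` with `u ≡ w`; `σ` records the exact quotient by 3.
  η-w : (𝟙 ⊞ w) ⊠ η ≈ w ⊞ three ⊠ σ
  η-w = begin
    (𝟙 ⊞ w) ⊠ η
      ≈⟨ solve 2 (λ w h → (w :^ 0 :+ w) :* h := h :+ w :* h) ≈-refl w η ⟩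
    η ⊞ w ⊠ η
      ≈⟨ ⊞-congʳ (≈-trans η-u (⊠-congˡ u-w ⟨⊞⟩ ⊠-congˡ (⊠-congʳ u-w))) ⟩
    four ⊠ (w ⊞ three ⊠ τ) ⊞ ι (ℤ.+ 8) ⊠ ((w ⊞ three ⊠ τ) ⊠ η) ⊞ w ⊠ η
      ≈⟨ solve 3 (λ w t h → con (ℤ.+ 4) :* (w :+ con (ℤ.+ 3) :* t) :+ con (ℤ.+ 8) :*
           ((w :+ con (ℤ.+ 3) :* t) :* h) :+ w :* h
           := w :+ con (ℤ.+ 3) :* (w :+ con (ℤ.+ 4) :* t :+ con (ℤ.+ 3) :* (w :* h) :+ con
               (ℤ.+ 8) :* (t :* h))) ≈-refl w τ η ⟩
    w ⊞ three ⊠ σ ∎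

  -- `R³ φ(-q³)` is `ψ(q³)` and leaves the section as `ψ(q)`. In the other factor `9t ≡ 9y`, since
  -- `t ≡ y` modulo 3.
  section₀-ϱ⁹ : section 3 0 (ϱ ⇡ 9 ⊠ p) ≡₂₇ Ψ ⊠ (𝟙 ⊞ ι (ℤ.+ 9) ⊠ η)
  section₀-ϱ⁹ = ≡₂₇-trans
    (≈⇒≡₂₇ (≈-trans (section-cong 3 0 (≈-trans (⊠-congʳ
        (≈-trans (≈-sym (⇡-* ϱ 3 3)) (≈-trans ϱ⁹ (⊠-congʳ (≈-sym (C-⇡ ϱ 3))))))
        (≈-trans (solve 3 (λ r t m → r :* t :* m := r :* m :* t) ≈-refl (C (ϱ ⇡ 3)) _ p)
            (⊠-congʳ (≈-sym (C-⊠ (ϱ ⇡ 3) M))))))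
      (≈-trans (section₀-C⊠ (ϱ ⇡ 3 ⊠ M) _) (⊠-congʳ (≈-sym Ψ-ϱ)))))
    (≡₂₇-⊠ Ψ (≡₂₇-trans (≡₂₇-section 3 0 (modulo {quotient = y ⇡ 2 ⊞ y ⇡ 3}
        (solve 1 (λ y → y :^ 0 :+ con (ℤ.+ 9) :* (y :+ con (ℤ.+ 3) :* (y :^ 2 :+ y :^ 3))
            := y :^ 0 :+ con (ℤ.+ 9) :* y :+ con (ℤ.+ 27) :* (y :^ 2 :+ y :^ 3)) ≈-refl y)))
      (≈⇒≡₂₇ (≈-trans (section-⊞ 3 0 _ _) (section-𝟙-zero 2 ⟨⊞⟩ section-ι 3 0 (ℤ.+ 9) y)))))

  N₇-mod : N₇ ≡₂₇ four ⊠ Ψ ⊞ -eighteen ⊠ (q ⊠ C (C Ψ))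
  N₇-mod = ≡₂₇-trans (≡₂₇-section 3 0 N₆-mod) (≡₂₇-trans
      (≈⇒≡₂₇ (≈-trans (section-linear 3 0 _ _ _ _) (⊞-congʳ (⊠-congˡ (section₀-C Ψ)))))
    (≡₂₇-trans (≡₂₇-⊞ (≈⇒≡₂₇ ≈-refl) (≡₂₇-⊠ -two section₀-ϱ⁹))
    (modulo {quotient = -two ⊠ (R ⊠ P ⊠ σ)} (begin
      six ⊠ Ψ ⊞ -two ⊠ (Ψ ⊠ (𝟙 ⊞ ι (ℤ.+ 9) ⊠ η))
        ≈⟨ solve 2 (λ p h → con (ℤ.+ 6) :* p :+ con (ℤ.- (ℤ.+ 2)) :*
             (p :* (p :^ 0 :+ con (ℤ.+ 9) :* h)) := con (ℤ.+ 4) :* p :+ con (ℤ.- (ℤ.+ 18)) :*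
                 (p :* h)) ≈-refl Ψ η ⟩
      four ⊠ Ψ ⊞ -eighteen ⊠ (Ψ ⊠ η)
        ≈⟨ ⊞-congˡ (⊠-congˡ (≈-trans (⊠-congʳ Ψ-w) (≈-trans (*-assoc _ _ _) (⊠-congˡ η-w)))) ⟩
      four ⊠ Ψ ⊞ -eighteen ⊠ (R ⊠ P ⊠ (w ⊞ three ⊠ σ))
        -- Here `18 · 3 = 27 · 2`, which is why knowing `(1 + w) η` modulo 3 is enough.
        ≈⟨ solve 4 (λ p a w s → con (ℤ.+ 4) :* p :+ con (ℤ.- (ℤ.+ 18)) :* (a :* (w :+ con (ℤ.+ 3) :* s))
             := con (ℤ.+ 4) :* p :+ con (ℤ.- (ℤ.+ 18)) :* (a :* w) :+ con (ℤ.+ 27) :*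
                 (con (ℤ.- (ℤ.+ 2)) :* (a :* s))) ≈-refl Ψ (R ⊠ P) w σ ⟩
      four ⊠ Ψ ⊞ -eighteen ⊠ (R ⊠ P ⊠ w) ⊞ ι (ℤ.+ 27) ⊠ (-two ⊠ (R ⊠ P ⊠ σ))
        ≈⟨ ⊞-congʳ (⊞-congˡ (⊠-congˡ qψ₉)) ⟨
      four ⊠ Ψ ⊞ -eighteen ⊠ (q ⊠ C (C Ψ)) ⊞ ι (ℤ.+ 27) ⊠ (-two ⊠ (R ⊠ P ⊠ σ)) ∎))))

  zeros : ∀ a b → ι a ⊠ ι 0ℤ ⊞ ι b ⊠ ι 0ℤ ≈ ι 0ℤ
  zeros a b = ≈-trans (zeroʳ (ι a) ⟨⊞⟩ zeroʳ (ι b)) (+-identityˡ _)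

  section₂-N₇ : section 3 2 N₇ ≡₂₇ ι 0ℤ
  section₂-N₇ = ≡₂₇-trans (≡₂₇-section 3 2 N₇-mod) (≈⇒≡₂₇ (≈-trans (section-linear 3 2 _ _ _ _)
    (≈-trans (⊠-congˡ section₂-Ψ ⟨⊞⟩ ⊠-congˡ (≈-trans (section-q⊠-suc 3 1 _) (section₁-C (C Ψ))))
        (zeros (ℤ.+ 4) (ℤ.- (ℤ.+ 18))))))

  -- Both `ψ(q)` and `q ψ(q⁹)` contribute `ψ(q³)` to this section, so it is a series in `q³` modulo
  -- 27 and its own classes 1 and 2 vanish.
  section₁-N₇ : section 3 1 N₇ ≡₂₇ four ⊠ C Ψ ⊞ -eighteen ⊠ C Ψ
  section₁-N₇ = ≡₂₇-trans (≡₂₇-section 3 1 N₇-mod) (≈⇒≡₂₇ (≈-trans (section-linear 3 1 _ _ _ _)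
    (⊠-congˡ section₁-Ψ ⟨⊞⟩ ⊠-congˡ (≈-trans (section-q⊠-suc 3 0 _) (section₀-C (C Ψ))))))

  section₁₁-N₇ : section 3 1 (section 3 1 N₇) ≡₂₇ ι 0ℤ
  section₁₁-N₇ = ≡₂₇-trans (≡₂₇-section 3 1 section₁-N₇) (≈⇒≡₂₇ (≈-trans (section-linear 3 1 _ _ _ _)
    (≈-trans (⊠-congˡ (section₁-C Ψ) ⟨⊞⟩ ⊠-congˡ (section₁-C Ψ)) (zeros (ℤ.+ 4) (ℤ.- (ℤ.+ 18))))))

  section₂₁-N₇ : section 3 2 (section 3 1 N₇) ≡₂₇ ι 0ℤ
  section₂₁-N₇ = ≡₂₇-trans (≡₂₇-section 3 2 section₁-N₇) (≈⇒≡₂₇ (≈-trans (section-linear 3 2 _ _ _ _)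
    (≈-trans (⊠-congˡ (section₂-C Ψ) ⟨⊞⟩ ⊠-congˡ (section₂-C Ψ)) (zeros (ℤ.+ 4) (ℤ.- (ℤ.+ 18))))))

  -- Return to the coefficients of `v₀`

  flip-suc : ∀ f n → (f [ ⊟ q ]) (suc n) ≡ ℤ.- (tail f [ ⊟ q ]) n
  flip-suc f n = trans (at ([]-uncons f o⊟) (suc n))
      (trans (⊞-at (ι (f 0)) _ (suc n)) (trans (ℤ.+-identityˡ _)
    (trans (at (solve 2 (λ x f → :- x :* f := x :* (:- f)) ≈-refl q (tail f [ ⊟ q ])) (suc n))
        (trans (q⊠-at-suc _ n) (⊟-at _ n)))))

  flip-zero : ∀ f → (f [ ⊟ q ]) 0 ≡ f 0
  flip-zero f = trans (at ([]-uncons f o⊟) 0) (trans (⊞-at (ι (f 0)) _ 0)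
    (trans (cong (λ z → f 0 ℤ.+ z) (vanish (Ord-⊠ˡ o⊟) (s≤s z≤n))) (ℤ.+-identityʳ (f 0))))

  flip-even : ∀ f n → (f [ ⊟ q ]) (n * 2) ≡ f (n * 2)
  flip-even f zero    = flip-zero f
  flip-even f (suc n) = trans (flip-suc f (suc (n * 2))) (trans (cong ℤ.-_ (flip-suc (tail f) (n * 2)))
    (trans (ℤ.neg-involutive _) (flip-even (tail (tail f)) n)))

  -- The index is kept positive because at 0 the subtracted 1 would remain.
  W-even : ∀ n → W (suc n * 2) ≡ v₀ (suc n * 2) ℤ.+ v₀ (suc n * 2)
  W-even n = trans (⊞-at (v₀ ⊞ v₀ [ ⊟ q ]) (⊟ 𝟙) (suc n * 2)) (trans
    (cong₂ ℤ._+_ (trans (⊞-at v₀ _ (suc n * 2)) (cong (λ z → v₀ (suc n * 2) ℤ.+ z)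
        (flip-even v₀ (suc n)))) (⊟-at 𝟙 (suc n * 2)))
    (ℤ.+-identityʳ _))

  N₇-index : ∀ n → N₇ n ≡ v₀ (288 * n + 36) ℤ.+ v₀ (288 * n + 36)
  N₇-index n = trans (cong W index) (trans (W-even (144 * n + 17)) (cong (λ i → v₀ i ℤ.+ v₀ i) (sym index′)))
    where
    -- From the inside outwards this undoes the sections from last to first: classes 0 and 1 modulo
    -- 3, then 0, 0, 1, 0, 0 modulo 2.
    index : ((((((n * 3 + 0) * 3 + 1) * 2 + 0) * 2 + 0) * 2 + 1) * 2 + 0) * 2 + 0 ≡ suc (144 * n + 17) * 2
    index = ℕ-solve 1 (λ n → ((((((n ∙ ♯ 3 ∔ ♯ 0) ∙ ♯ 3 ∔ ♯ 1) ∙ ♯ 2 ∔ ♯ 0) ∙ ♯ 2 ∔ ♯ 0) ∙ ♯ 2 ∔ ♯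
        1) ∙ ♯ 2 ∔ ♯ 0) ∙ ♯ 2 ∔ ♯ 0
      ≜ (♯ 1 ∔ (♯ 144 ∙ n ∔ ♯ 17)) ∙ ♯ 2) refl n
    index′ : 288 * n + 36 ≡ suc (144 * n + 17) * 2
    index′ = ℕ-solve 1 (λ n → ♯ 288 ∙ n ∔ ♯ 36 ≜ (♯ 1 ∔ (♯ 144 ∙ n ∔ ♯ 17)) ∙ ♯ 2) refl n

  -- 14 is the inverse of 2 modulo 27: `a = 14 (a + a) - 27a`.
  halve : ∀ a b → a ℤ.+ a ≡ ℤ.+ 27 ℤ.* b → a ≡ (ℤ.+ 14 ℤ.* b ℤ.- a) ℤ.* ℤ.+ 27
  halve a b p = trans (ℤS.solve 1 (λ a → a :≐ ♮ (ℤ.+ 14) :· (a :⊹ a) :∸ a :· ♮ (ℤ.+ 27)) refl a)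
    (trans (cong (λ z → ℤ.+ 14 ℤ.* z ℤ.- a ℤ.* ℤ.+ 27) p)
      (ℤS.solve 2 (λ a b → ♮ (ℤ.+ 14) :· (♮ (ℤ.+ 27) :· b) :∸ a :· ♮ (ℤ.+ 27) :≐
          (♮ (ℤ.+ 14) :· b :∸ a) :· ♮ (ℤ.+ 27)) refl a b))
    where open ℤS using () renaming (con to ♮; _:+_ to _:⊹_; _:-_ to _:∸_; _:*_ to _:·_; _:=_ to _:≐_)

27∣v₀ : ∀ {f} → f ≡₂₇ ι 0ℤ → ∀ i j → f i ≡ N₇ j → (+ 27) ∣ v₀ (288 * j + 36)
27∣v₀ {f} (modulo {x} p) i j f≡N₇ =
  ∣⇒∣ᵤ {+ 27} {v₀ (288 * j + 36)} (divides (ℤ.+ 14 ℤ.* x i ℤ.- v₀ (288 * j + 36))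
      (halve (v₀ (288 * j + 36)) (x i) twice))
  where
  ι0-at : ∀ i → ι 0ℤ i ≡ 0ℤ
  ι0-at zero    = refl
  ι0-at (suc i) = refl
  twice : v₀ (288 * j + 36) ℤ.+ v₀ (288 * j + 36) ≡ ℤ.+ 27 ℤ.* x i
  twice = trans (sym (N₇-index j)) (trans (sym f≡N₇) (trans (at p i) (trans (⊞-at (ι 0ℤ) (ι (ℤ.+ 27) ⊠ x) i)
    (trans (cong₂ ℤ._+_ (ι0-at i) (ι-at (ℤ.+ 27) x i)) (ℤ.+-identityˡ (ℤ.+ 27 ℤ.* x i))))))

theorem5p4 : ∀ (n : ℕ) →
    ((+ 27) ∣ v₀ (3 ^ 2 * (96 * n + 68))) ×
    ((+ 27) ∣ v₀ (3 ^ 3 * (96 * n + 44))) ×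
    ((+ 27) ∣ v₀ (3 ^ 3 * (96 * n + 76)))
theorem5p4 n =
  subst (λ i → (+ 27) ∣ v₀ i) index₁ (27∣v₀ section₂-N₇ n (n * 3 + 2) refl) ,
  subst (λ i → (+ 27) ∣ v₀ i) index₂ (27∣v₀ section₁₁-N₇ n ((n * 3 + 1) * 3 + 1) refl) ,
  subst (λ i → (+ 27) ∣ v₀ i) index₃ (27∣v₀ section₂₁-N₇ n ((n * 3 + 2) * 3 + 1) refl)
  where
  index₁ : 288 * (n * 3 + 2) + 36 ≡ 9 * (96 * n + 68)
  index₁ = ℕ-solve 1 (λ n → ♯ 288 ∙ (n ∙ ♯ 3 ∔ ♯ 2) ∔ ♯ 36 ≜ ♯ 9 ∙ (♯ 96 ∙ n ∔ ♯ 68)) refl n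
  index₂ : 288 * ((n * 3 + 1) * 3 + 1) + 36 ≡ 27 * (96 * n + 44)
  index₂ = ℕ-solve 1 (λ n → ♯ 288 ∙ ((n ∙ ♯ 3 ∔ ♯ 1) ∙ ♯ 3 ∔ ♯ 1) ∔ ♯ 36 ≜ ♯ 27 ∙ (♯ 96 ∙ n ∔ ♯ 44)) refl n
  index₃ : 288 * ((n * 3 + 2) * 3 + 1) + 36 ≡ 27 * (96 * n + 76)
  index₃ = ℕ-solve 1 (λ n → ♯ 288 ∙ ((n ∙ ♯ 3 ∔ ♯ 2) ∙ ♯ 3 ∔ ♯ 1) ∔ ♯ 36 ≜ ♯ 27 ∙ (♯ 96 ∙ n ∔ ♯ 76)) refl n
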